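{- There is a randomized algorithm which, given two matroids $\mathcal{M}_1=(V,\mathcal{I}_1)$ and $\mathcal{M}_2=(V,\mathcal{I}_2)$ on the same ground set $V$ with $|V|=n$ (accessed only through independence oracles), finds a common independent set $S\in\mathcal{I}_1\cap\mathcal{I}_2$ of maximum cardinality $r$, and with high probability (i.e. with probability at least $1-n^{ -c}$, for an arbitrarily large constant $c$) uses $O(nr^{3/4}\log n)$ independence queries. There is also a deterministic algorithm which finds a common independent set of maximum cardinality using $O(nr^{5/6}\log n)$ independence queries.
   Context: A matroid is a pair $\mathcal{M}=(V,\mathcal{I})$ with $V$ a finite ground set and $\mathcal{I}\subseteq 2^V$ a nonempty family of "independent sets" that is downward closed and satisfies the exchange property (if $S,S'\in\mathcal{I}$ and $|S|>|S'|$ then there is $x\in S\setminus S'$ with $S'\cup\{x\}\in\mathcal{I}$). The algorithm accesses the matroids only via independence queries: for a set $S\subseteq V$ and $i\in\{1,2\}$, a query answers whether $S\in\mathcal{I}_i$. Query complexity counts the number of such queries. A common independent set is a set in $\mathcal{I}_1\cap\mathcal{I}_2$; $r$ denotes the size of a largest common independent set. -}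

module Defs where

open import Data.Bool using (Bool; true; false; if_then_else_)
open import Data.Nat using (ℕ; zero; suc; _+_; _*_; _^_; _≤_; _<_; _⊔_; _<ᵇ_)
open import Data.Nat.Logarithm using (⌈log₂_⌉)
open import Data.Fin using (Fin)
open import Data.Fin.Subset using (Subset; ⊥; _⊆_; _∈_; _∉_; _∪_; ⁅_⁆; ∣_∣)
open import Data.Vec using (Vec; []; _∷_)
open import Data.Product using (Σ; ∃; _×_; _,_; proj₁; proj₂)
open import Relation.Binary.PropositionalEquality using (_≡_)

Oracle : ℕ → Set
Oracle n = Subset n → Bool

Indep : ∀ {n} → Oracle n → Subset n → Set
Indep I S = I S ≡ true

-- Matroid axioms (nonempty ⇔ ∅ independent, given downward closure).
record IsMatroid {n : ℕ} (I : Oracle n) : Set where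
  field
    empty    : Indep I ⊥
    downward : ∀ S T → S ⊆ T → Indep I T → Indep I S
    exchange : ∀ S T → Indep I S → Indep I T → ∣ T ∣ < ∣ S ∣ →
               ∃ λ x → x ∈ S × x ∉ T × Indep I (T ∪ ⁅ x ⁆)

CommonIndep : ∀ {n} → Oracle n → Oracle n → Subset n → Set
CommonIndep I₁ I₂ S = Indep I₁ S × Indep I₂ S

MaxCommonIndep : ∀ {n} → Oracle n → Oracle n → Subset n → Set
MaxCommonIndep I₁ I₂ S =
  CommonIndep I₁ I₂ S × (∀ T → CommonIndep I₁ I₂ T → ∣ T ∣ ≤ ∣ S ∣)

data Which : Set where
  M₁ M₂ : Which

-- Query (decision) trees: the model of a deterministic oracle algorithm
-- on ground set Fin n. Internal computation is free; only queries count.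
data QTree (n : ℕ) : Set where
  leaf  : Subset n → QTree n
  query : Which → Subset n → (Bool → QTree n) → QTree n

ask : ∀ {n} → Which → Oracle n → Oracle n → Subset n → Bool
ask M₁ I₁ I₂ S = I₁ S
ask M₂ I₁ I₂ S = I₂ S

run : ∀ {n} → QTree n → Oracle n → Oracle n → Subset n × ℕ
run (leaf S) I₁ I₂ = S , 0
run (query w S k) I₁ I₂ with run (k (ask w I₁ I₂ S)) I₁ I₂
... | T , q = T , suc q

output : ∀ {n} → QTree n → Oracle n → Oracle n → Subset n
output t I₁ I₂ = proj₁ (run t I₁ I₂)

queries : ∀ {n} → QTree n → Oracle n → Oracle n → ℕ
queries t I₁ I₂ = proj₂ (run t I₁ I₂)

DetAlg : Set
DetAlg = (n : ℕ) → QTree n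

record RandAlg : Set where
  field
    bits : ℕ → ℕ
    tree : (n : ℕ) → Vec Bool (bits n) → QTree n

count : (m : ℕ) → (Vec Bool m → Bool) → ℕ
count zero f = if f [] then 1 else 0
count (suc m) f = count m (λ ρ → f (true ∷ ρ)) + count m (λ ρ → f (false ∷ ρ))

-- Clamped parameters, so that the bound is meaningful for r = 0 or n ≤ 1.
logn : ℕ → ℕ
logn n = ⌈log₂ n ⌉ ⊔ 1

r⁺ : ℕ → ℕ
r⁺ r = r ⊔ 1

-- q ≤ C · n · r^{3/4} · log n, violated iff C⁴ n⁴ r³ (log n)⁴ < q⁴.
exceeds34 : ℕ → ℕ → ℕ → ℕ → Bool
exceeds34 C n r q = (C ^ 4 * n ^ 4 * r⁺ r ^ 3 * logn n ^ 4) <ᵇ (q ^ 4)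

-- q ≤ C · n · r^{5/6} · log n, written as q⁶ ≤ C⁶ n⁶ r⁵ (log n)⁶.
Bound56 : ℕ → ℕ → ℕ → ℕ → Set
Bound56 C n r q = q ^ 6 ≤ C ^ 6 * n ^ 6 * r⁺ r ^ 5 * logn n ^ 6

-- Part 1: for every c there is a Las Vegas randomized algorithm and a
-- constant C: on every seed it outputs a maximum common independent set,
-- and the fraction of seeds using more than C n r^{3/4} log n queries is
-- at most n^{-c}   (#bad · n^c ≤ 2^bits).
RandomizedClaim : Set
RandomizedClaim =
  (c : ℕ) → Σ RandAlg λ A → Σ ℕ λ C →
    (n : ℕ) (I₁ I₂ : Oracle n) → IsMatroid I₁ → IsMatroid I₂ →
      let open RandAlg A in
      ((ρ : Vec Bool (bits n)) →
          MaxCommonIndep I₁ I₂ (output (tree n ρ) I₁ I₂))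
      × (count (bits n)
           (λ ρ → exceeds34 C n ∣ output (tree n ρ) I₁ I₂ ∣
                                (queries (tree n ρ) I₁ I₂))
           * n ^ c ≤ 2 ^ bits n)

DeterministicClaim : Set
DeterministicClaim =
  Σ DetAlg λ A → Σ ℕ λ C →
    (n : ℕ) (I₁ I₂ : Oracle n) → IsMatroid I₁ → IsMatroid I₂ →
      MaxCommonIndep I₁ I₂ (output (A n) I₁ I₂)
      × Bound56 C n ∣ output (A n) I₁ I₂ ∣ (queries (A n) I₁ I₂)

{-# OPTIONS --safe #-}
-- Both algorithms keep a common independent set S together with labels under which S is nearly
-- optimal: in M₁ it has maximum weight and in M₂ minimum cost when the labels serve as weights and
-- as costs, up to one level. Cutting at a level t then gives |T| ≤ |S| + |S_{=t}| for every common
-- independent set T, and summing over d levels bounds the deficit of S by |S| / d.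
--
-- A greedy pass estimates r up to a factor 2; write r ≈ aᵉ with e = 4 (randomized) or e = 6
-- (deterministic). First an auction, in which an outside element enters S by throwing out an element
-- one label below, raises the labels to a and leaves a deficit O(aᵉ⁻¹). Then shortest augmenting
-- paths are found by breadth-first search. The labels are distances and never decrease, so raising
-- them to aᵉ⁻¹ costs n aᵉ⁻¹ queries in total besides O(n log n) per path, and the deficit drops
-- to O(a). The remaining paths are found by a search that expands all levels for only n aᵉ⁻²
-- log n queries.
--
-- Expanding a level is hard because a query can test one outside element x against a set of elements
-- y of S, but not conversely. All edges out of y ∈ S with few free out-neighbours are found in
-- advance by binary search from x. A level with another y is expanded by querying every x, which
-- removes many of them. Lightness of y is recognised by a random sample of outside elements. The
-- sample is drawn once: the answers of the expansion do not depend on it, hence the sequence of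
-- configurations is fixed and a union bound applies. Deterministically, the edges found so far take
-- the place of the sample, each x learns at most a⁴ of them, and the few x that reach this cap are
-- queried at every level.
module Submission where

open import Defs
open import Data.Bool using (Bool; true; false; if_then_else_; _∧_; _∨_; not)
open import Data.Nat using (ℕ; zero; suc; _+_; _*_; _^_; _∸_; _≤_; _<_; _⊔_; _≤ᵇ_; _<ᵇ_; _≡ᵇ_; z≤n; s≤s; _/_; ⌊_/2⌋; ⌈_/2⌉; >-nonZero)
open import Data.Nat.Properties
open import Data.Nat.DivMod using (m/n*n≤m; m≡m%n+[m/n]*n; m%n<n)
open import Data.Nat.Induction using (<-wellFounded; Acc; acc)
open import Data.Nat.Logarithm using (⌈log₂_⌉)
open import Data.Nat.Logarithm.Core using (⌈log2⌉)
open import Data.Nat.Tactic.RingSolver using (solve-∀)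
open import Data.Fin using (Fin; zero; suc; toℕ; fromℕ<)
open import Data.Fin.Properties using (toℕ-fromℕ<) renaming (_≟_ to _≟F_)
open import Data.Fin.Subset using (Subset; ∣_∣; ⁅_⁆) renaming (_∪_ to _∪S_; ⊥ to ∅S)
open import Data.Vec using (Vec; []; _∷_; lookup; tabulate)
open import Data.Vec.Properties using (lookup∘tabulate; tabulate-cong; tabulate∘lookup; []=⇒lookup; lookup⇒[]=)
open import Data.List using (List; []; _∷_; _++_; length; take; drop; foldr; filterᵇ; allFin) renaming (tabulate to tabulateL)
open import Data.List.Properties using (take++drop≡id; length-take; length-drop; length-tabulate)
open import Data.List.Membership.Propositional using () renaming (_∈_ to _∈L_)
open import Data.List.Membership.Propositional.Properties using (∈-allFin; ∈-++⁻; ∈-++⁺ˡ; ∈-++⁺ʳ)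
open import Data.List.Relation.Unary.Any using (here; there)
open import Data.Product using (∃; _×_; _,_; proj₁; proj₂)
open import Data.Sum using (_⊎_; inj₁; inj₂; map₂)
open import Data.Empty using (⊥; ⊥-elim)
open import Data.Unit using (⊤; tt)
open import Data.Maybe using (Maybe; just; nothing)
open import Function using (_∘_; case_of_)
open import Relation.Nullary using (¬_; Dec; yes; no; does)
open import Relation.Binary.PropositionalEquality using (_≡_; _≢_; refl; sym; trans; cong; cong₂; subst; subst₂)

-- The exponents come from the last phase. With T = aᵉ⁻² it has O(a) paths left, so each may cost n
-- T log n. Randomized: a sample of about T log n elements separates degrees above and below n / T.
-- Each full expansion uses up a sampled element, so these cost n T log n in all, and the edges out
-- of light elements cost r (n / T) log n, which fits when r ≤ T²: T = a², e = 4. Deterministic: T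
-- edges per element cost n T log n to learn, and full expansions remove n / T elements each, so
-- O(T) of them are made. Recorded degrees are O(n / T), so O(n r / T²) elements reach the cap, and
-- querying them on O(r) levels fits when r² ≤ T³: T = a⁴, e = 6. That phase goes through 2 ρ + 1
-- levels, where ρ is the size of the greedy set. Since every common independent set has size at
-- most 2 ρ, the deficit |S| / (2 ρ + 1) is below 1 and S is maximum. The randomized expansion is
-- analysed twice: for an arbitrary seed, to get correctness, and under the good event, to get the
-- cost. Every cost is a potential argument stated by additive inequalities over ℕ.

Pr : ℕ → Set
Pr n = Fin n → Bool

infix 4 _∈_ _∉_ _⊆_
infixl 6 _⊕_ _⊖_
infixr 5 _∩_ _∪_

_∈_ _∉_ : ∀ {n} → Fin n → Pr n → Set
x ∈ P = P x ≡ true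
x ∉ P = P x ≡ false

_⊆_ : ∀ {n} → Pr n → Pr n → Set
P ⊆ Q = ∀ x → x ∈ P → x ∈ Q

opaque
  _==_ : ∀ {n} → Fin n → Fin n → Bool
  x == y = does (x ≟F y)

_⊕_ _⊖_ : ∀ {n} → Pr n → Fin n → Pr n
(P ⊕ x) v = P v ∨ (v == x)
(P ⊖ x) v = P v ∧ not (v == x)

_∩_ _∪_ : ∀ {n} → Pr n → Pr n → Pr n
(P ∩ Q) v = P v ∧ Q v
(P ∪ Q) v = P v ∨ Q v

∅ : ∀ {n} → Pr n
∅ _ = false

absurd : ∀ {a} {A : Set a} {b} → b ≡ true → b ≡ false → A
absurd refl ()

¬true⇒false : ∀ {b} → ¬ (b ≡ true) → b ≡ false
¬true⇒false {true}  h = ⊥-elim (h refl)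
¬true⇒false {false} h = refl

bool : ∀ b → (b ≡ true) ⊎ (b ≡ false)
bool true  = inj₁ refl
bool false = inj₂ refl

∧-intro : ∀ {a b} → a ≡ true → b ≡ true → a ∧ b ≡ true
∧-intro refl refl = refl

∧-l : ∀ {a b} → a ∧ b ≡ true → a ≡ true
∧-l {true} _ = refl

∧-r : ∀ {a b} → a ∧ b ≡ true → b ≡ true
∧-r {true} e = e

∨-l : ∀ {a b} → a ≡ true → a ∨ b ≡ true
∨-l refl = refl

∨-r : ∀ {a b} → b ≡ true → a ∨ b ≡ true
∨-r {true}  _ = refl
∨-r {false} e = e

∨-cases : ∀ {a b} → a ∨ b ≡ true → (a ≡ true) ⊎ (b ≡ true)
∨-cases {true}  _ = inj₁ refl
∨-cases {false} e = inj₂ e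

∨-f : ∀ {a b} → a ≡ false → b ≡ false → a ∨ b ≡ false
∨-f refl refl = refl

∨-fl : ∀ {a b} → a ∨ b ≡ false → a ≡ false
∨-fl {false} _ = refl

∨-fr : ∀ {a b} → a ∨ b ≡ false → b ≡ false
∨-fr {false} e = e

∧-cases-f : ∀ {a b} → a ∧ b ≡ false → (a ≡ false) ⊎ (b ≡ false)
∧-cases-f {true}  e = inj₂ e
∧-cases-f {false} _ = inj₁ refl

∧-f-l : ∀ {a b} → a ≡ false → a ∧ b ≡ false
∧-f-l refl = refl

not-t : ∀ {b} → not b ≡ true → b ≡ false
not-t {false} _ = refl

not-f : ∀ {b} → b ≡ false → not b ≡ true
not-f refl = refl

not-ff : ∀ {b} → not b ≡ false → b ≡ true
not-ff {true} _ = refl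

opaque
  unfolding _==_

  ==-refl : ∀ {n} (x : Fin n) → (x == x) ≡ true
  ==-refl x with x ≟F x
  ... | yes _ = refl
  ... | no ¬p = ⊥-elim (¬p refl)

  ==-true : ∀ {n} {x y : Fin n} → (x == y) ≡ true → x ≡ y
  ==-true {x = x} {y} e with x ≟F y
  ... | yes p = p
  ==-true () | no _

  ==-false : ∀ {n} {x y : Fin n} → x ≢ y → (x == y) ≡ false
  ==-false {x = x} {y} ne with x ≟F y
  ... | yes p = ⊥-elim (ne p)
  ... | no _ = refl

  ==-zero-suc : ∀ {n} {i : Fin n} → (suc i == zero) ≡ false
  ==-zero-suc = refl

  ==-suc-zero : ∀ {n} {i : Fin n} → (zero == suc i) ≡ false
  ==-suc-zero = refl

  ==-suc : ∀ {n} {i j : Fin n} → (suc i == suc j) ≡ (i == j)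
  ==-suc {i = i} {j} with i ≟F j
  ... | yes _ = refl
  ... | no _ = refl

==-false⁻ : ∀ {n} {x y : Fin n} → (x == y) ≡ false → x ≢ y
==-false⁻ {x = x} e refl = absurd (==-refl x) e

≤ᵇ-t : ∀ {m n} → m ≤ n → (m ≤ᵇ n) ≡ true
≤ᵇ-t {m} {n} p with m ≤ᵇ n | ≤⇒≤ᵇ p
... | true | _ = refl

≤ᵇ-t⁻ : ∀ {m n} → (m ≤ᵇ n) ≡ true → m ≤ n
≤ᵇ-t⁻ {m} {n} e = ≤ᵇ⇒≤ m n (subst (λ b → Data.Bool.T b) (sym e) tt)

≤ᵇ-f : ∀ {m n} → n < m → (m ≤ᵇ n) ≡ false
≤ᵇ-f {m} {n} p = ¬true⇒false (λ e → <⇒≱ p (≤ᵇ-t⁻ e))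

≤ᵇ-f⁻ : ∀ {m n} → (m ≤ᵇ n) ≡ false → n < m
≤ᵇ-f⁻ e = ≰⇒> (λ p → absurd (≤ᵇ-t p) e)

≡ᵇ-t : ∀ {m n} → m ≡ n → (m ≡ᵇ n) ≡ true
≡ᵇ-t {m} {n} p with m ≡ᵇ n | ≡⇒≡ᵇ m n p
... | true | _ = refl

≡ᵇ-t⁻ : ∀ {m n} → (m ≡ᵇ n) ≡ true → m ≡ n
≡ᵇ-t⁻ {m} {n} e = ≡ᵇ⇒≡ m n (subst (λ b → Data.Bool.T b) (sym e) tt)

module _ {n : ℕ} where

  ⊕-here : (P : Pr n) (x : Fin n) → x ∈ P ⊕ x
  ⊕-here P x = ∨-r {P x} (==-refl x)

  ⊕-there : (P : Pr n) {x v : Fin n} → v ∈ P → v ∈ P ⊕ x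
  ⊕-there P = ∨-l

  ⊕-cases : (P : Pr n) {x v : Fin n} → v ∈ P ⊕ x → (v ∈ P) ⊎ (v ≡ x)
  ⊕-cases P {x} {v} e with ∨-cases {P v} e
  ... | inj₁ p = inj₁ p
  ... | inj₂ q = inj₂ (==-true q)

  ⊕-∉ : (P : Pr n) {x v : Fin n} → v ∉ P → v ≢ x → v ∉ P ⊕ x
  ⊕-∉ P p ne = ∨-f p (==-false ne)

  ⊖-in : (P : Pr n) {x v : Fin n} → v ∈ P → v ≢ x → v ∈ P ⊖ x
  ⊖-in P p ne = ∧-intro p (not-f (==-false ne))

  ⊖-∈ : (P : Pr n) {x v : Fin n} → v ∈ P ⊖ x → v ∈ P
  ⊖-∈ P = ∧-l

  ⊖-≢ : (P : Pr n) {x v : Fin n} → v ∈ P ⊖ x → v ≢ x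
  ⊖-≢ P {x} {v} e = ==-false⁻ (not-t (∧-r {P v} e))

  ⊖-here : (P : Pr n) (x : Fin n) → x ∉ P ⊖ x
  ⊖-here P x = ¬true⇒false (λ e → ⊖-≢ P e refl)

  ⊕-⊆ : {P Q : Pr n} {x : Fin n} → P ⊆ Q → x ∈ Q → P ⊕ x ⊆ Q
  ⊕-⊆ {P} {Q} h q v e with ⊕-cases P e
  ... | inj₁ r = h v r
  ... | inj₂ refl = q

  ∈≢∉ : {P : Pr n} {x v : Fin n} → v ∈ P → x ∉ P → v ≢ x
  ∈≢∉ p q refl = absurd p q

-- Finite sums and cardinalities.

b2n : Bool → ℕ
b2n true  = 1
b2n false = 0

sumF : ∀ {n} → (Fin n → ℕ) → ℕ
sumF {zero}  f = 0
sumF {suc n} f = f zero + sumF (f ∘ suc)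

# : ∀ {n} → Pr n → ℕ
# P = sumF (b2n ∘ P)

sum-mono : ∀ {n} {f g : Fin n → ℕ} → (∀ i → f i ≤ g i) → sumF f ≤ sumF g
sum-mono {zero}  h = z≤n
sum-mono {suc n} h = +-mono-≤ (h zero) (sum-mono (h ∘ suc))

sum-cong : ∀ {n} {f g : Fin n → ℕ} → (∀ i → f i ≡ g i) → sumF f ≡ sumF g
sum-cong {zero}  h = refl
sum-cong {suc n} h = cong₂ _+_ (h zero) (sum-cong (h ∘ suc))

sum-+ : ∀ {n} (f g : Fin n → ℕ) → sumF (λ i → f i + g i) ≡ sumF f + sumF g
sum-+ {zero}  f g = refl
sum-+ {suc n} f g = trans (cong (f zero + g zero +_) (sum-+ (f ∘ suc) (g ∘ suc)))
  (lem (f zero) (g zero) (sumF (f ∘ suc)) (sumF (g ∘ suc)))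
  where
  lem : ∀ a b c d → a + b + (c + d) ≡ a + c + (b + d)
  lem = solve-∀

sum-* : ∀ {n} k (f : Fin n → ℕ) → sumF (λ i → k * f i) ≡ k * sumF f
sum-* {zero}  k f = sym (*-zeroʳ k)
sum-* {suc n} k f = trans (cong (k * f zero +_) (sum-* k (f ∘ suc))) (sym (*-distribˡ-+ k (f zero) _))

sum-const : ∀ {n} k → sumF {n} (λ _ → k) ≡ n * k
sum-const {zero}  k = refl
sum-const {suc n} k = cong (k +_) (sum-const {n} k)

sum-swap : ∀ {n m} (f : Fin n → Fin m → ℕ) → sumF (λ i → sumF (f i)) ≡ sumF (λ j → sumF (λ i → f i j))
sum-swap {zero} {m} f = sym (trans (sum-const {m} 0) (*-zeroʳ m))
sum-swap {suc n} f = trans (cong (sumF (f zero) +_) (sum-swap (f ∘ suc)))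
  (sym (sum-+ (f zero) (λ j → sumF (λ i → f (suc i) j))))

sum-point : ∀ {n} (f : Fin n → ℕ) x → f x ≤ sumF f
sum-point f zero    = m≤m+n _ _
sum-point f (suc x) = ≤-trans (sum-point (f ∘ suc) x) (m≤n+m _ _)

sum-mono-at : ∀ {n} {f g : Fin n → ℕ} x k → (∀ i → f i ≤ g i) → f x + k ≤ g x → sumF f + k ≤ sumF g
sum-mono-at {f = f} {g} zero k h hx = subst (_≤ sumF g) (lem (f zero) k (sumF (f ∘ suc)))
  (+-mono-≤ hx (sum-mono (h ∘ suc)))
  where
  lem : ∀ a b c → a + b + c ≡ a + c + b
  lem = solve-∀
sum-mono-at {f = f} {g} (suc x) k h hx = subst (_≤ sumF g) (sym (+-assoc (f zero) _ k))
  (+-mono-≤ (h zero) (sum-mono-at x k (h ∘ suc) hx))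

b2n≤1 : ∀ b → b2n b ≤ 1
b2n≤1 true  = s≤s z≤n
b2n≤1 false = z≤n

b2n-mono : ∀ {a b} → (a ≡ true → b ≡ true) → b2n a ≤ b2n b
b2n-mono {true}  h rewrite h refl = s≤s z≤n
b2n-mono {false} h = z≤n

module _ {n : ℕ} where

  #-mono : {P Q : Pr n} → P ⊆ Q → # P ≤ # Q
  #-mono h = sum-mono (λ i → b2n-mono (h i))

  #≤n : (P : Pr n) → # P ≤ n
  #≤n P = subst (# P ≤_) (trans (sum-const {n} 1) (*-identityʳ n)) (sum-mono (λ i → b2n≤1 (P i)))

  #-⊂ : {P Q : Pr n} {x : Fin n} → P ⊆ Q → x ∉ P → x ∈ Q → # P < # Q
  #-⊂ {P} {Q} {x} h p q = subst (_≤ # Q) (+-comm (# P) 1)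
    (sum-mono-at x 1 (λ i → b2n-mono (h i)) lem)
    where
    lem : b2n (P x) + 1 ≤ b2n (Q x)
    lem rewrite p | q = ≤-refl

  #-∪ : {P Q R : Pr n} → (∀ x → x ∈ R → (x ∈ P) ⊎ (x ∈ Q)) → # R ≤ # P + # Q
  #-∪ {P} {Q} {R} h = subst (# R ≤_) (sum-+ (b2n ∘ P) (b2n ∘ Q)) (sum-mono lem)
    where
    lem : ∀ i → b2n (R i) ≤ b2n (P i) + b2n (Q i)
    lem i with R i | h i
    ... | false | _ = z≤n
    ... | true | k with k refl
    ... | inj₁ e rewrite e = s≤s z≤n
    ... | inj₂ e rewrite e = m≤n+m 1 (b2n (P i))

  #-⊎ : {P Q R : Pr n} → P ⊆ R → Q ⊆ R → (∀ x → x ∈ P → x ∈ Q → ⊥) → # P + # Q ≤ # R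
  #-⊎ {P} {Q} {R} p q d = subst (_≤ # R) (sum-+ (b2n ∘ P) (b2n ∘ Q)) (sum-mono lem)
    where
    lem : ∀ i → b2n (P i) + b2n (Q i) ≤ b2n (R i)
    lem i with P i in ep | Q i in eq
    ... | true  | true  = ⊥-elim (d i ep eq)
    ... | true  | false rewrite p i ep = ≤-refl
    ... | false | true  rewrite q i eq = ≤-refl
    ... | false | false = z≤n

  #-sing : (x : Fin n) → # (λ v → v == x) ≡ 1
  #-sing x = go x
    where
    go : ∀ {m} (x : Fin m) → # (λ v → v == x) ≡ 1
    go {suc m} zero = cong₂ _+_ (cong b2n (==-refl zero))
      (trans (sum-cong {m} (λ i → cong b2n ==-zero-suc)) (trans (sum-const {m} 0) (*-zeroʳ m)))
    go {suc m} (suc x) = cong₂ _+_ (cong b2n ==-suc-zero) (trans (sum-cong {m} (λ i → cong b2n ==-suc)) (go x))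

  #-⊕ : (P : Pr n) {x : Fin n} → x ∉ P → # (P ⊕ x) ≡ suc (# P)
  #-⊕ P {x} p = ≤-antisym
    (subst (# (P ⊕ x) ≤_) (trans (cong (# P +_) (#-sing x)) (+-comm _ 1))
      (#-∪ {P} {λ v → v == x} (λ v e → ∨-cases {P v} e)))
    (#-⊂ (λ v → ⊕-there P) p (⊕-here P x))

  #-⊖ : (P : Pr n) {x : Fin n} → x ∈ P → suc (# (P ⊖ x)) ≡ # P
  #-⊖ P {x} p = ≤-antisym
    (#-⊂ {P ⊖ x} (λ v → ⊖-∈ P {x} {v}) (⊖-here P x) p)
    (subst (# P ≤_) (trans (cong (# (P ⊖ x) +_) (#-sing x)) (+-comm _ 1))
      (#-∪ {P ⊖ x} {λ v → v == x} lem))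
    where
    lem : ∀ v → v ∈ P → (v ∈ P ⊖ x) ⊎ ((v == x) ≡ true)
    lem v e with bool (v == x)
    ... | inj₁ q = inj₂ q
    ... | inj₂ q = inj₁ (∧-intro e (not-f q))

  #-full : {P Q : Pr n} → P ⊆ Q → # Q ≤ # P → Q ⊆ P
  #-full {P} {Q} h le x q with bool (P x)
  ... | inj₁ p = p
  ... | inj₂ p = ⊥-elim (<⇒≱ (#-⊂ {P} {Q} h p q) le)

  #-∅ : # {n} ∅ ≡ 0
  #-∅ = trans (sum-const {n} 0) (*-zeroʳ n)

∣tabulate∣ : ∀ {n} (P : Pr n) → ∣ tabulate P ∣ ≡ # P
∣tabulate∣ {zero} P = refl
∣tabulate∣ {suc n} P with P zero
... | true  = cong suc (∣tabulate∣ (P ∘ suc))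
... | false = ∣tabulate∣ (P ∘ suc)

-- Matroids

record Mat (n : ℕ) : Set where
  field
    ind   : Pr n → Bool
    empt  : ind ∅ ≡ true
    down  : ∀ {P Q} → P ⊆ Q → ind Q ≡ true → ind P ≡ true
    exch  : ∀ {P Q} → ind P ≡ true → ind Q ≡ true → # Q < # P →
            ∃ λ x → x ∈ P × x ∉ Q × ind (Q ⊕ x) ≡ true

toMat : ∀ {n} {I : Oracle n} → IsMatroid I → Mat n
toMat {n} {I} m = record
  { ind  = λ P → I (tabulate P)
  ; empt = trans (cong I (tab-∅ n)) (IsMatroid.empty m)
  ; down = λ {P} {Q} h q → IsMatroid.downward m _ _
      (λ {x} x∈ → lookup⇒[]= x _ (trans (lookup∘tabulate Q x)
        (h x (trans (sym (lookup∘tabulate P x)) ([]=⇒lookup x∈))))) q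
  ; exch = λ {P} {Q} p q lt →
      let (x , x∈ , x∉ , i) = IsMatroid.exchange m (tabulate P) (tabulate Q) p q
                                (subst₂ _<_ (sym (∣tabulate∣ Q)) (sym (∣tabulate∣ P)) lt)
      in x , trans (sym (lookup∘tabulate P x)) ([]=⇒lookup x∈)
           , ¬true⇒false (λ e → x∉ (lookup⇒[]= x _ (trans (lookup∘tabulate Q x) e)))
           , trans (cong I (tab-⊕ Q x)) i
  }
  where
  tab-∅ : ∀ k → tabulate {n = k} ∅ ≡ ∅S
  tab-∅ zero = refl
  tab-∅ (suc k) = cong (false ∷_) (tab-∅ k)
  sing : ∀ {k} (x : Fin k) → tabulate (λ v → v == x) ≡ ⁅ x ⁆
  sing {suc k} zero = cong₂ _∷_ (==-refl zero) (trans (tabulate-cong (λ i → ==-zero-suc)) (tab-∅ k))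
  sing {suc k} (suc x) = cong₂ _∷_ ==-suc-zero (trans (tabulate-cong (λ i → ==-suc)) (sing x))
  tab-∪ : ∀ {k} (P Q : Pr k) → tabulate (P ∪ Q) ≡ (tabulate P ∪S tabulate Q)
  tab-∪ {zero} P Q = refl
  tab-∪ {suc k} P Q = cong ((P zero ∨ Q zero) ∷_) (tab-∪ (P ∘ suc) (Q ∘ suc))
  tab-⊕ : ∀ {k} (Q : Pr k) x → tabulate (Q ⊕ x) ≡ (tabulate Q ∪S ⁅ x ⁆)
  tab-⊕ Q x = trans (tab-∪ Q (λ v → v == x)) (cong (tabulate Q ∪S_) (sing x))

module MatL {n : ℕ} (M : Mat n) where
  open Mat M public

  Ind : Pr n → Set
  Ind P = ind P ≡ true

  Dep : Pr n → Set
  Dep P = ind P ≡ false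

  up : ∀ {P Q} → P ⊆ Q → Dep P → Dep Q
  up h d = ¬true⇒false (λ i → absurd (down h i) d)

  -- Exchange from a larger `T` would add to `B` an element that `B` spans.
  span-bound : ∀ {B T} → Ind B → Ind T → (∀ x → x ∈ T → x ∉ B → Dep (B ⊕ x)) → # T ≤ # B
  span-bound {B} {T} b t h with # T ≤? # B
  ... | yes p = p
  ... | no ¬p = let (x , xT , xB , i) = exch t b (≰⇒> ¬p) in absurd i (h x xT xB)

  extend : ∀ k {C Z} → Ind C → Ind Z → # Z ≤ # C + k →
           ∃ λ T → Ind T × C ⊆ T × (∀ v → v ∈ T → (v ∈ C) ⊎ (v ∈ Z)) × # Z ≤ # T
  extend zero {C} {Z} c z le = C , c , (λ _ e → e) , (λ _ → inj₁) , subst (# Z ≤_) (+-identityʳ _) le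
  extend (suc k) {C} {Z} c z le with # Z ≤? # C
  ... | yes p = C , c , (λ _ e → e) , (λ _ → inj₁) , p
  ... | no ¬p with exch z c (≰⇒> ¬p)
  ... | x , xZ , xC , i with extend k i z (subst (# Z ≤_) (trans (+-suc (# C) k) (cong (_+ k) (sym (#-⊕ C xC)))) le)
  ... | T , t , CT , TZ , le′ = T , t , (λ v e → CT v (⊕-there C e)) , lem , le′
    where
    lem : ∀ v → v ∈ T → (v ∈ C) ⊎ (v ∈ Z)
    lem v e with TZ v e
    ... | inj₂ q = inj₂ q
    ... | inj₁ q with ⊕-cases C q
    ... | inj₁ r = inj₁ r
    ... | inj₂ refl = inj₂ xZ

  extend′ : ∀ {C Z} → Ind C → Ind Z →
           ∃ λ T → Ind T × C ⊆ T × (∀ v → v ∈ T → (v ∈ C) ⊎ (v ∈ Z)) × # Z ≤ # T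
  extend′ {C} {Z} c z = extend (# Z) c z (m≤n+m _ _)

  -- Completing A from S never adds z, so it can only end at S − z + x.
  pivot : ∀ {S A x z} → Ind S → Ind A → (∀ v → v ∈ A → v ∈ S ⊕ x) → z ∈ S → x ∈ A → x ∉ S →
          Dep (A ⊕ z) → Ind (S ⊖ z ⊕ x)
  pivot {S} {A} {x} {z} s a AS zS xA xS d with extend′ a s
  ... | T , t , AT , TS , le = down (#-full T⊆ (subst (_≤ # T) (sym card) le)) t
    where
    z∉T : z ∉ T
    z∉T = ¬true⇒false (λ e → absurd (down (⊕-⊆ {P = A} AT e) t) d)
    T⊆ : T ⊆ (S ⊖ z ⊕ x)
    T⊆ v e = go v e (bool (v == x))
      where
      S⊕x : ∀ v → v ∈ T → v ∈ S ⊕ x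
      S⊕x v e with TS v e
      ... | inj₁ q = AS v q
      ... | inj₂ q = ⊕-there S q
      go : ∀ v → v ∈ T → ((v == x) ≡ true) ⊎ ((v == x) ≡ false) → v ∈ S ⊖ z ⊕ x
      go v e (inj₁ q) = ∨-r {(S ⊖ z) v} q
      go v e (inj₂ q) with ⊕-cases S (S⊕x v e)
      ... | inj₁ r = ⊕-there (S ⊖ z) (⊖-in S r (∈≢∉ {P = T} e z∉T))
      ... | inj₂ r = ⊥-elim (==-false⁻ q r)
    card : # (S ⊖ z ⊕ x) ≡ # S
    card = trans (#-⊕ (S ⊖ z) (∧-f-l xS)) (#-⊖ S zS)

  exch₂ : ∀ {A Z u v} → Ind A → Ind Z → # A < # Z →
          (∀ w → w ∈ Z → (w ∈ A) ⊎ (w ≡ u) ⊎ (w ≡ v)) → Ind (A ⊕ u) ⊎ Ind (A ⊕ v)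
  exch₂ {A} a z lt h with exch z a lt
  ... | w , wZ , wA , i with h w wZ
  ... | inj₁ q = absurd q wA
  ... | inj₂ (inj₁ refl) = inj₁ i
  ... | inj₂ (inj₂ refl) = inj₂ i

  -- Serves inside proofs only, as the reference set of a first auction round; it costs no queries.
  basis : ∃ λ B → Ind B × (∀ x → x ∉ B → Dep (B ⊕ x))
  basis = go (allFin n) ∅ empt (λ x _ → inj₁ (∈-allFin x))
    where
    go : ∀ xs B → Ind B → (∀ x → x ∉ B → (x ∈L xs) ⊎ Dep (B ⊕ x)) → ∃ λ B → Ind B × (∀ x → x ∉ B → Dep (B ⊕ x))
    go [] B b h = B , b , λ x e → case h x e of λ { (inj₂ d) → d }
    go (y ∷ ys) B b h with bool (ind (B ⊕ y))
    ... | inj₂ d = go ys B b λ x e → case h x e of λ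
      { (inj₁ (here refl)) → inj₂ d ; (inj₁ (there q)) → inj₁ q ; (inj₂ q) → inj₂ q }
    ... | inj₁ i = go ys (B ⊕ y) i lem
      where
      lem : ∀ x → x ∉ B ⊕ y → (x ∈L ys) ⊎ Dep (B ⊕ y ⊕ x)
      lem x e with h x (∨-fl e)
      ... | inj₁ (here refl) = absurd (⊕-here B y) e
      ... | inj₁ (there q) = inj₁ q
      ... | inj₂ d = inj₂ (up (⊕-⊆ {P = B} (λ v q → ⊕-there (B ⊕ y) (⊕-there B q)) (⊕-here (B ⊕ y) x)) d)

-- Query programs

data Q (n : ℕ) (A : Set) : Set where
  ret : A → Q n A
  qry : Which → Pr n → (Bool → Q n A) → Q n A

infixl 1 _>>=_

_>>=_ : ∀ {n A B} → Q n A → (A → Q n B) → Q n B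
ret a     >>= f = f a
qry w P k >>= f = qry w P (λ b → k b >>= f)

toTree : ∀ {n} → Q n (Subset n) → QTree n
toTree (ret S)     = leaf S
toTree (qry w P k) = query w (tabulate P) (λ b → toTree (k b))

test : ∀ {n} → Which → Pr n → Q n Bool
test w P = qry w P ret

foldQ : ∀ {n} {A S : Set} → (A → S → Q n S) → List A → S → Q n S
foldQ f []       s = ret s
foldQ f (a ∷ as) s = f a s >>= foldQ f as

travQ : ∀ {n m A} → (Fin m → Q n A) → Q n (Vec A m)
travQ {m = zero}  f = ret []
travQ {m = suc m} f = f zero >>= λ b → travQ (f ∘ suc) >>= λ v → ret (b ∷ v)

addL : ∀ {n} → Pr n → List (Fin n) → Pr n
addL = foldr (λ x P → P ⊕ x)

elems : ∀ {n} → Pr n → List (Fin n)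
elems {n} P = filterᵇ P (allFin n)

-- Halving search for the first element of `zs` whose addition to the independent set `B` creates a
-- dependency, given that adding all of `zs` does. `f` bounds the logarithm of the length and hence
-- the number of queries; `x` is a default for the empty list, which that assumption excludes.
bisect : ∀ {n} → Which → ℕ → Pr n → List (Fin n) → Fin n → Q n (Fin n)
bisect w f B [] x = ret x
bisect w zero B (z ∷ zs) x = ret z
bisect w (suc f) B zs x = qry w (addL B us) λ
  { false → bisect w f B us x
  ; true  → bisect w f (addL B us) (drop (2 ^ f) zs) x }
  where us = take (2 ^ f) zs

∈-elems : ∀ {n} (P : Pr n) {x} → x ∈ P → x ∈L elems P
∈-elems {n} P {x} p = go (allFin n) (∈-allFin x)
  where
  go : ∀ xs → x ∈L xs → x ∈L filterᵇ P xs
  go (y ∷ xs) (here refl) rewrite p = here refl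
  go (y ∷ xs) (there q) with P y
  ... | true  = there (go xs q)
  ... | false = go xs q

elems-∈ : ∀ {n} (P : Pr n) {x} → x ∈L elems P → x ∈ P
elems-∈ {n} P {x} = go (allFin n)
  where
  go : ∀ xs → x ∈L filterᵇ P xs → x ∈ P
  go (y ∷ xs) q with P y in e
  go (y ∷ xs) (here refl) | true = e
  go (y ∷ xs) (there q)   | true = go xs q
  go (y ∷ xs) q           | false = go xs q

length-elems : ∀ {n} (P : Pr n) → length (elems P) ≤ n
length-elems {n} P = ≤-trans (go (allFin n)) (≤-reflexive (length-tabulate (λ x → x)))
  where
  go : ∀ xs → length (filterᵇ P xs) ≤ length xs
  go [] = z≤n
  go (y ∷ xs) with P y
  ... | true  = s≤s (go xs)
  ... | false = ≤-trans (go xs) (n≤1+n _)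

module _ {n : ℕ} where

  addL-⊇ : ∀ {P : Pr n} xs → P ⊆ addL P xs
  addL-⊇ [] v e = e
  addL-⊇ {P} (x ∷ xs) v e = ⊕-there (addL P xs) (addL-⊇ xs v e)

  addL-∈ : ∀ {P : Pr n} xs {x} → x ∈L xs → x ∈ addL P xs
  addL-∈ {P} (x ∷ xs) (here refl) = ⊕-here (addL P xs) x
  addL-∈ {P} (x ∷ xs) (there q) = ⊕-there (addL P xs) (addL-∈ xs q)

  addL-cases : ∀ {P : Pr n} xs {x} → x ∈ addL P xs → (x ∈ P) ⊎ (x ∈L xs)
  addL-cases [] e = inj₁ e
  addL-cases {P} (y ∷ xs) e with ⊕-cases (addL P xs) e
  ... | inj₂ refl = inj₂ (here refl)
  ... | inj₁ q with addL-cases xs q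
  ... | inj₁ r = inj₁ r
  ... | inj₂ r = inj₂ (there r)

-- Powers of two around `n`.

n≤2^⌈log₂n⌉ : ∀ n → n ≤ 2 ^ ⌈log₂ n ⌉
n≤2^⌈log₂n⌉ n = go n (<-wellFounded n)
  where
  go : ∀ n (a : Acc _<_ n) → n ≤ 2 ^ ⌈log2⌉ n a
  go 0 _ = z≤n
  go 1 _ = ≤-refl
  go (suc (suc n)) (acc rs) = ≤-trans lem (*-monoʳ-≤ 2 (go (suc ⌈ n /2⌉) (rs (⌈n/2⌉<n n))))
    where
    lem : suc (suc n) ≤ 2 * suc ⌈ n /2⌉
    lem = begin
      2 + n                   ≡⟨ cong (2 +_) (sym (⌊n/2⌋+⌈n/2⌉≡n n)) ⟩
      2 + (⌊ n /2⌋ + ⌈ n /2⌉) ≤⟨ +-monoʳ-≤ 2 (+-monoˡ-≤ ⌈ n /2⌉ (⌊n/2⌋≤⌈n/2⌉ n)) ⟩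
      2 + (⌈ n /2⌉ + ⌈ n /2⌉) ≡⟨ eq ⌈ n /2⌉ ⟩
      2 * suc ⌈ n /2⌉         ∎
      where
      open ≤-Reasoning
      eq : ∀ m → 2 + (m + m) ≡ 2 * suc m
      eq = solve-∀

2^⌈log₂n⌉≤2n : ∀ n → 1 ≤ n → 2 ^ ⌈log₂ n ⌉ ≤ 2 * n
2^⌈log₂n⌉≤2n 1 _ = s≤s z≤n
2^⌈log₂n⌉≤2n n@(suc (suc k)) _ = m+n≤o⇒m≤o (2 ^ ⌈log₂ n ⌉) (go n (<-wellFounded n) (s≤s (s≤s z≤n)))
  where
  -- Halving rounds up, so the induction carries the stronger bound 2 (n - 1), valid from n = 2 on;
  -- the slack of 2 absorbs the rounding.
  go : ∀ n (a : Acc _<_ n) → 2 ≤ n → 2 ^ ⌈log2⌉ n a + 2 ≤ 2 * n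
  go 1 _ (s≤s ())
  go 2 (acc rs) _ = ≤-refl
  go (suc (suc (suc n))) (acc rs) _ =
    +-cancelʳ-≤ 2 _ _ (begin
      2 ^ suc (⌈log2⌉ m am) + 2 + 2     ≡⟨ eq (2 ^ ⌈log2⌉ m am) ⟩
      2 * (2 ^ ⌈log2⌉ m am + 2)         ≤⟨ *-monoʳ-≤ 2 (go m (rs (⌈n/2⌉<n (suc n))) (s≤s (s≤s z≤n))) ⟩
      2 * (2 * m)                      ≡⟨ eq₂ ⌊ n /2⌋ ⟩
      2 * (⌊ n /2⌋ + ⌊ n /2⌋) + 8      ≤⟨ +-monoˡ-≤ 8 (*-monoʳ-≤ 2 (+-monoʳ-≤ ⌊ n /2⌋ (⌊n/2⌋≤⌈n/2⌉ n))) ⟩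
      2 * (⌊ n /2⌋ + ⌈ n /2⌉) + 8      ≡⟨ cong (λ x → 2 * x + 8) (⌊n/2⌋+⌈n/2⌉≡n n) ⟩
      2 * n + 8                        ≡⟨ eq₃ n ⟩
      2 * suc (suc (suc n)) + 2        ∎)
    where
    open ≤-Reasoning
    m = suc ⌈ suc n /2⌉
    am : Acc _<_ m
    am = rs (⌈n/2⌉<n (suc n))
    eq : ∀ x → 2 * x + 2 + 2 ≡ 2 * (x + 2)
    eq = solve-∀
    eq₂ : ∀ x → 2 * (2 * (2 + x)) ≡ 2 * (x + x) + 8
    eq₂ = solve-∀
    eq₃ : ∀ x → 2 * x + 8 ≡ 2 * (3 + x) + 2
    eq₃ = solve-∀

n≤2^logn : ∀ n → n ≤ 2 ^ logn n
n≤2^logn n = ≤-trans (n≤2^⌈log₂n⌉ n) (^-monoʳ-≤ 2 (m≤m⊔n ⌈log₂ n ⌉ 1))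

-- Values and costs of query programs.

module Run {n : ℕ} (o : Which → Pr n → Bool) where

  val : ∀ {A} → Q n A → A
  val (ret a)     = a
  val (qry w P k) = val (k (o w P))

  cost : ∀ {A} → Q n A → ℕ
  cost (ret a)     = 0
  cost (qry w P k) = suc (cost (k (o w P)))

  -- A postcondition sees the result and the number of queries together, since potentials depend on
  -- both.
  wp : ∀ {A} → Q n A → (A → ℕ → Set) → Set
  wp m Φ = Φ (val m) (cost m)

  val->>= : ∀ {A B} (m : Q n A) (f : A → Q n B) → val (m >>= f) ≡ val (f (val m))
  val->>= (ret a)     f = refl
  val->>= (qry w P k) f = val->>= (k (o w P)) f

  cost->>= : ∀ {A B} (m : Q n A) (f : A → Q n B) → cost (m >>= f) ≡ cost m + cost (f (val m))
  cost->>= (ret a)     f = refl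
  cost->>= (qry w P k) f = cong suc (cost->>= (k (o w P)) f)

  wp->>= : ∀ {A B} (m : Q n A) (f : A → Q n B) (Φ : B → ℕ → Set) →
           wp m (λ a k → wp (f a) (λ b k′ → Φ b (k + k′))) → wp (m >>= f) Φ
  wp->>= m f Φ h = subst₂ Φ (sym (val->>= m f)) (sym (cost->>= m f)) h

  -- The invariant sees the part of the list not yet processed; thus pending elements can be
  -- mentioned in it and paid for in advance.
  wp-fold : ∀ {A S : Set} (f : A → S → Q n S) (P : List A → S → ℕ → Set) →
            (∀ a as s k → P (a ∷ as) s k → wp (f a s) (λ s′ k′ → P as s′ (k + k′))) →
            ∀ as s k → P as s k → wp (foldQ f as s) (λ s′ k′ → P [] s′ (k + k′))
  wp-fold f P h [] s k p = subst (P [] s) (sym (+-identityʳ k)) p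
  wp-fold f P h (a ∷ as) s k p =
    wp->>= (f a s) (foldQ f as) (λ s′ k′ → P [] s′ (k + k′))
      (subst (P [] _) (+-assoc k _ _) (wp-fold f P h as _ _ (h a as s k p)))

  val-trav : ∀ {m A} (f : Fin m → Q n A) → val (travQ f) ≡ tabulate (λ i → val (f i))
  val-trav {m = zero} f = refl
  val-trav {m = suc m} f = trans (val->>= (f zero) _)
    (trans (val->>= (travQ (f ∘ suc)) _) (cong (val (f zero) ∷_) (val-trav (f ∘ suc))))

  cost-trav : ∀ {m A} (f : Fin m → Q n A) → cost (travQ f) ≡ sumF (λ i → cost (f i))
  cost-trav {m = zero} f = refl
  cost-trav {m = suc m} f = trans (cost->>= (f zero) _) (cong (cost (f zero) +_)
    (trans (cost->>= (travQ (f ∘ suc)) _) (trans (+-identityʳ _) (cost-trav (f ∘ suc)))))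

run-toTree : ∀ {n} (I₁ I₂ : Oracle n) (o : Which → Pr n → Bool) →
  (∀ w P → ask w I₁ I₂ (tabulate P) ≡ o w P) → (m : Q n (Subset n)) →
  run (toTree m) I₁ I₂ ≡ (Run.val o m , Run.cost o m)
run-toTree I₁ I₂ o h (ret S) = refl
run-toTree I₁ I₂ o h (qry w P k)
  rewrite h w P | run-toTree I₁ I₂ o h (k (o w P)) = refl

module BisectL {n : ℕ} (w : Which) (M : Mat n) (o : Which → Pr n → Bool) (o≡ : ∀ P → o w P ≡ Mat.ind M P) where
  open MatL M
  open Run o

  -- `A` is the witness that `pivot` asks for: an independent set between `B` and `B` with `zs` that
  -- spans `z`.
  Splits : Pr n → List (Fin n) → Fin n → Set
  Splits B zs z = z ∈L zs × ∃ λ A → B ⊆ A × (∀ v → v ∈ A → (v ∈ B) ⊎ (v ∈L zs)) × Ind A × Dep (A ⊕ z)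

  private
    pow : ∀ f → 2 ^ suc f ≡ 2 ^ f + 2 ^ f
    pow f = cong (2 ^ f +_) (+-identityʳ _)

  bisect-spec : ∀ f B zs x → length zs ≤ 2 ^ f → Ind B → Dep (addL B zs) →
                wp (bisect w f B zs x) (λ z k → Splits B zs z × k ≤ f)
  bisect-spec f B [] x le b d = absurd b d
  bisect-spec zero B (z ∷ []) x le b d = (here refl , B , (λ _ e → e) , (λ _ → inj₁) , b , d) , z≤n
  bisect-spec zero B (z ∷ _ ∷ _) x (s≤s ()) b d
  bisect-spec (suc f) B zs@(z₀ ∷ zs₀) x le b d = main
    where
    us = take (2 ^ f) zs
    vs = drop (2 ^ f) zs
    eq : us ++ vs ≡ zs
    eq = take++drop≡id (2 ^ f) zs
    us⊆ : ∀ {v} → v ∈L us → v ∈L zs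
    us⊆ e = subst (_ ∈L_) eq (∈-++⁺ˡ e)
    vs⊆ : ∀ {v} → v ∈L vs → v ∈L zs
    vs⊆ e = subst (_ ∈L_) eq (∈-++⁺ʳ us e)
    len-us : length us ≤ 2 ^ f
    len-us = ≤-trans (≤-reflexive (length-take (2 ^ f) zs)) (m⊓n≤m _ _)
    len-vs : length vs ≤ 2 ^ f
    len-vs = ≤-trans (≤-reflexive (length-drop (2 ^ f) zs))
      (m≤n+o⇒m∸n≤o (length zs) (2 ^ f) (subst (length zs ≤_) (pow f) le))
    ⊆all : addL B zs ⊆ addL (addL B us) vs
    ⊆all v e with addL-cases zs e
    ... | inj₁ q = addL-⊇ vs v (addL-⊇ us v q)
    ... | inj₂ q with ∈-++⁻ us (subst (v ∈L_) (sym eq) q)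
    ... | inj₁ r = addL-⊇ vs v (addL-∈ us r)
    ... | inj₂ r = addL-∈ vs r
    main : wp (bisect w (suc f) B zs x) (λ z k → Splits B zs z × k ≤ suc f)
    main with o w (addL B us) in e
    ... | false with bisect-spec f B us x len-us b (trans (sym (o≡ _)) e)
    ... | (z∈ , A , BA , AZ , a , ad) , le′ = (us⊆ z∈ , A , BA , (λ v q → map₂ us⊆ (AZ v q)) , a , ad) , s≤s le′
    main | true with bisect-spec f (addL B us) vs x len-vs (trans (sym (o≡ _)) e) (up ⊆all d)
    ... | (z∈ , A , BA , AZ , a , ad) , le′ = (vs⊆ z∈ , A , (λ v q → BA v (addL-⊇ us v q)) , lem , a , ad) , s≤s le′
      where
      lem : ∀ v → v ∈ A → (v ∈ B) ⊎ (v ∈L zs)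
      lem v q with AZ v q
      ... | inj₂ r = inj₂ (vs⊆ r)
      ... | inj₁ r with addL-cases us r
      ... | inj₁ t = inj₁ t
      ... | inj₂ t = inj₂ (us⊆ t)

-- Labels

-- A label c v ≥ 1 stands for the M₁-weight c v when v ∈ S, but for c v − 1 when v ∉ S. An element
-- that leaves S is relabelled one higher and an element that enters keeps its label.
Lab : ℕ → Set
Lab n = Fin n → ℕ

opaque
  geq leq ltq at : ∀ {n} → Pr n → Lab n → ℕ → Pr n
  geq S c t v = S v ∧ (t ≤ᵇ c v)
  leq S c t v = S v ∧ (c v ≤ᵇ t)
  ltq S c t v = S v ∧ (suc (c v) ≤ᵇ t)
  at  S c t v = S v ∧ (c v ≡ᵇ t)

  geq-in : ∀ {n} (S : Pr n) c {t v} → v ∈ S → t ≤ c v → v ∈ geq S c t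
  geq-in S c p q = ∧-intro p (≤ᵇ-t q)

  geq-S : ∀ {n} (S : Pr n) c {t v} → v ∈ geq S c t → v ∈ S
  geq-S S c = ∧-l

  geq-≤ : ∀ {n} (S : Pr n) c {t v} → v ∈ geq S c t → t ≤ c v
  geq-≤ S c {v = v} e = ≤ᵇ-t⁻ (∧-r {S v} e)

  geq-∉ : ∀ {n} (S : Pr n) c {t v} → v ∉ S → v ∉ geq S c t
  geq-∉ S c = ∧-f-l

  leq-in : ∀ {n} (S : Pr n) c {t v} → v ∈ S → c v ≤ t → v ∈ leq S c t
  leq-in S c p q = ∧-intro p (≤ᵇ-t q)

  leq-S : ∀ {n} (S : Pr n) c {t v} → v ∈ leq S c t → v ∈ S
  leq-S S c = ∧-l

  leq-≤ : ∀ {n} (S : Pr n) c {t v} → v ∈ leq S c t → c v ≤ t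
  leq-≤ S c {v = v} e = ≤ᵇ-t⁻ (∧-r {S v} e)

  leq-∉ : ∀ {n} (S : Pr n) c {t v} → v ∉ S → v ∉ leq S c t
  leq-∉ S c = ∧-f-l

  ltq-in : ∀ {n} (S : Pr n) c {t v} → v ∈ S → c v < t → v ∈ ltq S c t
  ltq-in S c p q = ∧-intro p (≤ᵇ-t q)

  ltq-S : ∀ {n} (S : Pr n) c {t v} → v ∈ ltq S c t → v ∈ S
  ltq-S S c = ∧-l

  ltq-< : ∀ {n} (S : Pr n) c {t v} → v ∈ ltq S c t → c v < t
  ltq-< S c {v = v} e = ≤ᵇ-t⁻ (∧-r {S v} e)

  at-in : ∀ {n} (S : Pr n) c {t v} → v ∈ S → c v ≡ t → v ∈ at S c t
  at-in S c p q = ∧-intro p (≡ᵇ-t q)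

  at-S : ∀ {n} (S : Pr n) c {t v} → v ∈ at S c t → v ∈ S
  at-S S c = ∧-l

  at-≡ : ∀ {n} (S : Pr n) c {t v} → v ∈ at S c t → c v ≡ t
  at-≡ S c {v = v} e = ≡ᵇ-t⁻ (∧-r {S v} e)

upd : ∀ {n} {A : Set} → (Fin n → A) → Fin n → A → Fin n → A
upd c y k v = if v == y then k else c v

upd-here : ∀ {n} {A : Set} (c : Fin n → A) y k → upd c y k y ≡ k
upd-here c y k rewrite ==-refl y = refl

upd-there : ∀ {n} {A : Set} (c : Fin n → A) {y v} k → v ≢ y → upd c y k v ≡ c v
upd-there c {y} {v} k ne rewrite ==-false ne = refl

module _ {n : ℕ} where

  geq-mono : ∀ {S S′ : Pr n} {c c′ s s′} → (∀ v → v ∈ S → s ≤ c v → v ∈ S′ × s′ ≤ c′ v) → geq S c s ⊆ geq S′ c′ s′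
  geq-mono {S} {S′} {c} {c′} h v e = let (a , b) = h v (geq-S S c e) (geq-≤ S c e) in geq-in S′ c′ a b

  ⊕-mono : ∀ {P P′ : Pr n} {z} → P ⊆ P′ → P ⊕ z ⊆ P′ ⊕ z
  ⊕-mono {P} {P′} {z} h = ⊕-⊆ {P = P} (λ v e → ⊕-there P′ (h v e)) (⊕-here P′ z)

  #-swap : ∀ (P : Pr n) {x y} → y ∈ P → x ∉ P → # (P ⊖ y ⊕ x) ≡ # P
  #-swap P {x} {y} p q = trans (#-⊕ (P ⊖ y) (∧-f-l q)) (#-⊖ P p)

  swap-cases : ∀ (S : Pr n) {x y v} → v ∈ S ⊖ y ⊕ x → (v ∈ S × v ≢ y) ⊎ (v ≡ x)
  swap-cases S {x} {y} e with ⊕-cases (S ⊖ y) e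
  ... | inj₁ q = inj₁ (⊖-∈ S {y} q , ⊖-≢ S q)
  ... | inj₂ q = inj₂ q

  swap-in : ∀ (S : Pr n) {x y v} → v ∈ S → v ≢ y → v ∈ S ⊖ y ⊕ x
  swap-in S {x} {y} p ne = ⊕-there (S ⊖ y) (⊖-in S p ne)

  swap-x : ∀ (S : Pr n) {x y} → x ∈ S ⊖ y ⊕ x
  swap-x S {x} {y} = ⊕-here (S ⊖ y) x

  swap-∉ : ∀ (S : Pr n) {x y v} → v ∉ S ⊖ y ⊕ x → (v ∉ S ⊎ v ≡ y) × v ≢ x
  swap-∉ S {x} {y} {v} e = lem , (λ { refl → absurd (swap-x S) e })
    where
    lem : v ∉ S ⊎ v ≡ y
    lem with bool (S v) | bool (v == y)
    ... | inj₂ q | _ = inj₁ q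
    ... | inj₁ q | inj₁ r = inj₂ (==-true r)
    ... | inj₁ q | inj₂ r = absurd (swap-in S q (==-false⁻ r)) e

-- Exchanges along the labels.

module PushL {n : ℕ} (M : Mat n) (S : Pr n) (c : Lab n) (x y : Fin n) (t : ℕ)
             (iS : Mat.ind M S ≡ true) (x∉ : x ∉ S) (y∈ : y ∈ S) (cy : c y ≡ t) (cx : c x ≡ suc t)
             (dx : Mat.ind M (geq S c t ⊕ x) ≡ false) where
  open MatL M

  S′ = S ⊖ y ⊕ x

  private
    y∈A : ∀ {s} → s ≤ t → y ∈ geq S c s
    y∈A le = geq-in S c y∈ (subst (_ ≤_) (sym cy) le)

    x∉A : ∀ {s} → x ∉ geq S c s
    x∉A = geq-∉ S c x∉

    dx′ : ∀ {s} → s ≤ t → Dep (geq S c s ⊕ x)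
    dx′ {s} le = up (⊕-mono {P = geq S c t} {geq S c s} (geq-mono {S = S} {c = c} (λ v p q → p , ≤-trans le q))) dx

    to : ∀ {s} → s ≤ t → geq S c s ⊖ y ⊕ x ⊆ geq S′ c s
    to {s} le = ⊕-⊆ {P = geq S c s ⊖ y}
      (λ v e → geq-in S′ c (swap-in S (geq-S S c (⊖-∈ (geq S c s) {y} e)) (⊖-≢ (geq S c s) e))
                 (geq-≤ S c (⊖-∈ (geq S c s) {y} e)))
      (geq-in S′ c (swap-x S) (subst (s ≤_) (sym cx) (m≤n⇒m≤1+n le)))

    from : ∀ {s} → geq S′ c s ⊆ geq S c s ⊖ y ⊕ x
    from {s} v e with swap-cases S (geq-S S′ c e)
    ... | inj₁ (p , q) = swap-in (geq S c s) (geq-in S c p (geq-≤ S′ c e)) q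
    ... | inj₂ refl = swap-x (geq S c s)

    card : ∀ {s} → s ≤ t → # (geq S′ c s) ≡ # (geq S c s)
    card {s} le = trans (≤-antisym (#-mono {P = geq S′ c s} from) (#-mono {Q = geq S′ c s} (to le)))
                        (#-swap (geq S c s) (y∈A le) x∉A)

  -- For `s ≤ t` the old and new threshold sets have the same size and the old one spans `x`, so if
  -- the new one with `z` were independent, the old one could be enlarged by `x` or by `z`, both of
  -- which it spans. For `s > t` the threshold set does not contain `y` and can only grow.
  spn-keep : ∀ s z → z ∉ S → z ≢ x → Dep (geq S c s ⊕ z) → Dep (geq S′ c s ⊕ z)
  spn-keep s z z∉ z≢ d with s ≤? t
  ... | no s≰t = up (⊕-mono {P = geq S c s} {geq S′ c s}
          (λ v e → geq-in S′ c (swap-in S (geq-S S c e)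
            (λ { refl → s≰t (subst (s ≤_) cy (geq-≤ S c e)) })) (geq-≤ S c e))) d
  ... | yes s≤t = ¬true⇒false contra
    where
    z∉′ : z ∉ geq S′ c s
    z∉′ = geq-∉ S′ c (⊕-∉ (S ⊖ y) (∧-f-l z∉) z≢)
    contra : ¬ Ind (geq S′ c s ⊕ z)
    contra i with exch₂ {A = geq S c s} {geq S′ c s ⊕ z} {x} {z} (down (λ v → geq-S S c) iS) i
                    (subst₂ _<_ (card s≤t) (sym (#-⊕ (geq S′ c s) z∉′)) ≤-refl) cover
      where
      cover : ∀ w → w ∈ geq S′ c s ⊕ z → (w ∈ geq S c s) ⊎ (w ≡ x) ⊎ (w ≡ z)
      cover w e with ⊕-cases (geq S′ c s) e
      ... | inj₂ q = inj₂ (inj₂ q)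
      ... | inj₁ q with swap-cases (geq S c s) {x} {y} (from w q)
      ... | inj₁ (r , _) = inj₁ r
      ... | inj₂ r = inj₂ (inj₁ r)
    ... | inj₁ j = absurd j (dx′ s≤t)
    ... | inj₂ j = absurd j d

  -- This permits raising the label of the removed `y` to `t + 1`: it stays spanned at threshold
  -- `t`.
  spn-y : Dep (geq S′ c t ⊕ y)
  spn-y = up lem dx
    where
    lem : geq S c t ⊕ x ⊆ geq S′ c t ⊕ y
    lem v e with bool (v == y)
    ... | inj₁ q = ∨-r {geq S′ c t v} q
    ... | inj₂ q with ⊕-cases (geq S c t) e
    ... | inj₁ r = ⊕-there (geq S′ c t) (to ≤-refl v (swap-in (geq S c t) r (==-false⁻ q)))
    ... | inj₂ refl = ⊕-there (geq S′ c t) (to ≤-refl v (swap-x (geq S c t)))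

  -- The new threshold set spans `y`, because together with `y` it contains the dependent set
  -- `geq S c s ⊕ x`. So exchange from the larger set `geq S c s ⊕ z` can only add `z`.
  tight-keep : Ind S′ → ∀ s z → s ≤ t → z ∉ S → Ind (geq S c s ⊕ z) → Ind (geq S′ c s ⊕ z)
  tight-keep iS′ s z s≤t z∉ i
    with exch₂ {A = geq S′ c s} {geq S c s ⊕ z} {y} {z} (down (λ v → geq-S S′ c) iS′) i
           (subst₂ _<_ (sym (card s≤t)) (sym (#-⊕ (geq S c s) (geq-∉ S c z∉))) ≤-refl) cover
    where
    cover : ∀ w → w ∈ geq S c s ⊕ z → (w ∈ geq S′ c s) ⊎ (w ≡ y) ⊎ (w ≡ z)
    cover w e with ⊕-cases (geq S c s) e
    ... | inj₂ q = inj₂ (inj₂ q)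
    ... | inj₁ q with bool (w == y)
    ... | inj₁ r = inj₂ (inj₁ (==-true r))
    ... | inj₂ r = inj₁ (to s≤t w (swap-in (geq S c s) q (==-false⁻ r)))
  ... | inj₂ j = j
  ... | inj₁ j = absurd j (up lem (dx′ s≤t))
    where
    lem : geq S c s ⊕ x ⊆ geq S′ c s ⊕ y
    lem v e with bool (v == y)
    ... | inj₁ q = ∨-r {geq S′ c s v} q
    ... | inj₂ q with ⊕-cases (geq S c s) e
    ... | inj₁ r = ⊕-there (geq S′ c s) (to s≤t v (swap-in (geq S c s) r (==-false⁻ q)))
    ... | inj₂ refl = ⊕-there (geq S′ c s) (to s≤t v (swap-x (geq S c s)))

module _ {n : ℕ} (M : Mat n) where
  open MatL M

  -- Exchange from `S ⊕ x` adds `y` or `x`, and adding `y` back would yield the dependent `S ⊕ z`.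
  -- Hence a sink `x` may enter without spoiling the other exchanges of M₂, which keeps the stored
  -- parents valid along a path.
  sink-add : ∀ {S : Pr n} {x y z} → Ind (S ⊕ x) → x ∉ S → y ∈ S → z ∉ S → Dep (S ⊕ z) →
             Ind (S ⊖ y ⊕ z) → Ind (S ⊖ y ⊕ z ⊕ x)
  sink-add {S} {x} {y} {z} ix x∉ y∈ z∉ dz i
    with exch₂ {A = S ⊖ y ⊕ z} {S ⊕ x} {y} {x} i ix
           (subst₂ _<_ (sym (#-swap S y∈ z∉)) (sym (#-⊕ S x∉)) ≤-refl) cover
    where
    cover : ∀ w → w ∈ S ⊕ x → (w ∈ S ⊖ y ⊕ z) ⊎ (w ≡ y) ⊎ (w ≡ x)
    cover w e with ⊕-cases S e
    ... | inj₂ q = inj₂ (inj₂ q)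
    ... | inj₁ q with bool (w == y)
    ... | inj₁ r = inj₂ (inj₁ (==-true r))
    ... | inj₂ r = inj₁ (swap-in S q (==-false⁻ r))
  ... | inj₂ j = j
  ... | inj₁ j = absurd j (up lem dz)
    where
    lem : S ⊕ z ⊆ S ⊖ y ⊕ z ⊕ y
    lem v e with bool (v == y)
    ... | inj₁ q = ∨-r {(S ⊖ y ⊕ z) v} q
    ... | inj₂ q with ⊕-cases S e
    ... | inj₁ r = ⊕-there (S ⊖ y ⊕ z) (swap-in S r (==-false⁻ q))
    ... | inj₂ refl = ⊕-there (S ⊖ y ⊕ z) (swap-x S)

-- Deficit bounds from labels.

module Gap {n : ℕ} (MA MB : Mat n) where
  module A = MatL MA
  module B = MatL MB

  -- S has maximum weight in M₁.
  N1 : Pr n → Lab n → Set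
  N1 S c = ∀ x → x ∉ S → ∀ s → 1 ≤ s → s < c x → A.Dep (geq S c s ⊕ x)

  -- S has minimum cost in M₂, seen at the threshold t and up to a defect k.
  Dom : Pr n → Lab n → ℕ → ℕ → Set
  Dom S c k t = ∀ T → B.Ind T → (∀ v → v ∈ T → c v ≤ t) → # T ≤ # (leq S c t) + k

  -- Dominance bounds the elements of `T` with label at most `t`. All others lie in `geq S c t`, or
  -- outside `S` with a label above `t`, where `N1` puts them into the M₁-span of `geq S c t`.
  gap-level : ∀ {S c k T} t → A.Ind S → N1 S c → 1 ≤ t → Dom S c k t → A.Ind T → B.Ind T →
              # T ≤ # (geq S c t) + (# (leq S c t) + k)
  gap-level {S} {c} {k} {T} t iS n1 1≤t dom iA iB =
    ≤-trans (#-∪ {P = T₁} {T₂} cover)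
      (+-mono-≤ (A.span-bound (A.down (λ v → geq-S S c) iS) (A.down (λ v → ∧-l) iA) spn)
                (dom T₂ (B.down (λ v → ∧-l) iB) (λ v e → ≤ᵇ-t⁻ (∧-r {T v} e))))
    where
    T₁ T₂ : Pr n
    T₁ v = T v ∧ (geq S c t v ∨ (not (S v) ∧ (suc t ≤ᵇ c v)))
    T₂ v = T v ∧ (c v ≤ᵇ t)
    cover : ∀ x → x ∈ T → (x ∈ T₁) ⊎ (x ∈ T₂)
    cover x e with c x ≤? t
    ... | yes p = inj₂ (∧-intro e (≤ᵇ-t p))
    ... | no p with bool (S x)
    ... | inj₁ q = inj₁ (∧-intro e (∨-l (geq-in S c q (<⇒≤ (≰⇒> p)))))
    ... | inj₂ q = inj₁ (∧-intro e (∨-r {geq S c t x} (∧-intro (not-f q) (≤ᵇ-t (≰⇒> p)))))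
    spn : ∀ x → x ∈ T₁ → x ∉ geq S c t → A.Dep (geq S c t ⊕ x)
    spn x e q with ∨-cases {geq S c t x} (∧-r {T x} e)
    ... | inj₁ r = absurd r q
    ... | inj₂ r = n1 x (not-t (∧-l r)) t 1≤t (≤ᵇ-t⁻ (∧-r {not (S x)} r))

  -- The sum over thresholds telescopes: the upper part at `d + 1` and the lower part at `d` are
  -- disjoint in `S`, so a single lower part remains.
  gap : ∀ {S c k T} d → A.Ind S → N1 S c → (∀ t → 1 ≤ t → t ≤ d → Dom S c k t) → A.Ind T → B.Ind T →
        d * # T ≤ d * (# S + k) + # (leq S c d)
  gap zero iS n1 dom iA iB = z≤n
  gap {S} {c} {k} {T} (suc d) iS n1 dom iA iB = begin
    # T + d * # T
      ≤⟨ +-mono-≤ (gap-level (suc d) iS n1 (s≤s z≤n) (dom (suc d) (s≤s z≤n) ≤-refl) iA iB)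
                  (gap d iS n1 (λ t p q → dom t p (m≤n⇒m≤1+n q)) iA iB) ⟩
    # (geq S c (suc d)) + (# (leq S c (suc d)) + k) + (d * (# S + k) + # (leq S c d))
      ≡⟨ eq (# (geq S c (suc d))) (# (leq S c (suc d))) k (d * (# S + k)) (# (leq S c d)) ⟩
    # (geq S c (suc d)) + # (leq S c d) + (k + d * (# S + k) + # (leq S c (suc d)))
      ≤⟨ +-monoˡ-≤ _ (#-⊎ {P = geq S c (suc d)} {leq S c d} {S} (λ v → geq-S S c) (λ v → leq-S S c)
           (λ v p q → <⇒≱ (geq-≤ S c p) (leq-≤ S c q))) ⟩
    # S + (k + d * (# S + k) + # (leq S c (suc d)))
      ≡⟨ eq₂ (# S) k (d * (# S + k)) (# (leq S c (suc d))) ⟩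
    (# S + k) + d * (# S + k) + # (leq S c (suc d)) ∎
    where
    open ≤-Reasoning
    eq : ∀ a b k e f → a + (b + k) + (e + f) ≡ a + f + (k + e + b)
    eq = solve-∀
    eq₂ : ∀ a k e f → a + (k + e + f) ≡ a + k + e + f
    eq₂ = solve-∀

module Two {n : ℕ} (MA MB : Mat n) where
  module A = MatL MA
  module B = MatL MB
  open Gap MA MB public using (N1; Dom; gap)

  o : Which → Pr n → Bool
  o M₁ = Mat.ind MA
  o M₂ = Mat.ind MB

  open Run o public
  module SA = BisectL M₁ MA o (λ _ → refl)
  module SB = BisectL M₂ MB o (λ _ → refl)

  L : ℕ
  L = logn n

  len-elems : (P : Pr n) → length (elems P) ≤ 2 ^ L
  len-elems P = ≤-trans (length-elems P) (n≤2^logn n)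

  -- `x` fits with the elements above level `t` but not with those from `t` on, so some element of
  -- level exactly `t` can be exchanged for it, and bisecting that level alone suffices.
  kick-spec : ∀ {S : Pr n} {c x} t x₀ → A.Ind S → x ∉ S → A.Ind (geq S c (suc t) ⊕ x) → A.Dep (geq S c t ⊕ x) →
              wp (bisect M₁ L (geq S c (suc t) ⊕ x) (elems (at S c t)) x₀)
                 (λ y k → (y ∈ S × c y ≡ t × A.Ind (S ⊖ y ⊕ x)) × k ≤ L)
  kick-spec {S} {c} {x} t x₀ iS x∉ i d
    with SA.bisect-spec L (geq S c (suc t) ⊕ x) (elems (at S c t)) x₀ (len-elems (at S c t)) i (A.up sub d)
    where
    sub : geq S c t ⊕ x ⊆ addL (geq S c (suc t) ⊕ x) (elems (at S c t))
    sub = ⊕-⊆ {P = geq S c t} lem (addL-⊇ (elems (at S c t)) x (⊕-here (geq S c (suc t)) x))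
      where
      lem : geq S c t ⊆ addL (geq S c (suc t) ⊕ x) (elems (at S c t))
      lem v e with m≤n⇒m<n∨m≡n (geq-≤ S c e)
      ... | inj₁ p = addL-⊇ (elems (at S c t)) v (⊕-there (geq S c (suc t)) (geq-in S c (geq-S S c e) p))
      ... | inj₂ p = addL-∈ (elems (at S c t)) (∈-elems (at S c t) (at-in S c (geq-S S c e) (sym p)))
  ... | (z∈ , A′ , BA , AZ , a , ad) , le = (at-S S c (el z∈) , at-≡ S c (el z∈) ,
          A.pivot iS a A⊆ (at-S S c (el z∈)) (BA x (⊕-here (geq S c (suc t)) x)) x∉ ad) , le
    where
    el : ∀ {z} → z ∈L elems (at S c t) → z ∈ at S c t
    el = elems-∈ (at S c t)
    A⊆ : ∀ v → v ∈ A′ → v ∈ S ⊕ x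
    A⊆ v e with AZ v e
    ... | inj₂ q = ⊕-there S (at-S S c (el q))
    ... | inj₁ q = ⊕-mono {P = geq S c (suc t)} {S} (λ v → geq-S S c) v q

-- Auction

-- K collects the elements thrown out of S in the current round. They keep their old label until the
-- round ends, so that S ∪ K stays a greedy minimum-cost set of M₂.
record Auc (n : ℕ) : Set where
  constructor auc
  field
    S K : Pr n
    c   : Lab n

module _ {n : ℕ} where

  -- Below label 1 there is nothing to throw out, so an element of label 1 enters for free and `S`
  -- grows.
  push : ℕ → Fin n → Auc n → Q n (Auc n)
  push zero    v (auc S K c) = ret (auc (S ⊕ v) K c)
  push (suc u) v (auc S K c) =
    bisect M₁ (logn n) (geq S c (suc (suc u)) ⊕ v) (elems (at S c (suc u))) v >>= λ y →
    ret (auc (S ⊖ y ⊕ v) (K ⊕ y) c)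

  -- A refusal by M₂ requires no change, because cheaper elements already span `v` (`span-low`). A
  -- refusal by M₁ at the label of `v` is exactly what allows this label to be raised.
  bid : ℕ → Fin n → Auc n → Q n (Auc n)
  bid u v (auc S K c) = if S v ∨ K v ∨ not (c v ≡ᵇ suc u) then ret (auc S K c) else
    qry M₂ ((S ∪ K) ⊕ v) λ
      { false → ret (auc S K c)
      ; true  → qry M₁ (geq S c (suc u) ⊕ v) λ
          { false → ret (auc S K (upd c v (suc (suc u))))
          ; true  → push u v (auc S K c) } }

  levels : ℕ → ℕ → Auc n → Q n (Auc n)
  levels zero    u st = ret st
  levels (suc m) u st = foldQ (bid u) (allFin n) st >>= levels m (suc u)

  raise : Pr n → Lab n → Lab n
  raise K c v = if K v then suc (c v) else c v

  rounds : ℕ → ℕ → ℕ → Pr n → Lab n → Q n (Pr n)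
  rounds zero    d k S c = ret S
  rounds (suc f) d k S c = levels d 0 (auc S ∅ c) >>= λ st →
    if # (Auc.K st) ≤ᵇ k then ret (Auc.S st) else rounds f d k (Auc.S st) (raise (Auc.K st) (Auc.c st))

  -- Every unfinished round increases the load, which never exceeds `d * n`; hence the fuel.
  auction : ℕ → ℕ → Q n (Pr n)
  auction d k = rounds (suc (d * n)) d k ∅ (λ _ → 1)

  -- The potential of the auction. A swap replaces a label by the next higher one, so it adds 1 to
  -- the load.
  load : Pr n → Lab n → ℕ
  load S c = sumF (λ v → if S v then c v else 0)

  load-⊕ : ∀ (S : Pr n) c {x} → x ∉ S → load S c + c x ≤ load (S ⊕ x) c
  load-⊕ S c {x} x∉ = sum-mono-at x (c x) lem at-x
    where
    lem : ∀ w → (if S w then c w else 0) ≤ (if (S ⊕ x) w then c w else 0)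
    lem w with S w
    ... | true  = ≤-refl
    ... | false = z≤n
    at-x : (if S x then c x else 0) + c x ≤ (if (S ⊕ x) x then c x else 0)
    at-x rewrite x∉ | ==-refl x = ≤-refl

  load-⊖ : ∀ (S : Pr n) c {y} → y ∈ S → load S c ≤ load (S ⊖ y) c + c y
  load-⊖ S c {y} y∈ = ≤-trans (sum-mono lem) (≤-reflexive
      (trans (sum-+ (λ w → if (S ⊖ y) w then c w else 0) (λ w → c y * b2n (w == y)))
        (cong (load (S ⊖ y) c +_) (trans (sum-* (c y) (λ w → b2n (w == y)))
          (trans (cong (c y *_) (#-sing y)) (*-identityʳ (c y)))))))
    where
    lem : ∀ w → (if S w then c w else 0) ≤ (if (S ⊖ y) w then c w else 0) + c y * b2n (w == y)
    lem w with S w | w == y in e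
    ... | false | _ = z≤n
    ... | true | true = ≤-reflexive (trans (cong c (==-true e)) (sym (*-identityʳ (c y))))
    ... | true | false = m≤m+n (c w) _

  load-≤ : ∀ (S : Pr n) c d → (∀ v → v ∈ S → c v ≤ d) → load S c ≤ d * # S
  load-≤ S c d h = ≤-trans (sum-mono lem) (≤-reflexive (sum-* d (λ w → b2n (S w))))
    where
    lem : ∀ w → (if S w then c w else 0) ≤ d * b2n (S w)
    lem w with S w in e
    ... | true  = ≤-trans (h w e) (≤-reflexive (sym (*-identityʳ d)))
    ... | false = z≤n

-- One round of the auction.

module AuctionL {n : ℕ} (MA MB : Mat n) (d : ℕ) where
  open Two MA MB

  -- The final set W = S ∪ K of the previous round, with the labels it had then.
  record Ref (W : Pr n) (ĉ : Lab n) : Set where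
    field
      iW  : B.Ind W
      dom : ∀ s → s ≤ d → ∀ T → B.Ind T → (∀ v → v ∈ T → ĉ v ≤ s) → # T ≤ # (leq W ĉ s)

  record Inv (W : Pr n) (ĉ : Lab n) (t : ℕ) (todo : List (Fin n)) (st : Auc n) : Set where
    open Auc st
    field
      iA   : A.Ind S
      iB   : B.Ind (S ∪ K)
      disj : ∀ {v} → v ∈ K → v ∉ S
      c≥1  : ∀ v → 1 ≤ c v
      c≤d  : ∀ v → v ∈ S → c v ≤ d
      n1   : N1 S c
      n1K  : ∀ y → y ∈ K → A.Dep (geq S c (c y) ⊕ y)
      K<   : ∀ y → y ∈ K → c y < t
      r1   : ∀ v → ĉ v ≤ c v
      r2   : ∀ v → v ∈ S → t < c v → v ∈ W × ĉ v ≡ c v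
      skip : ∀ x → x ∉ S → x ∉ K → c x ≤ t → (c x ≡ t × x ∈L todo) ⊎ B.Dep (leq (S ∪ K) c (c x) ⊕ x)

  module _ {W : Pr n} {ĉ : Lab n} (ref : Ref W ĉ) where

    -- Elements of S above level t are not needed to span x, because a set reaching up to level t
    -- can be completed by them (dominance of the reference set).
    span-low : ∀ {t todo st} → Inv W ĉ t todo st → let open Auc st in t ≤ d → ∀ x → x ∉ S → x ∉ K → c x ≡ t →
               B.Dep ((S ∪ K) ⊕ x) → B.Dep (leq (S ∪ K) c t ⊕ x)
    span-low {t} {todo} {auc S K c} inv t≤d x x∉S x∉K cx dep = ¬true⇒false contra
      where
      open Inv inv
      C E Z : Pr n
      C = leq (S ∪ K) c t ⊕ x
      E = geq S c (suc t)
      Z = leq W ĉ t ∪ E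
      iZ : B.Ind Z
      iZ = B.down (λ v e → case ∨-cases {leq W ĉ t v} e of λ
        { (inj₁ q) → leq-S W ĉ q
        ; (inj₂ q) → proj₁ (r2 v (geq-S S c q) (geq-≤ S c q)) }) (Ref.iW ref)
      C≤ : ∀ v → v ∈ C → ĉ v ≤ t
      C≤ v e with ⊕-cases (leq (S ∪ K) c t) e
      ... | inj₁ q = ≤-trans (r1 v) (leq-≤ (S ∪ K) c q)
      ... | inj₂ refl = ≤-trans (r1 v) (≤-reflexive cx)
      contra : ¬ B.Ind C
      contra iC with B.extend′ iC iZ
      -- Dominance limits the part of `T` up to level `t`, so the size of `T` forces all of `E` into
      -- it. Then `T` contains `(S ∪ K) ⊕ x`, which is dependent.
      ... | T , iT , CT , TCZ , le = absurd (B.down all iT) dep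
        where
        T₁ T₂ : Pr n
        T₁ v = T v ∧ (ĉ v ≤ᵇ t)
        T₂ v = T v ∧ E v
        cover : ∀ v → v ∈ T → (v ∈ T₁) ⊎ (v ∈ T₂)
        cover v e with TCZ v e
        ... | inj₁ q = inj₁ (∧-intro e (≤ᵇ-t (C≤ v q)))
        ... | inj₂ q with ∨-cases {leq W ĉ t v} q
        ... | inj₁ r = inj₁ (∧-intro e (≤ᵇ-t (leq-≤ W ĉ r)))
        ... | inj₂ r = inj₂ (∧-intro e r)
        h₁ : # T₁ ≤ # (leq W ĉ t)
        h₁ = Ref.dom ref t t≤d T₁ (B.down (λ v → ∧-l) iT) (λ v e → ≤ᵇ-t⁻ (∧-r {T v} e))
        h₂ : # (leq W ĉ t) + # E ≤ # Z
        h₂ = #-⊎ {P = leq W ĉ t} {E} {Z} (λ v → ∨-l) (λ v → ∨-r {leq W ĉ t v})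
          (λ v p q → <⇒≱ (geq-≤ S c q) (subst (_≤ t) (proj₂ (r2 v (geq-S S c q) (geq-≤ S c q))) (leq-≤ W ĉ p)))
        h₃ : # E ≤ # T₂
        h₃ = +-cancelˡ-≤ (# (leq W ĉ t)) _ _ (≤-trans h₂ (≤-trans le
               (≤-trans (#-∪ {P = T₁} {T₂} cover) (+-monoˡ-≤ (# T₂) h₁))))
        ET : E ⊆ T
        ET v e = ∧-l (#-full {P = T₂} {E} (λ v → ∧-r {T v}) h₃ v e)
        all : (S ∪ K) ⊕ x ⊆ T
        all = ⊕-⊆ {P = S ∪ K} lem (CT x (⊕-here (leq (S ∪ K) c t) x))
          where
          lem : S ∪ K ⊆ T
          lem v e with c v ≤? t
          ... | yes p = CT v (⊕-there (leq (S ∪ K) c t) (leq-in (S ∪ K) c e p))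
          ... | no p with ∨-cases {S v} e
          ... | inj₁ q = ET v (geq-in S c q (≰⇒> p))
          ... | inj₂ q = ⊥-elim (p (<⇒≤ (K< v q)))

    -- Two queries per bid are paid outright and a bisection by the growth of the load. The last
    -- line charges each element of `K` to the load too, so that a round that throws out many
    -- elements makes progress.
    Post : ℕ → List (Fin n) → Auc n → Auc n → ℕ → Set
    Post t todo st st′ k = Inv W ĉ t todo st′
      × k + L * load (Auc.S st) (Auc.c st) ≤ 2 + L * load (Auc.S st′) (Auc.c st′)
      × # (Auc.K st′) + load (Auc.S st) (Auc.c st) ≤ # (Auc.K st) + load (Auc.S st′) (Auc.c st′)

    drop-todo : ∀ {t v vs st} → Inv W ĉ t (v ∷ vs) st → let open Auc st in
                (v ∉ S → v ∉ K → c v ≡ t → B.Dep (leq (S ∪ K) c (c v) ⊕ v)) → Inv W ĉ t vs st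
    drop-todo {t} {v} {vs} {auc S K c} inv h = record { Inv inv ; skip = lem }
      where
      lem : ∀ x → x ∉ S → x ∉ K → c x ≤ t → (c x ≡ t × x ∈L vs) ⊎ B.Dep (leq (S ∪ K) c (c x) ⊕ x)
      lem x p q r with Inv.skip inv x p q r
      ... | inj₂ dep = inj₂ dep
      ... | inj₁ (e , there m) = inj₁ (e , m)
      ... | inj₁ (e , here refl) = inj₂ (h p q e)

    bump-inv : ∀ {u v vs st} → Inv W ĉ (suc u) (v ∷ vs) st → let open Auc st in
               v ∉ S → c v ≡ suc u → A.Dep (geq S c (suc u) ⊕ v) → Inv W ĉ (suc u) vs (auc S K (upd c v (suc (suc u))))
    bump-inv {u} {v} {vs} {auc S K c} inv v∉ cv dep = record
      { iA = iA ; iB = iB ; disj = disj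
      ; c≥1 = λ w → ≤-trans (c≥1 w) (c≤ w)
      ; c≤d = λ w e → subst (_≤ d) (sym (same w (∈≢∉ {P = S} e v∉))) (c≤d w e)
      ; n1 = n1′
      ; n1K = λ y e → let ne = y≢ y e in
          subst (λ s → A.Dep (geq S c′ s ⊕ y)) (sym (same y ne)) (geqc (c y) y (n1K y e))
      ; K< = λ y e → subst (_< suc u) (sym (same y (y≢ y e))) (K< y e)
      ; r1 = λ w → ≤-trans (r1 w) (c≤ w)
      ; r2 = λ w e lt → let ne = same w (∈≢∉ {P = S} e v∉) ; (p , q) = r2 w e (subst (suc u <_) ne lt) in p , trans q (sym ne)
      ; skip = skip′ }
      where
      open Inv inv
      c′ = upd c v (suc (suc u))
      same : ∀ w → w ≢ v → c′ w ≡ c w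
      same w = upd-there c (suc (suc u))
      y≢ : ∀ y → y ∈ K → y ≢ v
      y≢ y e refl = <-irrefl cv (K< y e)
      c≤ : ∀ w → c w ≤ c′ w
      c≤ w with bool (w == v)
      ... | inj₂ q = ≤-reflexive (sym (same w (==-false⁻ q)))
      ... | inj₁ q with refl ← ==-true q = subst₂ _≤_ (sym cv) (sym (upd-here c v (suc (suc u)))) (n≤1+n _)
      geqc : ∀ s z → A.Dep (geq S c s ⊕ z) → A.Dep (geq S c′ s ⊕ z)
      geqc s z = A.up (⊕-mono {P = geq S c s} {geq S c′ s} (geq-mono {S = S} {c = c} (λ w p q → p , ≤-trans q (c≤ w))))
      n1′ : N1 S c′
      n1′ x x∉ s 1≤s s< with bool (x == v)
      ... | inj₂ q = geqc s x (n1 x x∉ s 1≤s (subst (s <_) (same x (==-false⁻ q)) s<))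
      ... | inj₁ q with refl ← ==-true q = geqc s x (A.up (⊕-mono {P = geq S c (suc u)} {geq S c s}
              (geq-mono {S = S} {c = c} (λ w p r → p , ≤-trans (s≤s⁻¹ (subst (s <_) (upd-here c v (suc (suc u))) s<)) r))) dep)
        where open import Data.Nat using (s≤s⁻¹)
      skip′ : ∀ x → x ∉ S → x ∉ K → c′ x ≤ suc u → (c′ x ≡ suc u × x ∈L vs) ⊎ B.Dep (leq (S ∪ K) c′ (c′ x) ⊕ x)
      skip′ x p q r with bool (x == v)
      ... | inj₁ e with refl ← ==-true e = ⊥-elim (1+n≰n (subst (_≤ suc u) (upd-here c v (suc (suc u))) r))
      ... | inj₂ e with ne ← ==-false⁻ e | skip x p q (subst (_≤ suc u) (same x (==-false⁻ e)) r)
      ... | inj₁ (cx , here refl) = ⊥-elim (ne refl)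
      ... | inj₁ (cx , there m) = inj₁ (trans (same x ne) cx , m)
      ... | inj₂ dp = inj₂ (subst (λ s → B.Dep (leq (S ∪ K) c′ s ⊕ x)) (sym (same x ne)) (B.up
              (⊕-mono {P = leq (S ∪ K) c (c x)} {leq (S ∪ K) c′ (c x)} low) dp))
        where
        low : leq (S ∪ K) c (c x) ⊆ leq (S ∪ K) c′ (c x)
        low w e = leq-in (S ∪ K) c′ (leq-S (S ∪ K) c e)
          (subst (_≤ c x) (sym (same w w≢)) (leq-≤ (S ∪ K) c e))
          where
          w≢ : w ≢ v
          w≢ refl with ∨-cases {S w} (leq-S (S ∪ K) c e)
          ... | inj₁ q = absurd q v∉
          ... | inj₂ q = y≢ w q refl

    push₀-inv : ∀ {v vs st} → Inv W ĉ 1 (v ∷ vs) st → 1 ≤ d → let open Auc st in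
                v ∉ S → v ∉ K → c v ≡ 1 → A.Ind (geq S c 1 ⊕ v) → B.Ind ((S ∪ K) ⊕ v) → Inv W ĉ 1 vs (auc (S ⊕ v) K c)
    push₀-inv {v} {vs} {auc S K c} inv 1≤d v∉ vK cv iAv iBv = record
      { iA = A.down (⊕-mono {P = S} {geq S c 1} (λ w e → geq-in S c e (c≥1 w))) iAv
      ; iB = B.down sub iBv
      ; disj = λ {w} e → ⊕-∉ S (disj e) (∈≢∉ {P = K} e vK)
      ; c≥1 = c≥1
      ; c≤d = λ w e → case ⊕-cases S e of λ { (inj₁ q) → c≤d w q ; (inj₂ refl) → ≤-trans (≤-reflexive cv) 1≤d }
      ; n1 = λ x e s p q → up-geq s x (n1 x (∨-fl e) s p q)
      ; n1K = λ y e → up-geq (c y) y (n1K y e)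
      ; K< = K<
      ; r1 = r1
      ; r2 = λ w e lt → case ⊕-cases S e of λ { (inj₁ q) → r2 w q lt ; (inj₂ refl) → ⊥-elim (<-irrefl (sym cv) lt) }
      ; skip = skip′ }
      where
      open Inv inv
      sub : (S ⊕ v) ∪ K ⊆ (S ∪ K) ⊕ v
      sub w e with ∨-cases {(S ⊕ v) w} e
      ... | inj₂ q = ⊕-there (S ∪ K) (∨-r {S w} q)
      ... | inj₁ q with ⊕-cases S q
      ... | inj₁ r = ⊕-there (S ∪ K) (∨-l r)
      ... | inj₂ refl = ⊕-here (S ∪ K) w
      up-geq : ∀ s z → A.Dep (geq S c s ⊕ z) → A.Dep (geq (S ⊕ v) c s ⊕ z)
      up-geq s z = A.up (⊕-mono {P = geq S c s} {geq (S ⊕ v) c s} (geq-mono {S = S} {c = c} (λ w p q → ⊕-there S p , q)))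
      skip′ : ∀ x → x ∉ S ⊕ v → x ∉ K → c x ≤ 1 → (c x ≡ 1 × x ∈L vs) ⊎ B.Dep (leq ((S ⊕ v) ∪ K) c (c x) ⊕ x)
      skip′ x p q r with skip x (∨-fl p) q r
      ... | inj₁ (e , there m) = inj₁ (e , m)
      ... | inj₁ (e , here refl) = absurd (⊕-here S x) p
      ... | inj₂ dp = inj₂ (B.up (⊕-mono {P = leq (S ∪ K) c (c x)} {leq ((S ⊕ v) ∪ K) c (c x)} λ w e →
              leq-in ((S ⊕ v) ∪ K) c (case ∨-cases {S w} (leq-S (S ∪ K) c e) of λ
                { (inj₁ t) → ∨-l (⊕-there S t) ; (inj₂ t) → ∨-r {(S ⊕ v) w} t }) (leq-≤ (S ∪ K) c e)) dp)

    push-inv : ∀ {u v vs st y} → Inv W ĉ (suc (suc u)) (v ∷ vs) st → suc (suc u) ≤ d → let open Auc st in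
               v ∉ S → v ∉ K → c v ≡ suc (suc u) → B.Ind ((S ∪ K) ⊕ v) →
               y ∈ S → c y ≡ suc u → A.Ind (S ⊖ y ⊕ v) → Inv W ĉ (suc (suc u)) vs (auc (S ⊖ y ⊕ v) (K ⊕ y) c)
    push-inv {u} {v} {vs} {auc S K c} {y} inv t≤d v∉ vK cv iBv y∈ cy iA′ = record
      { iA = iA′
      ; iB = B.down sub iBv
      ; disj = λ {w} e → case ⊕-cases K e of λ
          { (inj₁ q) → ⊕-∉ (S ⊖ y) (∧-f-l (disj q)) (∈≢∉ {P = K} q vK)
          ; (inj₂ refl) → ⊕-∉ (S ⊖ w) (⊖-here S w) (∈≢∉ {P = S} y∈ v∉) }
      ; c≥1 = c≥1
      ; c≤d = λ w e → case swap-cases S e of λ { (inj₁ (q , _)) → c≤d w q ; (inj₂ refl) → ≤-trans (≤-reflexive cv) t≤d }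
      ; n1 = λ x e s p q → case swap-∉ S e of λ
          { (inj₁ x∉ , ne) → spn-keep s x x∉ ne (n1 x x∉ s p q)
          ; (inj₂ refl , ne) → A.up (⊕-mono {P = geq S′ c (suc u)} {geq S′ c s}
              (geq-mono {S = S′} {c = c} (λ w a b → a , ≤-trans (≤-trans (n≤1+n s) (subst (suc s ≤_) cy q)) b))) spn-y }
      ; n1K = λ w e → case ⊕-cases K e of λ
          { (inj₁ q) → spn-keep (c w) w (disj q) (∈≢∉ {P = K} q vK) (n1K w q)
          ; (inj₂ refl) → subst (λ s → A.Dep (geq S′ c s ⊕ w)) (sym cy) spn-y }
      ; K< = λ w e → case ⊕-cases K e of λ { (inj₁ q) → K< w q ; (inj₂ refl) → s≤s (≤-reflexive cy) }
      ; r1 = r1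
      ; r2 = λ w e lt → case swap-cases S e of λ { (inj₁ (q , _)) → r2 w q lt ; (inj₂ refl) → ⊥-elim (<-irrefl (sym cv) lt) }
      ; skip = skip′ }
      where
      open Inv inv
      open PushL MA S c v y (suc u) iA v∉ y∈ cy cv (n1 v v∉ (suc u) (s≤s z≤n) (≤-reflexive (sym cv)))
      sub : S′ ∪ (K ⊕ y) ⊆ (S ∪ K) ⊕ v
      sub w e with ∨-cases {S′ w} e
      ... | inj₂ q = ⊕-there (S ∪ K) (case ⊕-cases K q of λ { (inj₁ r) → ∨-r {S w} r ; (inj₂ refl) → ∨-l y∈ })
      ... | inj₁ q with swap-cases S q
      ... | inj₁ (r , _) = ⊕-there (S ∪ K) (∨-l r)
      ... | inj₂ refl = ⊕-here (S ∪ K) w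
      keep : S ∪ K ⊆ S′ ∪ (K ⊕ y)
      keep w e with ∨-cases {S w} e
      ... | inj₂ q = ∨-r {S′ w} (⊕-there K q)
      ... | inj₁ q with bool (w == y)
      ... | inj₁ r = ∨-r {S′ w} (∨-r {K w} r)
      ... | inj₂ r = ∨-l (swap-in S q (==-false⁻ r))
      skip′ : ∀ x → x ∉ S′ → x ∉ K ⊕ y → c x ≤ suc (suc u) →
              (c x ≡ suc (suc u) × x ∈L vs) ⊎ B.Dep (leq (S′ ∪ (K ⊕ y)) c (c x) ⊕ x)
      skip′ x p q r with swap-∉ S p
      ... | inj₂ refl , _ = absurd (⊕-here K x) q
      ... | inj₁ x∉ , ne with skip x x∉ (∨-fl q) r
      ... | inj₁ (e , there m) = inj₁ (e , m)
      ... | inj₁ (e , here refl) = ⊥-elim (ne refl)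
      ... | inj₂ dp = inj₂ (B.up (⊕-mono {P = leq (S ∪ K) c (c x)} {leq (S′ ∪ (K ⊕ y)) c (c x)}
              (λ w e → leq-in (S′ ∪ (K ⊕ y)) c (keep w (leq-S (S ∪ K) c e)) (leq-≤ (S ∪ K) c e))) dp)

    bid-spec : ∀ u v vs st → suc u ≤ d → Inv W ĉ (suc u) (v ∷ vs) st → wp (bid u v st) (Post (suc u) vs st)
    bid-spec u v vs st@(auc S K c) u<d inv with S v ∨ K v ∨ not (c v ≡ᵇ suc u) in e
    ... | true = drop-todo inv bad , m≤n+m _ 2 , ≤-refl
      where
      bad : v ∉ S → v ∉ K → c v ≡ suc u → B.Dep (leq (S ∪ K) c (c v) ⊕ v)
      bad p q r with ∨-cases {S v} e
      ... | inj₁ x = absurd x p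
      ... | inj₂ y with ∨-cases {K v} y
      ... | inj₁ x = absurd x q
      ... | inj₂ x = absurd (≡ᵇ-t r) (not-t x)
    ... | false with B.ind ((S ∪ K) ⊕ v) in eB
    ...   | false = drop-todo inv (λ p q r → subst (λ s → B.Dep (leq (S ∪ K) c s ⊕ v)) (sym r) (span-low inv u<d v p q r eB))
              , n≤1+n _ , ≤-refl
    ...   | true with A.ind (geq S c (suc u) ⊕ v) in eA
    ...     | false = bump-inv inv v∉ cv eA , ≤-reflexive (cong (λ l → 2 + L * l) same) , ≤-reflexive (cong (# K +_) same)
      where
      v∉ = ∨-fl {S v} e
      cv : c v ≡ suc u
      cv = ≡ᵇ-t⁻ (not-ff (∨-fr {K v} (∨-fr {S v} e)))
      same : load S c ≡ load S (upd c v (suc (suc u)))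
      same = sum-cong lem
        where
        lem : ∀ w → (if S w then c w else 0) ≡ (if S w then upd c v (suc (suc u)) w else 0)
        lem w with S w in es
        ... | false = refl
        ... | true = sym (upd-there c _ (∈≢∉ {P = S} es v∉))
    bid-spec zero v vs st@(auc S K c) u<d inv | false | true | true =
      push₀-inv inv u<d v∉ (∨-fl (∨-fr {S v} e)) cv eA eB
      , +-monoʳ-≤ 2 (*-monoʳ-≤ L more) , +-monoʳ-≤ (# K) more
      where
      v∉ = ∨-fl {S v} e
      cv : c v ≡ 1
      cv = ≡ᵇ-t⁻ (not-ff (∨-fr {K v} (∨-fr {S v} e)))
      more : load S c ≤ load (S ⊕ v) c
      more = ≤-trans (m≤m+n _ (c v)) (load-⊕ S c v∉)
    bid-spec (suc u) v vs st@(auc S K c) u<d inv | false | true | true =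
      wp->>= (bisect M₁ L (geq S c (suc (suc u)) ⊕ v) (elems (at S c (suc u))) v) (λ y → ret (auc (S ⊖ y ⊕ v) (K ⊕ y) c))
        (λ st′ k → Post (suc (suc u)) vs st st′ (suc (suc k))) (main (kick-spec (suc u) v iA v∉ eA
          (n1 v v∉ (suc u) (s≤s z≤n) (≤-reflexive (sym cv)))))
      where
      open Inv inv
      v∉ = ∨-fl {S v} e
      cv : c v ≡ suc (suc u)
      cv = ≡ᵇ-t⁻ (not-ff (∨-fr {K v} (∨-fr {S v} e)))
      main : ∀ {y k} → (y ∈ S × c y ≡ suc u × A.Ind (S ⊖ y ⊕ v)) × k ≤ L →
             Post (suc (suc u)) vs st (auc (S ⊖ y ⊕ v) (K ⊕ y) c) (suc (suc (k + 0)))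
      main {y} {k} ((y∈ , cy , iA′) , le) =
        push-inv inv u<d v∉ (∨-fl (∨-fr {S v} e)) cv eB y∈ cy iA′
        , s≤s (s≤s (begin
            k + 0 + L * load S c  ≡⟨ cong (_+ L * load S c) (+-identityʳ k) ⟩
            k + L * load S c      ≤⟨ +-monoˡ-≤ _ le ⟩
            L + L * load S c      ≡⟨ sym (*-suc L (load S c)) ⟩
            L * suc (load S c)    ≤⟨ *-monoʳ-≤ L more ⟩
            L * load (S ⊖ y ⊕ v) c ∎))
        , ≤-trans (≤-reflexive (cong (_+ load S c) (#-⊕ K (¬true⇒false (λ q → absurd y∈ (disj q))))))
                  (≤-trans (≤-reflexive (sym (+-suc (# K) (load S c)))) (+-monoʳ-≤ (# K) more))
        where
        open ≤-Reasoning
        more : suc (load S c) ≤ load (S ⊖ y ⊕ v) c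
        more = begin
          suc (load S c)               ≤⟨ s≤s (load-⊖ S c y∈) ⟩
          suc (load (S ⊖ y) c + c y)   ≡⟨ sym (+-suc _ (c y)) ⟩
          load (S ⊖ y) c + suc (c y)   ≡⟨ cong (λ s → load (S ⊖ y) c + s) (trans (cong suc cy) (sym cv)) ⟩
          load (S ⊖ y) c + c v         ≤⟨ load-⊕ (S ⊖ y) c (∧-f-l v∉) ⟩
          load (S ⊖ y ⊕ v) c           ∎

-- All rounds of the auction.

module AuctionT {n : ℕ} (MA MB : Mat n) (d : ℕ) where
  open Two MA MB
  open AuctionL MA MB d

  module _ {W : Pr n} {ĉ : Lab n} (ref : Ref W ĉ) where

    next-level : ∀ {u st} → Inv W ĉ u [] st → Inv W ĉ (suc u) (allFin n) st
    next-level {u} {auc S K c} inv = record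
      { Inv inv
      ; K< = λ y e → m≤n⇒m≤1+n (K< y e)
      ; r2 = λ v e lt → r2 v e (<-trans (n<1+n u) lt)
      ; skip = skip′ }
      where
      open Inv inv
      skip′ : ∀ x → x ∉ S → x ∉ K → c x ≤ suc u → (c x ≡ suc u × x ∈L allFin n) ⊎ B.Dep (leq (S ∪ K) c (c x) ⊕ x)
      skip′ x p q r with m≤n⇒m<n∨m≡n r
      ... | inj₂ e = inj₁ (e , ∈-allFin x)
      ... | inj₁ (s≤s lt) with skip x p q lt
      ... | inj₂ dp = inj₂ dp

    LPost : ℕ → Auc n → Auc n → ℕ → Set
    LPost b st st′ k = k + L * load (Auc.S st) (Auc.c st) ≤ b + L * load (Auc.S st′) (Auc.c st′)
      × # (Auc.K st′) + load (Auc.S st) (Auc.c st) ≤ # (Auc.K st) + load (Auc.S st′) (Auc.c st′)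

    fold-spec : ∀ u st → suc u ≤ d → Inv W ĉ u [] st →
                wp (foldQ (bid u) (allFin n) st) (λ st′ k → Inv W ĉ (suc u) [] st′ × LPost (2 * n) st st′ k)
    fold-spec u st u<d inv =
      let (i , p , q) = wp-fold (bid u) P step (allFin n) st 0
            (next-level inv , +-monoˡ-≤ _ (≤-reflexive (cong (2 *_) (length-tabulate {n = n} (λ x → x)))) , ≤-refl)
      in i , ≤-trans (≤-reflexive (cong (_+ L * load (Auc.S st) (Auc.c st)) (sym (+-identityʳ _)))) p , q
      where
      P : List (Fin n) → Auc n → ℕ → Set
      P vs st′ k = Inv W ĉ (suc u) vs st′ × LPost (2 * n) st st′ (k + 2 * length vs)
      step : ∀ v vs s k → P (v ∷ vs) s k → wp (bid u v s) (λ s′ k′ → P vs s′ (k + k′))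
      step v vs s k (i , p , q) with bid-spec ref u v vs s u<d i
      ... | i′ , p′ , q′ = i′ ,
          +-cancelʳ-≤ (2 + ls) _ _ (begin
            k + k′ + 2 * length vs + l₀ + (2 + ls)     ≡⟨ eq k k′ (length vs) l₀ ls ⟩
            k + 2 * suc (length vs) + l₀ + (k′ + ls)   ≤⟨ +-mono-≤ p p′ ⟩
            2 * n + ls + (2 + ls′)                     ≡⟨ eq₂ n ls ls′ ⟩
            2 * n + ls′ + (2 + ls)                     ∎)
          , +-cancelʳ-≤ (# (Auc.K s) + load (Auc.S s) (Auc.c s)) _ _
              (subst₂ _≤_ (eq₃ (# (Auc.K s)) _ (# (Auc.K s″)) (load (Auc.S s) (Auc.c s)))
                          (eq₃′ (# (Auc.K st)) (load (Auc.S s) (Auc.c s)) (# (Auc.K s)) _) (+-mono-≤ q q′))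
        where
        open ≤-Reasoning
        s″ = val (bid u v s)
        k′ = cost (bid u v s)
        l₀ = L * load (Auc.S st) (Auc.c st)
        ls = L * load (Auc.S s) (Auc.c s)
        ls′ = L * load (Auc.S s″) (Auc.c s″)
        eq : ∀ a b l x y → a + b + 2 * l + x + (2 + y) ≡ a + 2 * suc l + x + (b + y)
        eq = solve-∀
        eq₂ : ∀ a x y → 2 * a + x + (2 + y) ≡ 2 * a + y + (2 + x)
        eq₂ = solve-∀
        eq₃ : ∀ a b e f → a + b + (e + f) ≡ e + b + (a + f)
        eq₃ = solve-∀
        eq₃′ : ∀ a b e f → a + b + (e + f) ≡ a + f + (e + b)
        eq₃′ = solve-∀

    levels-spec : ∀ m u st → u + m ≡ d → Inv W ĉ u [] st →
                  wp (levels m u st) (λ st′ k → Inv W ĉ d [] st′ × LPost (m * (2 * n)) st st′ k)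
    levels-spec zero u st e inv = subst (λ t → Inv W ĉ t [] st) (trans (sym (+-identityʳ u)) e) inv , ≤-refl , ≤-refl
    levels-spec (suc m) u st e inv =
      wp->>= (foldQ (bid u) (allFin n) st) (levels m (suc u)) (λ st′ k → Inv W ĉ d [] st′ × LPost (suc m * (2 * n)) st st′ k) main
      where
      e′ : suc u + m ≡ d
      e′ = trans (sym (+-suc u m)) e
      main : wp (foldQ (bid u) (allFin n) st) (λ s k → wp (levels m (suc u) s)
               (λ st′ k′ → Inv W ĉ d [] st′ × LPost (suc m * (2 * n)) st st′ (k + k′)))
      main with fold-spec u st (subst (suc u ≤_) e′ (m≤m+n (suc u) m)) inv
      ... | i , p , q with levels-spec m (suc u) (val (foldQ (bid u) (allFin n) st)) e′ i
      ... | i′ , p′ , q′ = i′ ,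
          glue (cost m₁) (cost m₂) (L * ld st) (L * ld s₁) (L * ld s₂) (2 * n) (m * (2 * n)) p p′ ,
          glue₂ (# (Auc.K st)) (# (Auc.K s₁)) (# (Auc.K s₂)) (ld st) (ld s₁) (ld s₂) q q′
        where
        ld : Auc n → ℕ
        ld st = load (Auc.S st) (Auc.c st)
        m₁ = foldQ (bid u) (allFin n) st
        s₁ = val m₁
        m₂ = levels m (suc u) s₁
        s₂ = val m₂
        glue : ∀ k k′ a b c f g → k + a ≤ f + b → k′ + b ≤ g + c → k + k′ + a ≤ f + g + c
        glue k k′ a b c f g h h′ = +-cancelʳ-≤ b _ _ (subst₂ _≤_ (eq k a k′ b) (eq₂ f b g c) (+-mono-≤ h h′))
          where
          eq : ∀ k a k′ b → k + a + (k′ + b) ≡ k + k′ + a + b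
          eq = solve-∀
          eq₂ : ∀ f b g c → f + b + (g + c) ≡ f + g + c + b
          eq₂ = solve-∀
        glue₂ : ∀ x y z a b c → y + a ≤ x + b → z + b ≤ y + c → z + a ≤ x + c
        glue₂ x y z a b c h h′ = +-cancelʳ-≤ (y + b) _ _ (subst₂ _≤_ (eq y a z b) (eq₂ x b y c) (+-mono-≤ h h′))
          where
          eq : ∀ y a z b → y + a + (z + b) ≡ z + a + (y + b)
          eq = solve-∀
          eq₂ : ∀ x b y c → x + b + (y + c) ≡ x + c + (y + b)
          eq₂ = solve-∀

    end-dom : ∀ {st} → Inv W ĉ d [] st → let open Auc st in ∀ s → s ≤ d → ∀ T → B.Ind T → (∀ v → v ∈ T → c v ≤ s) → # T ≤ # (leq (S ∪ K) c s)
    end-dom {auc S K c} inv s s≤d T iT T≤ = B.span-bound (B.down (λ v → leq-S (S ∪ K) c) iB) iT spn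
      where
      open Inv inv
      spn : ∀ x → x ∈ T → x ∉ leq (S ∪ K) c s → B.Dep (leq (S ∪ K) c s ⊕ x)
      spn x e q with bool ((S ∪ K) x)
      ... | inj₁ p = absurd (leq-in (S ∪ K) c p (T≤ x e)) q
      ... | inj₂ p with skip x (∨-fl p) (∨-fr {S x} p) (≤-trans (T≤ x e) s≤d)
      ... | inj₂ dp = B.up (⊕-mono {P = leq (S ∪ K) c (c x)} {leq (S ∪ K) c s}
              (λ w a → leq-in (S ∪ K) c (leq-S (S ∪ K) c a) (≤-trans (leq-≤ (S ∪ K) c a) (T≤ x e)))) dp

    -- `S ∪ K` dominates without defect, so `S` alone does with defect `# K`. This is why the
    -- auction may stop as soon as a round throws out few elements.
    end-gap : ∀ {st} → Inv W ĉ d [] st → let open Auc st in ∀ T → A.Ind T → B.Ind T → d * # T ≤ d * (# S + # K) + # S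
    end-gap {auc S K c} inv T iT jT = ≤-trans (gap d iA n1 dom iT jT) (+-monoʳ-≤ (d * (# S + # K)) (#-mono {P = leq S c d} (λ v → leq-S S c)))
      where
      open Inv inv
      dom : ∀ t → 1 ≤ t → t ≤ d → Dom S c (# K) t
      dom t _ t≤d T iT T≤ = ≤-trans (end-dom inv t t≤d T iT T≤) (#-∪ {P = leq S c t} {K} λ x e →
        case ∨-cases {S x} (leq-S (S ∪ K) c e) of λ
          { (inj₁ p) → inj₁ (leq-in S c p (leq-≤ (S ∪ K) c e)) ; (inj₂ p) → inj₂ p })

    -- `K` gets its higher labels only here. The reference keeps the labels from before, for which
    -- `S ∪ K` is dominant.
    next-round : ∀ {st} → Inv W ĉ d [] st → let open Auc st in Inv (S ∪ K) c 0 [] (auc S ∅ (raise K c))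
    next-round {auc S K c} inv = record
      { iA = iA
      ; iB = B.down (λ v e → case ∨-cases {S v} e of λ { (inj₁ p) → ∨-l p }) iB
      ; disj = λ ()
      ; c≥1 = λ v → ≤-trans (c≥1 v) (up≤ v)
      ; c≤d = λ v e → subst (_≤ d) (sym (onS v e)) (c≤d v e)
      ; n1 = n1′
      ; n1K = λ _ ()
      ; K< = λ _ ()
      ; r1 = up≤
      ; r2 = λ v e _ → ∨-l e , sym (onS v e)
      ; skip = λ x _ _ le → ⊥-elim (<⇒≱ (≤-trans (c≥1 x) (up≤ x)) le) }
      where
      open Inv inv
      c′ = raise K c
      up≤ : ∀ v → c v ≤ c′ v
      up≤ v with K v
      ... | true  = n≤1+n _
      ... | false = ≤-refl
      onS : ∀ v → v ∈ S → c′ v ≡ c v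
      onS v e with K v in k
      ... | true  = absurd e (disj k)
      ... | false = refl
      toK : ∀ {s z} → A.Dep (geq S c s ⊕ z) → A.Dep (geq S c′ s ⊕ z)
      toK {s} = A.up (⊕-mono {P = geq S c s} {geq S c′ s} (geq-mono {S = S} {c = c} (λ v p q → p , ≤-trans q (up≤ v))))
      n1′ : N1 S c′
      n1′ x x∉ s 1≤s s< with K x in k
      ... | false = toK (n1 x x∉ s 1≤s s<)
      ... | true = toK (A.up (⊕-mono {P = geq S c (c x)} {geq S c s} (geq-mono {S = S} {c = c} (λ v p q → p , ≤-trans (≤-pred s<) q))) (n1K x k))

  RPost : ℕ → ℕ → Pr n → Lab n → Pr n → ℕ → Set
  RPost k w S₀ c₀ S κ = A.Ind S × B.Ind S
    × (∀ T → A.Ind T → B.Ind T → d * # T ≤ d * (# S + k) + # S)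
    × κ + (w + L) * load S₀ c₀ ≤ d * (2 * n) + (w + L) * (d * # S)

  -- `w` is the price of one unit of load: an unfinished round raises the load by more than `k`,
  -- which pays for its `d * (2 * n)` direct queries. Only the last round is paid separately.
  rounds-spec : ∀ k w → d * (2 * n) ≤ w * suc k → ∀ f S c {W ĉ} → Ref W ĉ → Inv W ĉ 0 [] (auc S ∅ c) →
                d * n < f + load S c → wp (rounds f d k S c) (RPost k w S c)
  rounds-spec k w hw zero S c ref inv lt =
    ⊥-elim (<⇒≱ lt (≤-trans (load-≤ S c d (Inv.c≤d inv)) (*-monoʳ-≤ d (#≤n S))))
  rounds-spec k w hw (suc f) S c ref inv lt =
    wp->>= (levels d 0 (auc S ∅ c)) (λ st → if # (Auc.K st) ≤ᵇ k then ret (Auc.S st) else rounds f d k (Auc.S st) (raise (Auc.K st) (Auc.c st)))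
      (RPost k w S c) (main (levels-spec ref d 0 (auc S ∅ c) refl inv))
    where
    main : ∀ {st κ} → Inv _ _ d [] st × LPost ref (d * (2 * n)) (auc S ∅ c) st κ →
           wp (if # (Auc.K st) ≤ᵇ k then ret (Auc.S st) else rounds f d k (Auc.S st) (raise (Auc.K st) (Auc.c st)))
              (λ S′ κ′ → RPost k w S c S′ (κ + κ′))
    main {st@(auc S′ K′ c′)} {κ} (i , p , q) with # K′ ≤ᵇ k in e
    ... | true = Inv.iA i , B.down (λ v → ∨-l) (Inv.iB i)
          , (λ T iT jT → ≤-trans (end-gap ref i T iT jT) (+-monoˡ-≤ (# S′) (*-monoʳ-≤ d (+-monoʳ-≤ (# S′) (≤ᵇ-t⁻ e)))))
          , (begin
              κ + 0 + (w + L) * l₀                      ≡⟨ eq κ w L l₀ ⟩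
              κ + L * l₀ + w * l₀                       ≤⟨ +-mono-≤ p (*-monoʳ-≤ w l₀≤) ⟩
              d * (2 * n) + L * l′ + w * l′             ≡⟨ eq₂ (d * (2 * n)) L w l′ ⟩
              d * (2 * n) + (w + L) * l′                ≤⟨ +-monoʳ-≤ (d * (2 * n)) (*-monoʳ-≤ (w + L) (load-≤ S′ c′ d (Inv.c≤d i))) ⟩
              d * (2 * n) + (w + L) * (d * # S′)        ∎)
      where
      open ≤-Reasoning
      l₀ = load S c
      l′ = load S′ c′
      l₀≤ : l₀ ≤ l′
      l₀≤ = ≤-trans (m≤n+m l₀ (# K′)) (subst (λ z → # K′ + l₀ ≤ z + l′) (#-∅ {n}) q)
      eq : ∀ a w l x → a + 0 + (w + l) * x ≡ a + l * x + w * x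
      eq = solve-∀
      eq₂ : ∀ a l w x → a + l * x + w * x ≡ a + (w + l) * x
      eq₂ = solve-∀
    ... | false with rounds-spec k w hw f S′ (raise K′ c′) (record { iW = Inv.iB i ; dom = end-dom ref i }) (next-round ref i)
                      (≤-trans (≤-trans lt (≤-reflexive (sym (+-suc f (load S c))))) (+-monoʳ-≤ f l₀<))
      where
      l₀< : suc (load S c) ≤ load S′ (raise K′ c′)
      l₀< = ≤-trans (+-monoˡ-≤ (load S c) (≤-trans (s≤s z≤n) (≤ᵇ-f⁻ e)))
              (≤-trans (subst (λ z → # K′ + load S c ≤ z + load S′ c′) (#-∅ {n}) q) (sum-mono lem))
        where
        lem : ∀ v → (if S′ v then c′ v else 0) ≤ (if S′ v then raise K′ c′ v else 0)
        lem v with S′ v | K′ v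
        ... | false | _ = z≤n
        ... | true | true = n≤1+n _
        ... | true | false = ≤-refl
    ... | a , b , g , h = a , b , g , (begin
              κ + κ′ + (w + L) * l₀                       ≤⟨ +-cancelʳ-≤ (w * suc k) _ _ (begin
                κ + κ′ + (w + L) * l₀ + w * suc k           ≡⟨ eq κ κ′ w L l₀ (suc k) ⟩
                κ + L * l₀ + w * (suc k + l₀) + κ′          ≤⟨ +-monoˡ-≤ κ′ (+-mono-≤ p (*-monoʳ-≤ w l₀<)) ⟩
                d * (2 * n) + L * l′ + w * l′ + κ′          ≤⟨ +-monoˡ-≤ κ′ (+-monoˡ-≤ (w * l′) (+-monoˡ-≤ (L * l′) hw)) ⟩
                w * suc k + L * l′ + w * l′ + κ′            ≡⟨ eq₂ (w * suc k) L w l′ κ′ ⟩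
                κ′ + (w + L) * l′ + w * suc k               ∎) ⟩
              κ′ + (w + L) * l′                           ≤⟨ +-monoʳ-≤ κ′ (*-monoʳ-≤ (w + L) l′≤) ⟩
              κ′ + (w + L) * load S′ (raise K′ c′)        ≤⟨ h ⟩
              d * (2 * n) + (w + L) * (d * # (val (rounds f d k S′ (raise K′ c′)))) ∎)
      where
      open ≤-Reasoning
      κ′ = cost (rounds f d k S′ (raise K′ c′))
      l₀ = load S c
      l′ = load S′ c′
      l₀< : suc k + l₀ ≤ l′
      l₀< = ≤-trans (+-monoˡ-≤ l₀ (≤ᵇ-f⁻ e)) (subst (λ z → # K′ + load S c ≤ z + load S′ c′) (#-∅ {n}) q)
      l′≤ : l′ ≤ load S′ (raise K′ c′)
      l′≤ = sum-mono lem
        where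
        lem : ∀ v → (if S′ v then c′ v else 0) ≤ (if S′ v then raise K′ c′ v else 0)
        lem v with S′ v | K′ v
        ... | false | _ = z≤n
        ... | true | true = n≤1+n _
        ... | true | false = ≤-refl
      eq : ∀ a b w l x y → a + b + (w + l) * x + w * y ≡ a + l * x + w * (y + x) + b
      eq = solve-∀
      eq₂ : ∀ y l w x b → y + l * x + w * x + b ≡ b + (w + l) * x + y
      eq₂ = solve-∀

  auction-spec : ∀ k w → d * (2 * n) ≤ w * suc k → wp (auction d k) (λ S κ → A.Ind S × B.Ind S
    × (∀ T → A.Ind T → B.Ind T → d * # T ≤ d * (# S + k) + # S)
    × κ ≤ d * (2 * n) + (w + L) * (d * # S))
  auction-spec k w hw with B.basis
  -- Any basis of M₂ with all labels 1 is a reference for the first round.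
  ... | W , iW , mx with rounds-spec k w hw (suc (d * n)) ∅ (λ _ → 1) {W} {λ _ → 1} ref inv (s≤s (m≤m+n (d * n) _))
    where
    ref : Ref W (λ _ → 1)
    ref = record { iW = iW ; dom = λ { zero _ T iT T≤ → B.span-bound (B.down (λ v → leq-S W (λ _ → 1)) iW) iT (λ x e _ → ⊥-elim (1+n≰n (T≤ x e)))
                                     ; (suc s) _ T iT T≤ → B.span-bound (B.down (λ v → leq-S W (λ _ → 1)) iW) iT
                                         (λ x e q → B.up (⊕-mono {P = W} {leq W (λ _ → 1) (suc s)} (λ v a → leq-in W (λ _ → 1) a (s≤s z≤n)))
                                           (mx x (¬true⇒false (λ a → absurd (leq-in W (λ _ → 1) a (s≤s z≤n)) q)))) } }
    inv : Inv W (λ _ → 1) 0 [] (auc ∅ ∅ (λ _ → 1))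
    inv = record
      { iA = A.empt ; iB = B.empt ; disj = λ () ; c≥1 = λ _ → ≤-refl ; c≤d = λ _ ()
      ; n1 = λ x _ s 1≤s s<1 → ⊥-elim (<⇒≱ s<1 1≤s) ; n1K = λ _ () ; K< = λ _ ()
      ; r1 = λ _ → ≤-refl ; r2 = λ _ () ; skip = λ x _ _ () }
  ... | a , b , g , h = a , b , g , m+n≤o⇒m≤o _ h

length-elems≡# : ∀ {n} (P : Pr n) → length (elems P) ≡ # P
length-elems≡# P = go P (λ x → x)
  where
  go : ∀ {n m} (P : Pr n) (f : Fin m → Fin n) → length (filterᵇ P (tabulateL f)) ≡ sumF (λ i → b2n (P (f i)))
  go {m = zero} P f = refl
  go {m = suc m} P f with P (f zero)
  ... | true  = cong suc (go P (f ∘ suc))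
  ... | false = go P (f ∘ suc)

-- Shortest augmenting paths

-- lev counts the completed levels, so the level worked on has label suc lev. par y is an element
-- outside S of the same label that M₂ accepts in exchange for y.
record Cfg (n : ℕ) : Set where
  constructor cfg
  field
    lev : ℕ
    S   : Pr n
    c   : Lab n
    par : Fin n → Fin n

module _ {n : ℕ} where

  bumpX : ℕ → Pr n → Pr n → Lab n → Lab n
  bumpX t S kp c v = if not (S v) ∧ (c v ≡ᵇ t) ∧ not (kp v) then suc t else c v

  bumpY : ℕ → Pr n → Pr n → Lab n → Lab n
  bumpY t S fd c v = if S v ∧ (c v ≡ᵇ t) ∧ not (fd v) then suc t else c v

  findSink : Pr n → List (Fin n) → Q n (Maybe (Fin n))
  findSink S []       = ret nothing
  findSink S (v ∷ vs) = qry M₂ (S ⊕ v) λ { true → ret (just v) ; false → findSink S vs }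

  unfound : ℕ → Pr n → Lab n → Pr n → Pr n
  unfound t S c fd v = at S c t v ∧ not (fd v)

  -- M₂ spans `x` by labels up to `t`. As long as the lower labels and the elements found so far do
  -- not span it, the level holds another partner of `x`. Each success finds a new `y`, so the cost
  -- per `x` is one failing query.
  grab : ℕ → Pr n → Lab n → ℕ → Fin n → Pr n × (Fin n → Fin n) → Q n (Pr n × (Fin n → Fin n))
  grab t S c zero    x st = ret st
  grab t S c (suc f) x (fd , par) = qry M₂ ((ltq S c t ∪ fd) ⊕ x) λ
    { false → ret (fd , par)
    ; true  → bisect M₂ (logn n) ((ltq S c t ∪ fd) ⊕ x) (elems (unfound t S c fd)) x >>= λ y →
              grab t S c f x (fd ⊕ y , upd par y x) }

  discover : ℕ → Pr n → Lab n → Pr n → (Fin n → Fin n) → Q n (Pr n × (Fin n → Fin n))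
  discover t S c kp par = foldQ (grab t S c n) (elems kp) (∅ , par)

  -- The search has stored the M₂ partners. Those of M₁ are found only now, by bisection in the set
  -- as changed by the part of the path already traced.
  aug : ℕ → Pr n → Lab n → (Fin n → Fin n) → Fin n → Q n (Pr n × Lab n)
  aug zero    S c par x = ret (S ⊕ x , c)
  aug (suc u) S c par x =
    bisect M₁ (logn n) (geq S c (suc (suc u)) ⊕ x) (elems (at S c (suc u))) x >>= λ y →
    aug u (S ⊖ y ⊕ x) (upd c y (suc (suc u))) par (par y)

  settle : Cfg n → Pr n → Maybe (Fin n) → Q n (Cfg n)
  settle (cfg u S c par) kp (just x) =
    aug u S (bumpX (suc u) S kp c) par x >>= λ r → ret (cfg 0 (proj₁ r) (proj₂ r) par)
  settle (cfg u S c par) kp nothing =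
    discover (suc u) S (bumpX (suc u) S kp c) kp par >>= λ r →
    ret (cfg (suc u) S (bumpY (suc u) S (proj₁ r) (bumpX (suc u) S kp c)) (proj₂ r))

  after : Cfg n → Pr n → Q n (Cfg n)
  after g kp = findSink (Cfg.S g) (elems kp) >>= settle g kp

-- Tracing a path back.

module MachineL {n : ℕ} (MA MB : Mat n) where
  open Two MA MB

  -- The state while a path is traced back: x can enter S for M₂, and every level from suc u on is
  -- one element short until the last element of the path enters.
  record PI (ℓ u : ℕ) (S : Pr n) (c : Lab n) (par : Fin n → Fin n) (x : Fin n) : Set where
    field
      iA   : A.Ind S
      iB   : B.Ind S
      u≤ℓ  : u ≤ ℓ
      x∉   : x ∉ S
      cx   : c x ≡ suc u
      iBx  : B.Ind (S ⊕ x)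
      c≥1  : ∀ v → 1 ≤ c v
      n1   : N1 S c
      cap  : ∀ v → v ∈ S → c v ≤ suc ℓ
      dom  : ∀ s → 1 ≤ s → s ≤ ℓ → ∀ T → B.Ind T → (∀ v → v ∈ T → c v ≤ s) → # T ≤ # (leq S c s) + b2n (suc u ≤ᵇ s)
      t1   : ∀ z → z ∉ S → c z ≤ suc u → A.Ind (geq S c (c z) ⊕ z)
      t2   : ∀ y → y ∈ S → c y ≤ u → par y ∉ S × c (par y) ≡ c y × B.Ind (S ⊖ y ⊕ par y)

  -- `ℓ` is the highest level with known dominance, possibly from an earlier search, and `lev` the
  -- progress of the current one. `t1` and `t2` concern the completed levels: outside elements left
  -- there are reachable through M₁, and elements of `S` have a valid parent.
  record MI (ℓ : ℕ) (g : Cfg n) : Set where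
    open Cfg g
    field
      iA   : A.Ind S
      iB   : B.Ind S
      c≥1  : ∀ v → 1 ≤ c v
      n1   : N1 S c
      cap  : ∀ v → v ∈ S → c v ≤ suc ℓ
      dom  : ∀ s → 1 ≤ s → s ≤ ℓ → Dom S c 0 s
      u≤ℓ  : lev ≤ ℓ
      t1   : ∀ z → z ∉ S → c z ≤ lev → A.Ind (geq S c (c z) ⊕ z)
      t2   : ∀ y → y ∈ S → c y ≤ lev → par y ∉ S × c (par y) ≡ c y × B.Ind (S ⊖ y ⊕ par y)

  dom-dep : ∀ {S c s x} → (∀ T → B.Ind T → (∀ v → v ∈ T → c v ≤ s) → # T ≤ # (leq S c s)) → x ∉ S → c x ≤ s →
            B.Dep (leq S c s ⊕ x)
  dom-dep {S} {c} {s} {x} h x∉ le = ¬true⇒false λ i → 1+n≰n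
    (subst (_≤ # (leq S c s)) (#-⊕ (leq S c s) (leq-∉ S c x∉))
      (h (leq S c s ⊕ x) i (λ v e → case ⊕-cases (leq S c s) e of λ { (inj₁ q) → leq-≤ S c q ; (inj₂ refl) → le })))

  module AugStep {ℓ u S c par x y} (I : PI ℓ (suc u) S c par x)
                 (y∈ : y ∈ S) (cy : c y ≡ suc u) (iA′ : A.Ind (S ⊖ y ⊕ x)) where
    open PI I
    dx : A.Dep (geq S c (suc u) ⊕ x)
    dx = n1 x x∉ (suc u) (s≤s z≤n) (≤-reflexive (sym cx))
    open PushL MA S c x y (suc u) iA x∉ y∈ cy cx dx
    c′ = upd c y (suc (suc u))
    x′ = par y
    same : ∀ v → v ≢ y → c′ v ≡ c v
    same v = upd-there c (suc (suc u))
    c≤ : ∀ v → c v ≤ c′ v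
    c≤ v with bool (v == y)
    ... | inj₂ q = ≤-reflexive (sym (same v (==-false⁻ q)))
    ... | inj₁ q with refl ← ==-true q = subst₂ _≤_ (sym cy) (sym (upd-here c v (suc (suc u)))) (n≤1+n _)
    low-dep : ∀ {s z} → 1 ≤ s → s ≤ suc u → z ∉ S → c z ≤ s → B.Dep (leq S c s ⊕ z)
    low-dep {s} 1≤s s≤ z∉ le = dom-dep (λ T iT T≤ → ≤-trans (dom s 1≤s (≤-trans s≤ u≤ℓ) T iT T≤)
      (≤-reflexive (trans (cong (λ b → # (leq S c s) + b2n b) (≤ᵇ-f (s≤s s≤))) (+-identityʳ _)))) z∉ le
    no-sink : ∀ {z} → z ∉ S → c z ≤ suc u → B.Dep (S ⊕ z)
    no-sink {z} z∉ le = B.up (⊕-mono {P = leq S c (c z)} {S} (λ v → leq-S S c)) (low-dep (c≥1 z) le z∉ ≤-refl)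
    tt2 = t2 y y∈ (≤-reflexive cy)
    x′∉ : x′ ∉ S
    x′∉ = proj₁ tt2
    cx′ : c x′ ≡ suc u
    cx′ = trans (proj₁ (proj₂ tt2)) cy
    lvl≢x : ∀ {z} → c z ≤ suc u → z ≢ x
    lvl≢x le refl = 1+n≰n (subst (_≤ suc u) cx le)
    y∉S′ : y ∉ S′
    y∉S′ = ⊕-∉ (S ⊖ y) (⊖-here S y) (∈≢∉ {P = S} y∈ x∉)
    S′≢y : ∀ v → v ∈ S′ → v ≢ y
    S′≢y v e = ∈≢∉ {P = S′} e y∉S′
    to′ : ∀ {s} → geq S′ c s ⊆ geq S′ c′ s
    to′ {s} = geq-mono {S = S′} {c = c} (λ v p q → p , ≤-trans q (c≤ v))
    from′ : ∀ {s} → geq S′ c′ s ⊆ geq S′ c s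
    from′ {s} = geq-mono {S = S′} {c = c′} (λ v p q → p , subst (s ≤_) (same v (S′≢y v p)) q)
    ind-to : ∀ s z → A.Ind (geq S′ c s ⊕ z) → A.Ind (geq S′ c′ s ⊕ z)
    ind-to s z = A.down (⊕-mono {P = geq S′ c′ s} {geq S′ c s} from′)
    dep-to : ∀ s z → A.Dep (geq S′ c s ⊕ z) → A.Dep (geq S′ c′ s ⊕ z)
    dep-to s z = A.up (⊕-mono {P = geq S′ c s} {geq S′ c′ s} to′)
    n1′ : N1 S′ c′
    n1′ z z∉ s 1≤s s< with swap-∉ S z∉
    ... | inj₁ z∉S , ne = dep-to s z (spn-keep s z z∉S ne (n1 z z∉S s 1≤s (subst (s <_) (same z (λ { refl → absurd y∈ z∉S })) s<)))
    ... | inj₂ refl , ne = dep-to s z (A.up (⊕-mono {P = geq S′ c (suc u)} {geq S′ c s}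
            (geq-mono {S = S′} {c = c} (λ w a b → a , ≤-trans (≤-pred (subst (s <_) (upd-here c z (suc (suc u))) s<)) b))) spn-y)
    next : PI ℓ u S′ c′ par x′
    next = record
      { iA = iA′
      ; iB = B.down (⊕-⊆ {P = S ⊖ y} (λ v e → ⊕-there S (⊖-∈ S {y} e)) (⊕-here S x)) iBx
      ; u≤ℓ = ≤-trans (n≤1+n u) u≤ℓ
      ; x∉ = ⊕-∉ (S ⊖ y) (∧-f-l x′∉) (lvl≢x (≤-reflexive cx′))
      ; cx = trans (same x′ (λ e → absurd y∈ (subst (_∉ S) e x′∉))) cx′
      -- The parent of `y` is the next sink: by `sink-add` it is accepted in exchange for `y` even
      -- after `x` has entered.
      ; iBx = B.down (⊕-⊆ {P = S′} (⊕-⊆ {P = S ⊖ y}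
                (λ v e → ⊕-there (S ⊖ y ⊕ x′) (⊕-there (S ⊖ y) e)) (⊕-here (S ⊖ y ⊕ x′) x))
                (⊕-there (S ⊖ y ⊕ x′) (⊕-here (S ⊖ y) x′)))
                (sink-add MB iBx x∉ y∈ x′∉ (no-sink x′∉ (≤-reflexive cx′)) (proj₂ (proj₂ tt2)))
      ; c≥1 = λ v → ≤-trans (c≥1 v) (c≤ v)
      ; n1 = n1′
      ; cap = λ v e → case swap-cases S e of λ
          { (inj₁ (p , q)) → subst (_≤ suc ℓ) (sym (same v q)) (cap v p)
          ; (inj₂ refl) → subst (_≤ suc ℓ) (sym (trans (same v (S′≢y v e)) cx)) (s≤s u≤ℓ) }
      ; dom = λ s 1≤s s≤ℓ T iT T≤ → ≤-trans (dom s 1≤s s≤ℓ T iT (λ v e → ≤-trans (c≤ v) (T≤ v e))) (bal s)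
      ; t1 = t1′
      ; t2 = t2′ }
      where
      leq′-in : ∀ {s v} → v ∈ S′ → c v ≤ s → v ∈ leq S′ c′ s
      leq′-in {s} {v} p q = leq-in S′ c′ p (subst (_≤ s) (sym (same v (S′≢y v p))) q)
      -- At thresholds above `suc u` the swap keeps the count. At `suc u` the loss of `y` is covered
      -- by the shortage of one that is allowed from there on. Below, nothing changes.
      bal : ∀ s → # (leq S c s) + b2n (suc (suc u) ≤ᵇ s) ≤ # (leq S′ c′ s) + b2n (suc u ≤ᵇ s)
      bal s with suc (suc u) ≤? s
      ... | yes p rewrite ≤ᵇ-t p | ≤ᵇ-t (≤-trans (n≤1+n (suc u)) p) = +-monoˡ-≤ 1
              (subst (_≤ # (leq S′ c′ s)) (#-swap (leq S c s) (leq-in S c y∈ (≤-trans (≤-reflexive cy) (≤-trans (n≤1+n _) p))) (leq-∉ S c x∉))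
                (#-mono {P = leq S c s ⊖ y ⊕ x} (⊕-⊆ {P = leq S c s ⊖ y}
                  (λ v e → leq′-in (swap-in S (leq-S S c (⊖-∈ (leq S c s) {y} e)) (⊖-≢ (leq S c s) e)) (leq-≤ S c (⊖-∈ (leq S c s) {y} e)))
                  (leq′-in (swap-x S) (≤-trans (≤-reflexive cx) p)))))
      ... | no p with suc u ≤? s
      ... | yes q rewrite ≤ᵇ-f (≰⇒> p) | ≤ᵇ-t q =
              subst₂ _≤_ (sym (+-identityʳ _)) (cong (# (leq S′ c′ s) +_) (#-sing y))
                (#-∪ {P = leq S′ c′ s} {λ v → v == y} (λ v e → case bool (v == y) of λ
                  { (inj₁ r) → inj₂ r ; (inj₂ r) → inj₁ (leq′-in (swap-in S (leq-S S c e) (==-false⁻ r)) (leq-≤ S c e)) }))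
      ... | no q rewrite ≤ᵇ-f (≰⇒> p) | ≤ᵇ-f (≰⇒> q) = +-monoˡ-≤ 0 (#-mono {P = leq S c s}
              (λ v e → leq′-in (swap-in S (leq-S S c e) (λ { refl → q (subst (_≤ s) cy (leq-≤ S c e)) })) (leq-≤ S c e)))
      out : ∀ {z} → z ∉ S′ → c′ z ≤ suc u → z ∉ S × z ≢ y
      out {z} z∉ le with swap-∉ S z∉
      ... | inj₁ p , _ = p , λ { refl → absurd y∈ p }
      ... | inj₂ refl , _ = ⊥-elim (1+n≰n (subst (_≤ suc u) (upd-here c z (suc (suc u))) le))
      t1′ : ∀ z → z ∉ S′ → c′ z ≤ suc u → A.Ind (geq S′ c′ (c′ z) ⊕ z)
      t1′ z z∉ le with out z∉ le
      ... | z∉S , ne = subst (λ s → A.Ind (geq S′ c′ s ⊕ z)) (sym (same z ne))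
              (ind-to (c z) z (tight-keep iA′ (c z) z le′ z∉S (t1 z z∉S (≤-trans le′ (n≤1+n _)))))
        where
        le′ : c z ≤ suc u
        le′ = subst (_≤ suc u) (same z ne) le
      t2′ : ∀ w → w ∈ S′ → c′ w ≤ u → par w ∉ S′ × c′ (par w) ≡ c′ w × B.Ind (S′ ⊖ w ⊕ par w)
      t2′ w w∈ le with swap-cases S w∈
      ... | inj₂ refl = ⊥-elim (1+n≰n (≤-trans (≤-reflexive (sym (trans (same w (S′≢y w w∈)) cx))) (≤-trans le (n≤1+n u))))
      ... | inj₁ (w∈S , w≢) with t2 w w∈S (≤-trans (subst (_≤ u) (same w w≢) le) (n≤1+n u))
      ... | z∉ , cz , iz = ⊕-∉ (S ⊖ y) (∧-f-l z∉) (lvl≢x zle) , trans (same z z≢y) (trans cz (sym (same w w≢)))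
            , B.down (⊕-⊆ {P = S′ ⊖ w} sub (⊕-there (S ⊖ w ⊕ z) (⊕-here (S ⊖ w) z)))
                (sink-add MB iBx x∉ w∈S z∉ (no-sink z∉ zle) iz)
        where
        z = par w
        zle : c z ≤ suc u
        zle = ≤-trans (≤-reflexive cz) (≤-trans (subst (_≤ u) (same w w≢) le) (n≤1+n u))
        z≢y : z ≢ y
        z≢y e = absurd y∈ (subst (_∉ S) e z∉)
        sub : S′ ⊖ w ⊆ S ⊖ w ⊕ z ⊕ x
        sub v e with swap-cases S (⊖-∈ S′ {w} e)
        ... | inj₁ (p , _) = ⊕-there (S ⊖ w ⊕ z) (⊕-there (S ⊖ w) (⊖-in S p (⊖-≢ S′ e)))
        ... | inj₂ refl = ⊕-here (S ⊖ w ⊕ z) v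

  AugPost : ℕ → ℕ → Pr n → Lab n → (Fin n → Fin n) → Pr n × Lab n → ℕ → Set
  AugPost ℓ u S c par (S′ , c′) k = MI ℓ (cfg 0 S′ c′ par) × # S′ ≡ suc (# S) × (∀ v → c v ≤ c′ v) × k ≤ u * L

  aug-spec : ∀ {ℓ} u {S c par x} → PI ℓ u S c par x → wp (aug u S c par x) (AugPost ℓ u S c par)
  aug-spec {ℓ} zero {S} {c} {par} {x} I = record
      { iA = A.down (⊕-mono {P = S} {geq S c 1} (λ v e → geq-in S c e (c≥1 v)))
               (subst (λ s → A.Ind (geq S c s ⊕ x)) cx (t1 x x∉ (≤-reflexive cx)))
      ; iB = iBx ; c≥1 = c≥1
      ; n1 = λ z z∉ s p q → A.up (⊕-mono {P = geq S c s} {geq (S ⊕ x) c s} (geq-mono {S = S} {c = c} (λ v a b → ⊕-there S a , b)))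
                              (n1 z (∨-fl z∉) s p q)
      ; cap = λ v e → case ⊕-cases S e of λ { (inj₁ p) → cap v p ; (inj₂ refl) → ≤-trans (≤-reflexive cx) (s≤s z≤n) }
      ; dom = λ s 1≤s s≤ℓ T iT T≤ → ≤-trans (dom s 1≤s s≤ℓ T iT T≤) (bal s 1≤s)
      ; u≤ℓ = z≤n
      ; t1 = λ z _ le → ⊥-elim (<⇒≱ (c≥1 z) le)
      ; t2 = λ z _ le → ⊥-elim (<⇒≱ (c≥1 z) le) }
    , #-⊕ S x∉ , (λ v → ≤-refl) , z≤n
    where
    open PI I
    -- The last element has label 1, so its entry repairs the shortage at every threshold at once.
    bal : ∀ s → 1 ≤ s → # (leq S c s) + b2n (1 ≤ᵇ s) ≤ # (leq (S ⊕ x) c s) + 0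
    bal s 1≤s = subst₂ _≤_ (trans (#-⊕ (leq S c s) (leq-∉ S c x∉)) (trans (+-comm 1 _) (cong (λ b → # (leq S c s) + b2n b) (sym (≤ᵇ-t 1≤s)))))
        (sym (+-identityʳ _))
      (#-mono {P = leq S c s ⊕ x} (⊕-⊆ {P = leq S c s} (λ v e → leq-in (S ⊕ x) c (⊕-there S (leq-S S c e)) (leq-≤ S c e))
        (leq-in (S ⊕ x) c (⊕-here S x) (≤-trans (≤-reflexive cx) 1≤s))))
  aug-spec {ℓ} (suc u) {S} {c} {par} {x} I =
    wp->>= (bisect M₁ L (geq S c (suc (suc u)) ⊕ x) (elems (at S c (suc u))) x)
      (λ y → aug u (S ⊖ y ⊕ x) (upd c y (suc (suc u))) par (par y)) (AugPost ℓ (suc u) S c par)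
      (main (kick-spec (suc u) x iA x∉ (subst (λ s → A.Ind (geq S c s ⊕ x)) cx (t1 x x∉ (≤-reflexive cx)))
        (n1 x x∉ (suc u) (s≤s z≤n) (≤-reflexive (sym cx)))))
    where
    open PI I
    main : ∀ {y k} → (y ∈ S × c y ≡ suc u × A.Ind (S ⊖ y ⊕ x)) × k ≤ L →
           wp (aug u (S ⊖ y ⊕ x) (upd c y (suc (suc u))) par (par y)) (λ r k′ → AugPost ℓ (suc u) S c par r (k + k′))
    main {y} ((y∈ , cy , iA′) , le) with aug-spec u (AugStep.next I y∈ cy iA′)
    ... | mi , e , h , le′ = mi , trans e (cong suc (#-swap S y∈ x∉))
          , (λ v → ≤-trans (AugStep.c≤ I y∈ cy iA′ v) (h v)) , +-mono-≤ le le′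

full : ∀ {n} → Pr n
full _ = true

above : ∀ {n} → Lab n → ℕ → ℕ
above c t = # (geq full c t)

-- Following the edges of M₂ within a level.

module DiscoverL {n : ℕ} (MA MB : Mat n) (t : ℕ) (S : Pr n) (c : Lab n) (kp : Pr n) (par₀ : Fin n → Fin n)
                 (iB : Mat.ind MB S ≡ true) (kp∉ : ∀ x → x ∈ kp → x ∉ S)
                 (dep : ∀ x → x ∈ kp → Mat.ind MB (leq S c t ⊕ x) ≡ false) where
  open Two MA MB

  record DI (st : Pr n × (Fin n → Fin n)) : Set where
    fd : Pr n
    fd = proj₁ st
    par : Fin n → Fin n
    par = proj₂ st
    field
      fd⊆  : fd ⊆ at S c t
      link : ∀ y → y ∈ fd → par y ∈ kp × B.Ind (S ⊖ y ⊕ par y)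
      old  : ∀ y → y ∉ fd → par y ≡ par₀ y

  spans : Pr n → Fin n → Set
  spans fd x = B.Dep ((ltq S c t ∪ fd) ⊕ x)

  low-cover : ∀ (fd Z : Pr n) → (∀ v → v ∈ at S c t → (v ∈ fd) ⊎ (v ∈ Z)) →
              ∀ v → v ∈ leq S c t → (v ∈ ltq S c t ∪ fd) ⊎ (v ∈ Z)
  low-cover fd Z h v e with m≤n⇒m<n∨m≡n (leq-≤ S c e)
  ... | inj₁ p = inj₁ (∨-l (ltq-in S c (leq-S S c e) p))
  ... | inj₂ p with h v (at-in S c (leq-S S c e) p)
  ... | inj₁ q = inj₁ (∨-r {ltq S c t v} q)
  ... | inj₂ q = inj₂ q

  GPost : Fin n → Pr n × (Fin n → Fin n) → Pr n × (Fin n → Fin n) → ℕ → Set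
  GPost x st st′ k = DI st′ × proj₁ st ⊆ proj₁ st′ × spans (proj₁ st′) x
    × k + (1 + L) * # (proj₁ st) ≤ 1 + (1 + L) * # (proj₁ st′)

  grab-spec : ∀ f x st → x ∈ kp → DI st → # (at S c t) ≤ # (proj₁ st) + f →
              wp (grab t S c f x st) (GPost x st)
  -- The fuel can run out only after the whole level has been found, and then `dep` says that `x` is
  -- spanned.
  grab-spec zero x st@(fd , par) x∈ di le = di , (λ _ e → e) , B.up (⊕-mono {P = leq S c t} {ltq S c t ∪ fd} sub) (dep x x∈) , n≤1+n _
    where
    sub : leq S c t ⊆ ltq S c t ∪ fd
    sub v e with low-cover fd ∅ (λ w a → inj₁ (#-full (DI.fd⊆ di) (subst (# (at S c t) ≤_) (+-identityʳ _) le) w a)) v e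
    ... | inj₁ q = q
  grab-spec (suc f) x st@(fd , par) x∈ di le with B.ind ((ltq S c t ∪ fd) ⊕ x) in e
  ... | false = di , (λ _ e → e) , e , ≤-refl
  ... | true = wp->>= (bisect M₂ L BB (elems U) x) (λ y → grab t S c f x (fd ⊕ y , upd par y x))
                 (λ st′ k → GPost x st st′ (suc k)) (main bs)
    where
    BB = (ltq S c t ∪ fd) ⊕ x
    U = unfound t S c fd
    allU : leq S c t ⊕ x ⊆ addL BB (elems U)
    allU = ⊕-⊆ {P = leq S c t} lem (addL-⊇ (elems U) x (⊕-here (ltq S c t ∪ fd) x))
      where
      h : ∀ v → v ∈ at S c t → (v ∈ fd) ⊎ (v ∈ U)
      h v a with bool (fd v)
      ... | inj₁ p = inj₁ p
      ... | inj₂ p = inj₂ (∧-intro a (not-f p))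
      lem : leq S c t ⊆ addL BB (elems U)
      lem v a with low-cover fd U h v a
      ... | inj₁ p = addL-⊇ (elems U) v (⊕-there (ltq S c t ∪ fd) p)
      ... | inj₂ p = addL-∈ (elems U) (∈-elems U p)
    bs = SB.bisect-spec L BB (elems U) x (len-elems U) e (B.up allU (dep x x∈))
    main : ∀ {y k} → SB.Splits BB (elems U) y × k ≤ L →
           wp (grab t S c f x (fd ⊕ y , upd par y x)) (λ st′ k′ → GPost x st st′ (suc (k + k′)))
    main {y} {k} ((y∈ , A′ , BA , AZ , a , ad) , k≤)
      with grab-spec f x (fd ⊕ y , upd par y x) x∈ di′ le′
      where
      yU : y ∈ U
      yU = elems-∈ U y∈
      y∉ : y ∉ fd
      y∉ = not-t (∧-r {at S c t y} yU)
      yat : y ∈ at S c t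
      yat = ∧-l yU
      y∉′ : y ∈ S
      y∉′ = at-S S c yat
      A⊆ : ∀ v → v ∈ A′ → v ∈ S ⊕ x
      A⊆ v q with AZ v q
      ... | inj₂ r = ⊕-there S (at-S S c (∧-l (elems-∈ U r)))
      ... | inj₁ r = ⊕-mono {P = ltq S c t ∪ fd} {S} (λ w s → case ∨-cases {ltq S c t w} s of λ
              { (inj₁ z) → ltq-S S c z ; (inj₂ z) → at-S S c (DI.fd⊆ di w z) }) v r
      di′ : DI (fd ⊕ y , upd par y x)
      di′ = record
        { fd⊆ = ⊕-⊆ {P = fd} (DI.fd⊆ di) yat
        ; link = lnk
        ; old = λ w q → trans (upd-there par x (λ { refl → absurd (⊕-here fd w) q })) (DI.old di w (∨-fl q)) }
        where
        lnk : ∀ w → w ∈ fd ⊕ y → upd par y x w ∈ kp × B.Ind (S ⊖ w ⊕ upd par y x w)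
        lnk w q with bool (w == y)
        ... | inj₁ r with refl ← ==-true r = subst (λ z → z ∈ kp × B.Ind (S ⊖ w ⊕ z)) (sym (upd-here par w x))
                (x∈ , B.pivot iB a A⊆ y∉′ (BA x (⊕-here (ltq S c t ∪ fd) x)) (kp∉ x x∈) ad)
        ... | inj₂ r = subst (λ z → z ∈ kp × B.Ind (S ⊖ w ⊕ z)) (sym (upd-there par x (==-false⁻ r)))
                (DI.link di w (case ⊕-cases fd q of λ { (inj₁ s) → s ; (inj₂ s) → ⊥-elim (==-false⁻ r s) }))
      le′ : # (at S c t) ≤ # (fd ⊕ y) + f
      le′ = ≤-trans le (≤-reflexive (trans (+-suc (# fd) f) (cong (_+ f) (sym (#-⊕ fd y∉)))))
    ... | di″ , sub , sp , ct = di″ , (λ v q → sub v (⊕-there fd q)) , sp , (begin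
            suc (k + k′) + (1 + L) * # fd        ≤⟨ +-monoˡ-≤ _ (s≤s (+-monoˡ-≤ k′ k≤)) ⟩
            suc (L + k′) + (1 + L) * # fd        ≡⟨ eq L k′ (# fd) ⟩
            k′ + (1 + L) * suc (# fd)            ≡⟨ cong (λ z → k′ + (1 + L) * z) (sym (#-⊕ fd (not-t (∧-r {at S c t y} (elems-∈ U y∈))))) ⟩
            k′ + (1 + L) * # (fd ⊕ y)            ≤⟨ ct ⟩
            1 + (1 + L) * # (proj₁ (val (grab t S c f x (fd ⊕ y , upd par y x)))) ∎)
      where
      open ≤-Reasoning
      k′ = cost (grab t S c f x (fd ⊕ y , upd par y x))
      eq : ∀ l k a → suc (l + k) + (1 + l) * a ≡ k + (1 + l) * suc a
      eq = solve-∀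

  discover-spec : wp (discover t S c kp par₀) (λ st k → DI st × (∀ x → x ∈ kp → spans (proj₁ st) x) × k ≤ # kp + (1 + L) * # (proj₁ st))
  discover-spec =
    let (i , sp , _ , ct) = wp-fold (grab t S c n) P step (elems kp) (∅ , par₀) 0
          ( record { fd⊆ = λ _ () ; link = λ _ () ; old = λ _ _ → refl }
          , (λ x x∈ → inj₁ (∈-elems kp x∈))
          , (λ x → elems-∈ kp)
          , ≤-trans (≤-reflexive (length-elems≡# kp)) (m≤m+n _ _))
    in i , (λ x x∈ → case sp x x∈ of λ { (inj₂ q) → q }) , ≤-trans (≤-reflexive (sym (+-identityʳ _))) ct
    where
    P : List (Fin n) → Pr n × (Fin n → Fin n) → ℕ → Set
    P xs st k = DI st × (∀ x → x ∈ kp → (x ∈L xs) ⊎ spans (proj₁ st) x) × (∀ x → x ∈L xs → x ∈ kp)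
      × k + length xs ≤ # kp + (1 + L) * # (proj₁ st)
    step : ∀ x xs st k → P (x ∷ xs) st k → wp (grab t S c n x st) (λ st′ k′ → P xs st′ (k + k′))
    step x xs st k (di , sp , xs⊆ , ct)
      with grab-spec n x st (xs⊆ x (here refl)) di (≤-trans (#≤n (at S c t)) (m≤n+m n _))
    ... | di′ , sub , s , ct′ = di′ , sp′ , (λ y q → xs⊆ y (there q)) ,
          +-cancelʳ-≤ (1 + (1 + L) * a) _ _ (subst₂ _≤_ (eq k k′ (length xs) ((1 + L) * a)) (eq₂ (# kp) ((1 + L) * a) ((1 + L) * a′)) (+-mono-≤ ct ct′))
      where
      st′ = val (grab t S c n x st)
      k′ = cost (grab t S c n x st)
      a = # (proj₁ st)
      a′ = # (proj₁ st′)
      eq : ∀ k k′ l a → k + suc l + (k′ + a) ≡ k + k′ + l + (1 + a)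
      eq = solve-∀
      eq₂ : ∀ p a b → p + a + (1 + b) ≡ p + b + (1 + a)
      eq₂ = solve-∀
      sp′ : ∀ y → y ∈ kp → (y ∈L xs) ⊎ spans (proj₁ st′) y
      sp′ y y∈ with sp y y∈
      ... | inj₁ (here refl) = inj₂ s
      ... | inj₁ (there q) = inj₁ q
      ... | inj₂ q = inj₂ (B.up (⊕-mono {P = ltq S c t ∪ proj₁ st} {ltq S c t ∪ proj₁ st′} (λ w e →
              case ∨-cases {ltq S c t w} e of λ { (inj₁ z) → ∨-l z ; (inj₂ z) → ∨-r {ltq S c t w} (sub w z) })) q)

-- One level of the search.

module StageL {n : ℕ} (MA MB : Mat n) where
  open Two MA MB
  open MachineL MA MB

  -- A vector and not a predicate, so that the answers of different expansions are equal in the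
  -- sense of `_≡_`.
  spec : Cfg n → Subset n
  spec (cfg u S c par) = tabulate (λ v → not (S v) ∧ (c v ≡ᵇ suc u) ∧ A.ind (geq S c (suc u) ⊕ v))

  next : Cfg n → Cfg n
  next g = val (after g (lookup (spec g)))

  record StepRel (g : Cfg n) (c′ : Lab n) : Set where
    open Cfg g
    field
      outer : ∀ x → x ∉ S → c′ x ≡ bumpX (suc lev) S (lookup (spec g)) c x
      inner : ∀ y → y ∈ S → (c′ y ≡ c y) ⊎ (c y ≡ suc lev × c′ y ≡ suc (suc lev))

  findSink-spec : ∀ S vs → wp (findSink S vs) (λ
    { (just x) k → (x ∈L vs × B.Ind (S ⊕ x)) × k ≤ length vs
    ; nothing  k → (∀ x → x ∈L vs → B.Dep (S ⊕ x)) × k ≤ length vs })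
  findSink-spec S [] = (λ x ()) , z≤n
  findSink-spec S (v ∷ vs) with B.ind (S ⊕ v) in e
  ... | true = (here refl , e) , s≤s z≤n
  ... | false with val (findSink S vs) | findSink-spec S vs
  ... | just x | (x∈ , i) , le = (there x∈ , i) , s≤s le
  ... | nothing | h , le = (λ { x (here refl) → e ; x (there q) → h x q }) , s≤s le

  -- Elements that keep the label just completed leave the count `above` and pay for the move, once
  -- per search. An augmentation is charged to the growth of `S` instead.
  data AfterPost (ℓ : ℕ) (g : Cfg n) : Cfg n → ℕ → Set where
    moved : ∀ {c′ par′ k} → let open Cfg g in
            StepRel g c′ → MI (ℓ ⊔ suc lev) (cfg (suc lev) S c′ par′) →
            k + (2 + L) * above c′ (suc (suc lev)) ≤ (2 + L) * above c (suc lev) →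
            AfterPost ℓ g (cfg (suc lev) S c′ par′) k
    augmented : ∀ {S′ c′ par′ k} → let open Cfg g in
            MI ℓ (cfg 0 S′ c′ par′) → # S′ ≡ suc (# S) → (∀ v → c v ≤ c′ v) → k ≤ n + lev * L →
            AfterPost ℓ g (cfg 0 S′ c′ par′) k

  module _ {ℓ : ℕ} {g : Cfg n} (M : MI ℓ g) where
    open MI M
    open Cfg g renaming (lev to u)
    t : ℕ
    t = suc u
    kp : Pr n
    kp = lookup (spec g)
    c₁ : Lab n
    c₁ = bumpX t S kp c

    private
      kp≡ : ∀ x → kp x ≡ not (S x) ∧ (c x ≡ᵇ t) ∧ A.ind (geq S c t ⊕ x)
      kp≡ x = lookup∘tabulate _ x
      kp∉ : ∀ x → x ∈ kp → x ∉ S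
      kp∉ x e = not-t (∧-l (trans (sym (kp≡ x)) e))
      kpc : ∀ x → x ∈ kp → c x ≡ t
      kpc x e = ≡ᵇ-t⁻ (∧-l (∧-r {not (S x)} (trans (sym (kp≡ x)) e)))
      kpi : ∀ x → x ∈ kp → A.Ind (geq S c t ⊕ x)
      kpi x e = ∧-r {c x ≡ᵇ t} (∧-r {not (S x)} (trans (sym (kp≡ x)) e))
      kpn : ∀ x → x ∉ S → c x ≡ t → x ∉ kp → A.Dep (geq S c t ⊕ x)
      kpn x p q e = ¬true⇒false λ i → absurd (trans (kp≡ x) (∧-intro (not-f p) (∧-intro (≡ᵇ-t q) i))) e

      data C₁ (v : Fin n) : Set where
        kept   : c₁ v ≡ c v → (v ∉ S → c v ≡ t → v ∈ kp) → C₁ v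
        bumped : c₁ v ≡ suc t → v ∉ S → c v ≡ t → v ∉ kp → C₁ v

      c₁-view : ∀ v → C₁ v
      c₁-view v with not (S v) ∧ (c v ≡ᵇ t) ∧ not (kp v) in e
      ... | true = bumped (cong (λ b → if b then suc t else c v) e) (not-t (∧-l e)) (≡ᵇ-t⁻ (∧-l (∧-r {not (S v)} e)))
                     (not-t (∧-r {c v ≡ᵇ t} (∧-r {not (S v)} e)))
      ... | false = kept (cong (λ b → if b then suc t else c v) e) lem
        where
        lem : v ∉ S → c v ≡ t → v ∈ kp
        lem p q with bool (kp v)
        ... | inj₁ r = r
        ... | inj₂ r = absurd (∧-intro (not-f p) (∧-intro (≡ᵇ-t q) (not-f r))) e

      onS : ∀ v → v ∈ S → c₁ v ≡ c v
      onS v e with c₁-view v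
      ... | kept p _ = p
      ... | bumped _ q _ _ = absurd e q
      c≤c₁ : ∀ v → c v ≤ c₁ v
      c≤c₁ v with c₁-view v
      ... | kept p _ = ≤-reflexive (sym p)
      ... | bumped p _ q _ = subst₂ _≤_ (sym q) (sym p) (n≤1+n t)
      geq₁ : ∀ {s} → geq S c s ⊆ geq S c₁ s
      geq₁ {s} = geq-mono {S = S} {c = c} (λ v p q → p , ≤-trans q (c≤c₁ v))
      geq₁′ : ∀ {s} → geq S c₁ s ⊆ geq S c s
      geq₁′ {s} = geq-mono {S = S} {c = c₁} (λ v p q → p , subst (s ≤_) (onS v p) q)
      leq₁ : ∀ {s} → leq S c s ⊆ leq S c₁ s
      leq₁ {s} v e = leq-in S c₁ (leq-S S c e) (subst (_≤ s) (sym (onS v (leq-S S c e))) (leq-≤ S c e))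
      n1₁ : N1 S c₁
      n1₁ x x∉ s 1≤s s< with c₁-view x
      ... | kept p _ = A.up (⊕-mono {P = geq S c s} {geq S c₁ s} geq₁) (n1 x x∉ s 1≤s (subst (s <_) p s<))
      ... | bumped p _ q r = A.up (⊕-mono {P = geq S c t} {geq S c₁ s} (λ v e → geq₁ v
              (geq-in S c (geq-S S c e) (≤-trans (≤-pred (subst (s <_) p s<)) (geq-≤ S c e))))) (kpn x x∉ q r)
      t1₁ : ∀ z → z ∉ S → c₁ z ≤ t → A.Ind (geq S c₁ (c₁ z) ⊕ z)
      t1₁ z z∉ le with c₁-view z
      ... | bumped p _ _ _ = ⊥-elim (1+n≰n (subst (_≤ t) p le))
      ... | kept p h = subst (λ s → A.Ind (geq S c₁ s ⊕ z)) (sym p)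
              (A.down (⊕-mono {P = geq S c₁ (c z)} {geq S c (c z)} geq₁′) (lem (m≤n⇒m<n∨m≡n (subst (_≤ t) p le))))
        where
        lem : c z < t ⊎ c z ≡ t → A.Ind (geq S c (c z) ⊕ z)
        lem (inj₁ q) = t1 z z∉ (≤-pred q)
        lem (inj₂ q) = subst (λ s → A.Ind (geq S c s ⊕ z)) (sym q) (kpi z (h z∉ q))
      par₁ : ∀ y → y ∈ S → c₁ y ≤ u → par y ∉ S × c₁ (par y) ≡ c₁ y × B.Ind (S ⊖ y ⊕ par y)
      par₁ y y∈ le with t2 y y∈ (subst (_≤ u) (onS y y∈) le)
      ... | z∉ , cz , iz = z∉ , trans lem (trans cz (sym (onS y y∈))) , iz
        where
        lem : c₁ (par y) ≡ c (par y)
        lem with c₁-view (par y)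
        ... | kept p _ = p
        ... | bumped _ _ q _ = ⊥-elim (1+n≰n (subst (_≤ u) (trans (sym cz) q) (subst (_≤ u) (onS y y∈) le)))
      dom₁ : ∀ s → 1 ≤ s → s ≤ ℓ → ∀ T → B.Ind T → (∀ v → v ∈ T → c₁ v ≤ s) → # T ≤ # (leq S c₁ s)
      dom₁ s 1≤s s≤ T iT T≤ = ≤-trans (dom s 1≤s s≤ T iT (λ v e → ≤-trans (c≤c₁ v) (T≤ v e)))
        (≤-trans (≤-reflexive (+-identityʳ _)) (#-mono {P = leq S c s} leq₁))
      kp₁ : ∀ x → x ∈ kp → c₁ x ≡ t
      kp₁ x e with c₁-view x
      ... | kept p _ = trans p (kpc x e)
      ... | bumped _ _ _ q = absurd e q

    sink-case : ∀ x → x ∈ kp → B.Ind (S ⊕ x) →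
                wp (aug u S c₁ par x >>= λ r → ret (cfg 0 (proj₁ r) (proj₂ r) par))
                   (λ g′ k → ∀ k₀ → k₀ ≤ n → AfterPost ℓ g g′ (k₀ + k))
    sink-case x x∈ i = wp->>= (aug u S c₁ par x) (λ r → ret (cfg 0 (proj₁ r) (proj₂ r) par))
        (λ g′ k → ∀ k₀ → k₀ ≤ n → AfterPost ℓ g g′ (k₀ + k)) (main (aug-spec u pi))
      where
      u≡ℓ : ℓ ≤ u
      u≡ℓ = ≮⇒≥ λ lt → absurd i (B.up (⊕-mono {P = leq S c₁ t} {S} (λ v → leq-S S c₁))
              (dom-dep (dom₁ t (s≤s z≤n) lt) (kp∉ x x∈) (≤-reflexive (kp₁ x x∈))))
      pi : PI ℓ u S c₁ par x
      pi = record
        { iA = iA ; iB = iB ; u≤ℓ = u≤ℓ ; x∉ = kp∉ x x∈ ; cx = kp₁ x x∈ ; iBx = i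
        ; c≥1 = λ v → ≤-trans (c≥1 v) (c≤c₁ v) ; n1 = n1₁
        ; cap = λ v e → subst (_≤ suc ℓ) (sym (onS v e)) (cap v e)
        ; dom = λ s 1≤s s≤ T iT T≤ → ≤-trans (dom₁ s 1≤s s≤ T iT T≤) (m≤m+n _ _)
        ; t1 = t1₁ ; t2 = par₁ }
      main : ∀ {r k} → AugPost ℓ u S c₁ par r k → ∀ k₀ → k₀ ≤ n → AfterPost ℓ g (cfg 0 (proj₁ r) (proj₂ r) par) (k₀ + (k + 0))
      main {r} {k} (mi , e , h , le) k₀ k₀≤ = augmented mi e (λ v → ≤-trans (c≤c₁ v) (h v))
        (+-mono-≤ k₀≤ (≤-trans (≤-reflexive (+-identityʳ k)) le))

    move-case : (∀ x → x ∈ kp → B.Dep (S ⊕ x)) →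
                wp (discover t S c₁ kp par >>= λ r → ret (cfg t S (bumpY t S (proj₁ r) c₁) (proj₂ r)))
                   (λ g′ k → ∀ k₀ → k₀ ≤ # kp → AfterPost ℓ g g′ (k₀ + k))
    move-case nosink = wp->>= (discover t S c₁ kp par) (λ r → ret (cfg t S (bumpY t S (proj₁ r) c₁) (proj₂ r)))
        (λ g′ k → ∀ k₀ → k₀ ≤ # kp → AfterPost ℓ g g′ (k₀ + k)) (main discover-spec)
      where
      depx : ∀ x → x ∈ kp → B.Dep (leq S c₁ t ⊕ x)
      depx x x∈ with t ≤? ℓ
      ... | yes p = dom-dep (dom₁ t (s≤s z≤n) p) (kp∉ x x∈) (≤-reflexive (kp₁ x x∈))
      -- Beyond `ℓ` no dominance is known, but there `cap` places all of `S` within label `t`, and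
      -- the absence of a sink gives the dependency.
      ... | no p = B.up (⊕-mono {P = S} {leq S c₁ t} (λ v e → leq-in S c₁ e
              (subst (_≤ t) (sym (onS v e)) (≤-trans (cap v e) (≰⇒> p))))) (nosink x x∈)
      open DiscoverL MA MB t S c₁ kp par iB kp∉ depx
      main : ∀ {r k} → DI r × (∀ x → x ∈ kp → spans (proj₁ r) x) × k ≤ # kp + (1 + L) * # (proj₁ r) →
             ∀ k₀ → k₀ ≤ # kp → AfterPost ℓ g (cfg t S (bumpY t S (proj₁ r) c₁) (proj₂ r)) (k₀ + (k + 0))
      main {fd , par′} {k} (di , sp , ct) k₀ k₀≤ = moved rel mi costs
        where
        c₂ = bumpY t S fd c₁
        fd≡ : ∀ y → y ∈ fd → y ∈ S × c₁ y ≡ t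
        fd≡ y e = at-S S c₁ (DI.fd⊆ di y e) , at-≡ S c₁ (DI.fd⊆ di y e)
        data C₂ (v : Fin n) : Set where
          same₂ : c₂ v ≡ c₁ v → (v ∈ S → c₁ v ≡ t → v ∈ fd) → C₂ v
          up₂   : c₂ v ≡ suc t → v ∈ S → c₁ v ≡ t → v ∉ fd → C₂ v
        c₂-view : ∀ v → C₂ v
        c₂-view v with S v ∧ (c₁ v ≡ᵇ t) ∧ not (fd v) in e
        ... | true = up₂ (cong (λ b → if b then suc t else c₁ v) e) (∧-l e) (≡ᵇ-t⁻ (∧-l (∧-r {S v} e)))
                       (not-t (∧-r {c₁ v ≡ᵇ t} (∧-r {S v} e)))
        ... | false = same₂ (cong (λ b → if b then suc t else c₁ v) e) lem
          where
          lem : v ∈ S → c₁ v ≡ t → v ∈ fd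
          lem p q with bool (fd v)
          ... | inj₁ r = r
          ... | inj₂ r = absurd (∧-intro p (∧-intro (≡ᵇ-t q) (not-f r))) e
        out₂ : ∀ x → x ∉ S → c₂ x ≡ c₁ x
        out₂ x x∉ with c₂-view x
        ... | same₂ p _ = p
        ... | up₂ _ q _ _ = absurd q x∉
        c₁≤c₂ : ∀ v → c₁ v ≤ c₂ v
        c₁≤c₂ v with c₂-view v
        ... | same₂ p _ = ≤-reflexive (sym p)
        ... | up₂ p _ q _ = subst₂ _≤_ (sym q) (sym p) (n≤1+n t)
        fd₂ : ∀ y → y ∈ fd → c₂ y ≡ t
        fd₂ y e with c₂-view y
        ... | same₂ p _ = trans p (proj₂ (fd≡ y e))
        ... | up₂ _ _ _ q = absurd e q
        rel : StepRel g c₂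
        rel = record { outer = out₂ ; inner = inn }
          where
          inn : ∀ y → y ∈ S → (c₂ y ≡ c y) ⊎ (c y ≡ t × c₂ y ≡ suc t)
          inn y y∈ with c₂-view y
          ... | same₂ p _ = inj₁ (trans p (onS y y∈))
          ... | up₂ p _ q _ = inj₂ (trans (sym (onS y y∈)) q , p)
        n1₂ : N1 S c₂
        n1₂ x x∉ s 1≤s s< = A.up (⊕-mono {P = geq S c₁ s} {geq S c₂ s} (geq-mono {S = S} {c = c₁} (λ v p q → p , ≤-trans q (c₁≤c₂ v))))
          (n1₁ x x∉ s 1≤s (subst (s <_) (out₂ x x∉) s<))
        leq₂ : ∀ {s} → s ≢ t → leq S c₁ s ⊆ leq S c₂ s
        leq₂ {s} s≢ v e with c₂-view v
        ... | same₂ p _ = leq-in S c₂ (leq-S S c₁ e) (subst (_≤ s) (sym p) (leq-≤ S c₁ e))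
        ... | up₂ p q r _ = leq-in S c₂ q (subst (_≤ s) (sym p)
                (≤∧≢⇒< (subst (_≤ s) r (leq-≤ S c₁ e)) (λ t≡s → s≢ (sym t≡s))))
        -- Outside elements of label `t` that M₁ accepted are spanned by the elements found, the
        -- refused ones have left the level, and smaller labels are covered by the old dominance.
        dom-t : ∀ T → B.Ind T → (∀ v → v ∈ T → c₂ v ≤ t) → # T ≤ # (leq S c₂ t)
        dom-t T iT T≤ = B.span-bound (B.down (λ v → leq-S S c₂) iB) iT spn
          where
          spn : ∀ x → x ∈ T → x ∉ leq S c₂ t → B.Dep (leq S c₂ t ⊕ x)
          spn x e q with bool (S x)
          ... | inj₁ p = absurd (leq-in S c₂ p (T≤ x e)) q
          ... | inj₂ p with c₁-view x
          ...   | bumped r _ _ _ = ⊥-elim (1+n≰n (subst (_≤ t) (trans (out₂ x p) r) (T≤ x e)))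
          ...   | kept r h with m≤n⇒m<n∨m≡n (subst (_≤ t) (trans (out₂ x p) r) (T≤ x e))
          ...     | inj₂ cx = B.up (⊕-mono {P = ltq S c₁ t ∪ fd} {leq S c₂ t} sub) (sp x (h p cx))
            where
            sub : ltq S c₁ t ∪ fd ⊆ leq S c₂ t
            sub v a with ∨-cases {ltq S c₁ t v} a
            ... | inj₂ b = leq-in S c₂ (proj₁ (fd≡ v b)) (≤-reflexive (fd₂ v b))
            ... | inj₁ b with c₂-view v
            ... | same₂ y _ = leq-in S c₂ (ltq-S S c₁ b) (≤-trans (≤-reflexive y) (<⇒≤ (ltq-< S c₁ b)))
            ... | up₂ _ _ y _ = ⊥-elim (<-irrefl y (ltq-< S c₁ b))
          ...     | inj₁ cx = B.up (⊕-mono {P = leq S c (c x)} {leq S c₂ t} (λ v a →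
                      let b = leq₂ (<⇒≢ cx) v (leq₁ v a) in leq-in S c₂ (leq-S S c₂ b) (≤-trans (leq-≤ S c₂ b) (<⇒≤ cx))))
                      (dom-dep (λ T iT T≤ → ≤-trans (dom (c x) (c≥1 x) (≤-trans (≤-pred cx) u≤ℓ) T iT T≤) (≤-reflexive (+-identityʳ _))) p ≤-refl)
        mi : MI (ℓ ⊔ t) (cfg t S c₂ par′)
        mi = record
          { iA = iA ; iB = iB
          ; c≥1 = λ v → ≤-trans (c≥1 v) (≤-trans (c≤c₁ v) (c₁≤c₂ v))
          ; n1 = n1₂ ; cap = cap′ ; dom = dom′ ; u≤ℓ = m≤n⊔m ℓ t ; t1 = t1′ ; t2 = t2′ }
          where
          cap′ : ∀ v → v ∈ S → c₂ v ≤ suc (ℓ ⊔ t)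
          cap′ v e with c₂-view v
          ... | same₂ p _ = ≤-trans (≤-reflexive (trans p (onS v e))) (≤-trans (cap v e) (s≤s (m≤m⊔n ℓ t)))
          ... | up₂ p _ _ _ = ≤-trans (≤-reflexive p) (s≤s (m≤n⊔m ℓ t))
          dom′ : ∀ s → 1 ≤ s → s ≤ ℓ ⊔ t → Dom S c₂ 0 s
          dom′ s 1≤s s≤ T iT T≤ = ≤-trans (lem (s ≟ t)) (m≤m+n _ 0)
            where
            lem : Dec (s ≡ t) → # T ≤ # (leq S c₂ s)
            lem (yes refl) = dom-t T iT T≤
            lem (no ne) = ≤-trans (dom₁ s 1≤s s≤ℓ T iT (λ v e → ≤-trans (c₁≤c₂ v) (T≤ v e))) (#-mono {P = leq S c₁ s} (leq₂ ne))
              where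
              s≤ℓ : s ≤ ℓ
              s≤ℓ with ≤-total ℓ t
              ... | inj₂ q = subst (s ≤_) (m≥n⇒m⊔n≡m q) s≤
              ... | inj₁ q = ≤-trans (≤-pred (≤∧≢⇒< (subst (s ≤_) (m≤n⇒m⊔n≡n q) s≤) ne)) u≤ℓ
          t1′ : ∀ z → z ∉ S → c₂ z ≤ t → A.Ind (geq S c₂ (c₂ z) ⊕ z)
          t1′ z z∉ le = subst (λ s → A.Ind (geq S c₂ s ⊕ z)) (sym (out₂ z z∉))
            (A.down (⊕-mono {P = geq S c₂ (c₁ z)} {geq S c₁ (c₁ z)} (geq-mono {S = S} {c = c₂} sub)) (t1₁ z z∉ le′))
            where
            le′ : c₁ z ≤ t
            le′ = subst (_≤ t) (out₂ z z∉) le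
            sub : ∀ v → v ∈ S → c₁ z ≤ c₂ v → v ∈ S × c₁ z ≤ c₁ v
            sub v p q with c₂-view v
            ... | same₂ r _ = p , subst (c₁ z ≤_) r q
            ... | up₂ _ _ r _ = p , ≤-trans le′ (≤-reflexive (sym r))
          t2′ : ∀ y → y ∈ S → c₂ y ≤ t → par′ y ∉ S × c₂ (par′ y) ≡ c₂ y × B.Ind (S ⊖ y ⊕ par′ y)
          t2′ y y∈ le with bool (fd y)
          ... | inj₁ p = let (z∈ , iz) = DI.link di y p in kp∉ _ z∈
                  , trans (out₂ _ (kp∉ _ z∈)) (trans (kp₁ _ z∈) (sym (fd₂ y p))) , iz
          ... | inj₂ p with c₂-view y
          ...   | up₂ q _ _ _ = ⊥-elim (1+n≰n (subst (_≤ t) q le))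
          ...   | same₂ q h with par₁ y y∈ (≤-pred (≤∧≢⇒< (subst (_≤ t) q le) (λ e → absurd (h y∈ e) p)))
          ...     | z∉ , cz , iz rewrite DI.old di y p = z∉ , trans (out₂ _ z∉) (trans cz (sym q)) , iz
        cnt : # kp + # fd + above c₂ (suc t) ≤ above c t
        cnt = ≤-trans (+-monoˡ-≤ (above c₂ (suc t)) (#-⊎ {P = kp} {fd} {kp ∪ fd} (λ v → ∨-l) (λ v → ∨-r {kp v})
                 (λ v p q → absurd (proj₁ (fd≡ v q)) (kp∉ v p))))
               (#-⊎ {P = kp ∪ fd} {geq full c₂ (suc t)} {geq full c t} lo hi
                 (λ v p q → 1+n≰n (subst (suc t ≤_) (c₂t v p) (geq-≤ full c₂ q))))
          where
          c₂t : ∀ v → v ∈ kp ∪ fd → c₂ v ≡ t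
          c₂t v e with ∨-cases {kp v} e
          ... | inj₁ p = trans (out₂ v (kp∉ v p)) (kp₁ v p)
          ... | inj₂ p = fd₂ v p
          lo : kp ∪ fd ⊆ geq full c t
          lo v e with ∨-cases {kp v} e
          ... | inj₁ p = geq-in full c refl (≤-reflexive (sym (kpc v p)))
          ... | inj₂ p = geq-in full c refl (≤-reflexive (sym (trans (sym (onS v (proj₁ (fd≡ v p)))) (proj₂ (fd≡ v p)))))
          hi : geq full c₂ (suc t) ⊆ geq full c t
          hi v e with c₂-view v | c₁-view v
          ... | up₂ _ q r _ | _ = geq-in full c refl (≤-reflexive (trans (sym r) (onS v q)))
          ... | same₂ p _ | bumped _ _ r _ = geq-in full c refl (≤-reflexive (sym r))
          ... | same₂ p _ | kept q _ = geq-in full c refl (≤-trans (n≤1+n t) (subst (suc t ≤_) (trans p q) (geq-≤ full c₂ e)))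
        costs : k₀ + (k + 0) + (2 + L) * above c₂ (suc t) ≤ (2 + L) * above c t
        costs = begin
          k₀ + (k + 0) + (2 + L) * a₂                         ≡⟨ cong (λ z → k₀ + z + (2 + L) * a₂) (+-identityʳ k) ⟩
          k₀ + k + (2 + L) * a₂                               ≤⟨ +-monoˡ-≤ _ (+-mono-≤ k₀≤ ct) ⟩
          # kp + (# kp + (1 + L) * # fd) + (2 + L) * a₂       ≤⟨ m≤m+n _ (L * # kp + # fd) ⟩
          # kp + (# kp + (1 + L) * # fd) + (2 + L) * a₂ + (L * # kp + # fd) ≡⟨ eq L (# kp) (# fd) a₂ ⟩
          (2 + L) * (# kp + # fd + a₂)                        ≤⟨ *-monoʳ-≤ (2 + L) cnt ⟩
          (2 + L) * above c t                                 ∎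
          where
          open ≤-Reasoning
          a₂ = above c₂ (suc t)
          eq : ∀ l p f a → p + (p + (1 + l) * f) + (2 + l) * a + (l * p + f) ≡ (2 + l) * (p + f + a)
          eq = solve-∀

    after-spec : wp (after g kp) (AfterPost ℓ g)
    after-spec = wp->>= (findSink S (elems kp)) (settle g kp) (AfterPost ℓ g) main
      where
      main : wp (findSink S (elems kp)) (λ m k → wp (settle g kp m) (λ g′ k′ → AfterPost ℓ g g′ (k + k′)))
      main with val (findSink S (elems kp)) | findSink-spec S (elems kp)
      ... | just x | (x∈ , i) , le = sink-case x (elems-∈ kp x∈) i _ (≤-trans le (length-elems kp))
      ... | nothing | h , le = move-case (λ x x∈ → h x (∈-elems kp x∈)) _ (≤-trans le (≤-reflexive (length-elems≡# kp)))

-- The search loop.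

iter : ∀ {A : Set} → (A → A) → ℕ → A → A
iter f zero    x = x
iter f (suc i) x = iter f i (f x)

-- The searches differ only in how expand pays for finding the elements of the current label that
-- M₁ lets enter above it; its answer is fixed, hence so is the sequence of configurations.
module Machine {n : ℕ} (St : Set) (ini : St) (expand : Cfg n → St → Q n (Subset n × St)) where

  -- Level 0 after a step means that `S` was augmented, so remembered exchange edges are stale.
  reset : ℕ → St → St
  reset zero    _  = ini
  reset (suc _) st = st

  mach : ℕ → ℕ → Cfg n → St → Q n (Cfg n)
  mach zero    d g st = ret g
  mach (suc f) d g st = if d ≤ᵇ Cfg.lev g then ret g else
    (expand g st >>= λ r → after g (lookup (proj₁ r)) >>= λ g′ → mach f d g′ (reset (Cfg.lev g′) (proj₂ r)))

module MachineT {n : ℕ} (MA MB : Mat n) (d : ℕ)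
                (St : Set) (ini : St) (expand : Cfg n → St → Q n (Subset n × St))
                (InvE : Cfg n → St → Set) (Pot : Cfg n → St → ℕ) (Ok : Cfg n → Set) (B₀ : ℕ) where
  open Two MA MB
  open MachineL MA MB
  open StageL MA MB
  open Machine St ini expand

  -- Expansion ends before it is known whether a path has been found, so its cost is bounded for
  -- both outcomes. `B₀` is the allowance for restoring the potential when a new search starts.
  ExpandPost : Cfg n → St → Subset n × St → ℕ → Set
  ExpandPost g st r k = let open Cfg g in proj₁ r ≡ spec g
    × (∀ c′ par′ → StepRel g c′ → InvE (cfg (suc lev) S c′ par′) (proj₂ r)
         × k + Pot (cfg (suc lev) S c′ par′) (proj₂ r) ≤ Pot g st)
    × (∀ S′ c′ par′ → (∀ v → c v ≤ c′ v) → InvE (cfg 0 S′ c′ par′) ini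
         × k + Pot (cfg 0 S′ c′ par′) ini ≤ Pot g st + B₀)

  -- Cost of one augmentation: the allowance of the expansion, the sink search, the bisections along
  -- the path, and a fresh `above` for the next search.
  price : ℕ
  price = B₀ + n + d * L + (2 + L) * n

  MachPost : Cfg n → St → Cfg n → ℕ → Set
  MachPost g st g′ k = let open Cfg in
    A.Ind (S g′) × B.Ind (S g′)
    × (∀ T → A.Ind T → B.Ind T → d * # T ≤ d * # (S g′) + # (S g′))
    × (∃ λ ℓ → MI ℓ (cfg 0 (S g′) (c g′) (par g′)))
    × k + # (S g) * price ≤ # (S g′) * price + ((2 + L) * above (c g) (suc (lev g)) + Pot g st)

  finish : ∀ {ℓ g st} → MI ℓ g → d ≤ Cfg.lev g → MachPost g st g 0
  finish {ℓ} {g} mi d≤ = iA , iB , final , (ℓ , record { MI mi ; u≤ℓ = z≤n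
      ; t1 = λ z _ le → ⊥-elim (<⇒≱ (c≥1 z) le) ; t2 = λ z _ le → ⊥-elim (<⇒≱ (c≥1 z) le) }) , m≤m+n _ _
    where
    open MI mi
    open Cfg g
    final : ∀ T → A.Ind T → B.Ind T → d * # T ≤ d * # S + # S
    final T iT jT = ≤-trans (gap d iA n1 (λ t p q → dom t p (≤-trans q (≤-trans d≤ u≤ℓ))) iT jT)
      (+-mono-≤ (≤-reflexive (cong (d *_) (+-identityʳ _))) (#-mono {P = leq S c d} (λ v → leq-S S c)))

  module _ (hex : ∀ ℓ g st → Cfg.lev g < d → MI ℓ g → Ok g → InvE g st → wp (expand g st) (ExpandPost g st)) where

    -- The fuel covers the levels left in the current search and `d + 1` steps for each augmentation
    -- that may follow. `Ok` is demanded along the iterates of `next`, in which the expansion does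
    -- not occur.
    mach-spec : ∀ f {ℓ} g st → (∀ i → i < f → Ok (iter next i g)) → MI ℓ g → InvE g st →
                (n ∸ # (Cfg.S g)) * suc d + (d ∸ Cfg.lev g) ≤ f → wp (mach f d g st) (MachPost g st)
    mach-spec zero g st ok mi ie le = finish mi (m∸n≡0⇒m≤n (n≤0⇒n≡0 (m+n≤o⇒n≤o _ le)))
    mach-spec (suc f) {ℓ} g st ok mi ie le with d ≤ᵇ Cfg.lev g in e
    ... | true = finish mi (≤ᵇ-t⁻ e)
    ... | false = wp->>= (expand g st) _ (MachPost g st) main
      where
      open Cfg g
      lev<d : lev < d
      lev<d = ≤ᵇ-f⁻ e
      rest : St → Cfg n → Q n (Cfg n)
      rest st′ g′ = mach f d g′ (reset (Cfg.lev g′) st′)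
      main : wp (expand g st) (λ r k → wp (after g (lookup (proj₁ r)) >>= rest (proj₂ r)) (λ g″ k′ → MachPost g st g″ (k + k′)))
      main with val (expand g st) | cost (expand g st) | hex ℓ g st lev<d mi (ok 0 (s≤s z≤n)) ie
      ... | .(spec g) , st′ | k | refl , hmove , haug =
        wp->>= (after g (lookup (spec g))) (rest st′) (λ g″ k′ → MachPost g st g″ (k + k′))
          (go (val (after g (lookup (spec g)))) (cost (after g (lookup (spec g)))) refl (after-spec mi))
        where
        shift : ∀ {g′} → next g ≡ g′ → ∀ i → i < f → Ok (iter next i g′)
        shift refl i lt = ok (suc i) (s≤s lt)
        go : ∀ g′ k₁ → next g ≡ g′ → AfterPost ℓ g g′ k₁ →
             wp (rest st′ g′) (λ g″ k₂ → MachPost g st g″ (k + (k₁ + k₂)))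
        go g′ k₁ eq (moved {c′} {par′} rel mi′ ct) with hmove c′ par′ rel
        ... | ie′ , pt with mach-spec f g′ st′ (shift eq) mi′ ie′ le′
          where
          le′ : (n ∸ # S) * suc d + (d ∸ suc lev) ≤ f
          le′ = ≤-pred (≤-trans (≤-reflexive (trans (sym (+-suc _ _)) (cong ((n ∸ # S) * suc d +_) (sym (+-∸-assoc 1 lev<d))))) le)
        ... | a , b , fin , mi″ , bd = a , b , fin , mi″ ,
            +-cancelʳ-≤ (p′ + X′) _ _ (begin
              k + (k₁ + k₂) + # S * price + (p′ + X′)     ≡⟨ eq₁ k k₁ k₂ (# S * price) p′ X′ ⟩
              (k₂ + # S * price) + (k₁ + X′) + (k + p′)   ≤⟨ +-mono-≤ (+-mono-≤ bd ct) pt ⟩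
              (E + (X′ + p′)) + X + p                     ≡⟨ eq₂ E X′ p′ X p ⟩
              E + (X + p) + (p′ + X′)                     ∎)
          where
          open ≤-Reasoning
          k₂ = cost (rest st′ g′)
          E = # (Cfg.S (val (rest st′ g′))) * price
          X = (2 + L) * above c (suc lev)
          X′ = (2 + L) * above c′ (suc (suc lev))
          p = Pot g st
          p′ = Pot g′ st′
          eq₁ : ∀ k a b s p x → k + (a + b) + s + (p + x) ≡ (b + s) + (a + x) + (k + p)
          eq₁ = solve-∀
          eq₂ : ∀ e x p y q → (e + (x + p)) + y + q ≡ e + (y + q) + (p + x)
          eq₂ = solve-∀
        go g′ k₁ eq (augmented {S′} {c′} {par′} mi′ card c≤ ct) with haug S′ c′ par′ c≤
        ... | ie′ , pt with mach-spec f g′ ini (shift eq) mi′ ie′ le′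
          where
          n∸ : n ∸ # S ≡ suc (n ∸ # S′)
          n∸ = trans (cong (suc n ∸_) (sym card)) (+-∸-assoc 1 (#≤n S′))
          le′ : (n ∸ # S′) * suc d + d ≤ f
          le′ = ≤-pred (≤-trans (≤-trans (≤-reflexive eq₃) (m≤m+n _ (d ∸ lev)))
                  (subst (λ z → z * suc d + (d ∸ lev) ≤ suc f) n∸ le))
            where
            eq₃ : suc ((n ∸ # S′) * suc d + d) ≡ suc (n ∸ # S′) * suc d
            eq₃ = cong suc (+-comm _ d)
        ... | a , b , fin , mi″ , bd = a , b , fin , mi″ ,
            +-cancelʳ-≤ (price + p′) _ _ (begin
              k + (k₁ + k₂) + # S * price + (price + p′)              ≡⟨ eq₁ k k₁ k₂ (# S) price p′ ⟩
              (k₂ + suc (# S) * price) + k₁ + (k + p′)                ≤⟨ +-mono-≤ (+-mono-≤ (subst (λ z → k₂ + z * price ≤ E + ((2 + L) * above c′ 1 + p′)) card bd) ct) pt ⟩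
              (E + ((2 + L) * above c′ 1 + p′)) + (n + lev * L) + (p + B₀)
                ≤⟨ +-monoˡ-≤ _ (+-mono-≤ (+-monoʳ-≤ E (+-monoˡ-≤ p′ (*-monoʳ-≤ (2 + L) (#≤n (geq full c′ 1))))) (+-monoʳ-≤ n (*-monoˡ-≤ L (<⇒≤ lev<d)))) ⟩
              (E + ((2 + L) * n + p′)) + (n + d * L) + (p + B₀)       ≡⟨ eq₂ E ((2 + L) * n) p′ n (d * L) p B₀ ⟩
              E + p + (price + p′)                                    ≤⟨ +-monoˡ-≤ (price + p′) (+-monoʳ-≤ E (m≤n+m p X)) ⟩
              E + (X + p) + (price + p′)                              ∎)
          where
          open ≤-Reasoning
          k₂ = cost (rest st′ g′)
          E = # (Cfg.S (val (rest st′ g′))) * price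
          X = (2 + L) * above c (suc lev)
          p = Pot g st
          p′ = Pot g′ ini
          eq₁ : ∀ k a b s q p → k + (a + b) + s * q + (q + p) ≡ (b + suc s * q) + a + (k + p)
          eq₁ = solve-∀
          eq₂ : ∀ e l p m x y b → (e + (l + p)) + (m + x) + (y + b) ≡ e + y + (b + m + x + l + p)
          eq₂ = solve-∀

module _ {n : ℕ} where

  naive : Cfg n → ⊤ → Q n (Subset n × ⊤)
  naive (cfg u S c par) _ = travQ (λ v → if not (S v) ∧ (c v ≡ᵇ suc u) then test M₁ (geq S c (suc u) ⊕ v) else ret false)
    >>= λ kp → ret (kp , tt)

  -- A query about `v` either raises its label, paid by the second summand, or leaves `v` behind for
  -- the rest of this search, paid by the first.
  naivePot : ℕ → Cfg n → ⊤ → ℕ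
  naivePot d (cfg u S c par) _ = sumF (λ v → b2n (suc u ≤ᵇ c v) + (d + 1 ∸ c v))

module NaiveL {n : ℕ} (MA MB : Mat n) (d : ℕ) where
  open Two MA MB
  open MachineL MA MB
  open StageL MA MB
  open MachineT MA MB d ⊤ tt naive (λ _ _ → ⊤) (naivePot d) (λ _ → ⊤) (2 * n)

  naive-spec : ∀ ℓ g st → Cfg.lev g < d → MI ℓ g → ⊤ → ⊤ → wp (naive g st) (ExpandPost g st)
  naive-spec ℓ g@(cfg u S c par) st u<d mi _ _ = wp->>= (travQ f) (λ kp → ret (kp , tt)) (ExpandPost g st)
      (kp≡ , (λ c′ par′ rel → tt , moveCost c′ rel) , (λ S′ c′ par′ c≤ → tt , augCost c′ c≤))
    where
    f : Fin n → Q n Bool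
    f v = if not (S v) ∧ (c v ≡ᵇ suc u) then test M₁ (geq S c (suc u) ⊕ v) else ret false
    val-f : ∀ v → val (f v) ≡ not (S v) ∧ (c v ≡ᵇ suc u) ∧ A.ind (geq S c (suc u) ⊕ v)
    val-f v with not (S v) | c v ≡ᵇ suc u
    ... | false | _ = refl
    ... | true | false = refl
    ... | true | true = refl
    cost-f : ∀ v → cost (f v) ≡ b2n (not (S v) ∧ (c v ≡ᵇ suc u))
    cost-f v with not (S v) ∧ (c v ≡ᵇ suc u)
    ... | true = refl
    ... | false = refl
    kp≡ : val (travQ f) ≡ spec g
    kp≡ = trans (val-trav f) (tabulate-cong val-f)
    k≡ : cost (travQ f) + 0 ≡ sumF (λ v → b2n (not (S v) ∧ (c v ≡ᵇ suc u)))
    k≡ = trans (+-identityʳ _) (trans (cost-trav f) (sum-cong cost-f))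
    k≤n : cost (travQ f) + 0 ≤ n
    k≤n = subst (_≤ n) (sym k≡) (#≤n (λ v → not (S v) ∧ (c v ≡ᵇ suc u)))
    pt : ℕ → ℕ → ℕ
    pt t x = b2n (t ≤ᵇ x) + (d + 1 ∸ x)
    pt-bump : ∀ {x y} → x ≡ suc u → y ≡ suc (suc u) → 1 + pt (suc (suc u)) y ≤ pt (suc u) x
    pt-bump refl refl rewrite ≤ᵇ-t (≤-refl {suc u}) | +-comm d 1 =
      s≤s (≤-reflexive (sym (+-∸-assoc 1 {d} {suc u} u<d)))
    pt-at : ∀ {x y} → x ≡ suc u → y ≡ x → 1 + pt (suc (suc u)) y ≤ pt (suc u) x
    pt-at refl refl rewrite ≤ᵇ-t (≤-refl {suc u}) | ≤ᵇ-f (≤-refl {suc (suc u)}) = ≤-refl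
    pt-same : ∀ {x y} → y ≡ x → pt (suc (suc u)) y ≤ pt (suc u) x
    pt-same {x} refl = +-monoˡ-≤ (d + 1 ∸ x) (b2n-mono {suc (suc u) ≤ᵇ x} {suc u ≤ᵇ x}
      (λ e → ≤ᵇ-t {suc u} {x} (≤-trans (n≤1+n (suc u)) (≤ᵇ-t⁻ {suc (suc u)} {x} e))))
    moveCost : ∀ c′ → StepRel g c′ → cost (travQ f) + 0 + naivePot d (cfg (suc u) S c′ par) tt ≤ naivePot d g tt
    moveCost c′ rel = begin
      cost (travQ f) + 0 + sumF (λ v → pt (suc (suc u)) (c′ v))   ≡⟨ cong (_+ sumF (λ v → pt (suc (suc u)) (c′ v))) k≡ ⟩
      sumF (λ v → b2n (not (S v) ∧ (c v ≡ᵇ suc u))) + sumF (λ v → pt (suc (suc u)) (c′ v))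
        ≡⟨ sym (sum-+ (λ v → b2n (not (S v) ∧ (c v ≡ᵇ suc u))) (λ v → pt (suc (suc u)) (c′ v))) ⟩
      sumF (λ v → b2n (not (S v) ∧ (c v ≡ᵇ suc u)) + pt (suc (suc u)) (c′ v))
        ≤⟨ sum-mono pw ⟩
      sumF (λ v → pt (suc u) (c v))                               ∎
      where
      open ≤-Reasoning
      pw : ∀ v → b2n (not (S v) ∧ (c v ≡ᵇ suc u)) + pt (suc (suc u)) (c′ v) ≤ pt (suc u) (c v)
      pw v with S v in eS
      ... | true with StepRel.inner rel v eS
      ... | inj₁ e = pt-same {c v} e
      ... | inj₂ (e , e′) = ≤-trans (n≤1+n _) (pt-bump {c v} e e′)
      pw v | false with StepRel.outer rel v eS
      ... | e rewrite eS with c v ≡ᵇ suc u in ec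
      ... | false = pt-same {c v} e
      ... | true with not (lookup (spec g) v)
      ... | true = pt-bump {c v} (≡ᵇ-t⁻ {c v} ec) e
      ... | false = pt-at {c v} (≡ᵇ-t⁻ {c v} ec) e
    augCost : ∀ c′ → (∀ v → c v ≤ c′ v) → cost (travQ f) + 0 + naivePot d (cfg 0 S c′ par) tt ≤ naivePot d g tt + 2 * n
    augCost c′ c≤ = begin
      cost (travQ f) + 0 + sumF (λ v → pt 1 (c′ v))           ≤⟨ +-mono-≤ k≤n (sum-mono pw) ⟩
      n + sumF (λ v → pt (suc u) (c v) + 1)                   ≡⟨ cong (n +_) (trans (sum-+ (λ v → pt (suc u) (c v)) (λ _ → 1)) (cong (naivePot d g tt +_) (sum-const {n} 1))) ⟩
      n + (naivePot d g tt + n * 1)                           ≡⟨ eq n (naivePot d g tt) ⟩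
      naivePot d g tt + 2 * n                                 ∎
      where
      open ≤-Reasoning
      eq : ∀ n p → n + (p + n * 1) ≡ p + 2 * n
      eq = solve-∀
      pw : ∀ v → pt 1 (c′ v) ≤ pt (suc u) (c v) + 1
      pw v = begin
        b2n (1 ≤ᵇ c′ v) + (d + 1 ∸ c′ v)   ≤⟨ +-mono-≤ (b2n≤1 (1 ≤ᵇ c′ v)) (∸-monoʳ-≤ (d + 1) (c≤ v)) ⟩
        1 + (d + 1 ∸ c v)                  ≡⟨ +-comm 1 _ ⟩
        (d + 1 ∸ c v) + 1                  ≤⟨ +-monoˡ-≤ 1 (m≤n+m _ (b2n (suc u ≤ᵇ c v))) ⟩
        pt (suc u) (c v) + 1               ∎

  naive-mach : ∀ f {ℓ} g → MI ℓ g → (n ∸ # (Cfg.S g)) * suc d + (d ∸ Cfg.lev g) ≤ f →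
               wp (Machine.mach ⊤ tt naive f d g tt) (MachPost g tt)
  naive-mach f g mi le = mach-spec naive-spec f g tt (λ _ _ → tt) mi tt le

  naivePot-≤ : ∀ g → naivePot d g tt ≤ (d + 2) * n
  naivePot-≤ g = ≤-trans (sum-mono {n} {g = λ _ → d + 2} (λ v → ≤-trans
      (+-mono-≤ (b2n≤1 (suc (Cfg.lev g) ≤ᵇ Cfg.c g v)) (m∸n≤m (d + 1) (Cfg.c g v)))
      (≤-reflexive (trans (+-comm 1 _) (+-assoc d 1 1)))))
    (≤-reflexive (trans (sum-const {n} (d + 2)) (*-comm n _)))

nonempty : ∀ {n} → Pr n → Bool
nonempty P = 1 ≤ᵇ # P

pick : ∀ {n} (P : Pr n) → 1 ≤ # P → ∃ λ x → x ∈ P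
pick {zero} P ()
pick {suc n} P le with P zero in e
... | true = zero , e
... | false = let (x , p) = pick (P ∘ suc) le in suc x , p

nonempty-t : ∀ {n} (P : Pr n) → nonempty P ≡ true → ∃ λ x → x ∈ P
nonempty-t P e = pick P (≤ᵇ-t⁻ e)

nonempty-f : ∀ {n} (P : Pr n) → nonempty P ≡ false → ∀ x → x ∉ P
nonempty-f P e x = ¬true⇒false λ p → absurd (≤ᵇ-t (≤-trans (≤-reflexive (sym (cong b2n p))) (sum-point (λ i → b2n (P i)) x))) e

nonempty-in : ∀ {n} (P : Pr n) x → x ∈ P → nonempty P ≡ true
nonempty-in P x p with bool (nonempty P)
... | inj₁ e = e
... | inj₂ e = absurd p (nonempty-f P e x)

-- Cheap level expansion

-- K x holds known exchange edges y → x. Every edge from F to a free element with fewer than h known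
-- edges is known. ref is the number of measured free elements when the edges were last refreshed.
record Mem (n : ℕ) : Set where
  constructor mem
  field
    K   : Fin n → Pr n
    F   : Pr n
    ref : ℕ

opaque
  free : ∀ {n} → Pr n → Lab n → ℕ → Pr n
  free S c t x = not (S x) ∧ (t ≤ᵇ c x)

  _∖_ : ∀ {n} → Pr n → Pr n → Pr n
  (P ∖ R) x = P x ∧ not (R x)

  free-in : ∀ {n} (S : Pr n) c {t x} → x ∉ S → t ≤ c x → x ∈ free S c t
  free-in S c p q = ∧-intro (not-f p) (≤ᵇ-t q)

  free-∉ : ∀ {n} (S : Pr n) c {t x} → x ∈ free S c t → x ∉ S
  free-∉ S c e = not-t (∧-l e)

  free-≤ : ∀ {n} (S : Pr n) c {t x} → x ∈ free S c t → t ≤ c x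
  free-≤ S c {x = x} e = ≤ᵇ-t⁻ (∧-r {not (S x)} e)

  ∖-in : ∀ {n} (P R : Pr n) {x} → x ∈ P → x ∉ R → x ∈ P ∖ R
  ∖-in P R p q = ∧-intro p (not-f q)

  ∖-∈ : ∀ {n} (P R : Pr n) {x} → x ∈ P ∖ R → x ∈ P
  ∖-∈ P R = ∧-l

  ∖-∉ : ∀ {n} (P R : Pr n) {x} → x ∈ P ∖ R → x ∉ R
  ∖-∉ P R {x} e = not-t (∧-r {P x} e)

module _ {n : ℕ} where

  opaque
    known : Pr n → Pr n → (Fin n → Pr n) → Fin n → Pr n
    known Z U K y x = Z x ∧ U x ∧ K x y

    known-in : ∀ Z U K {y x} → x ∈ Z → x ∈ U → y ∈ K x → x ∈ known Z U K y
    known-in Z U K p q r = ∧-intro p (∧-intro q r)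

    known-Z : ∀ Z U K {y x} → x ∈ known Z U K y → x ∈ Z
    known-Z Z U K = ∧-l

    known-U : ∀ Z U K {y x} → x ∈ known Z U K y → x ∈ U
    known-U Z U K {x = x} e = ∧-l (∧-r {Z x} e)

    known-K : ∀ Z U K {y x} → x ∈ known Z U K y → y ∈ K x
    known-K Z U K {x = x} e = ∧-r {U x} (∧-r {Z x} e)

  deg : Pr n → Pr n → (Fin n → Pr n) → Fin n → ℕ
  deg Z U K y = # (known Z U K y)

  edges : (Fin n → Pr n) → ℕ
  edges K = sumF (λ x → # (K x))

  -- Delete from `S` all light elements not known to have an edge to `x`. If `x` is still refused,
  -- none of them has such an edge; otherwise bisection over the deleted ones finds one. An element
  -- reaching degree `hi` stops being light at once, which bounds the edges it collects.
  learn : Pr n → Pr n → Pr n → ℕ → ℕ → ℕ → Fin n → (Fin n → Pr n) × Pr n → Q n ((Fin n → Pr n) × Pr n)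
  learn Z S U hi h zero    x st = ret st
  learn Z S U hi h (suc f) x (K , F) = if h ≤ᵇ # (K x) then ret (K , F) else
    qry M₁ ((S ∖ (F ∖ K x)) ⊕ x) λ
      { false → ret (K , F)
      ; true  → bisect M₁ (logn n) ((S ∖ (F ∖ K x)) ⊕ x) (elems (F ∖ K x)) x >>= λ y →
          learn Z S U hi h f x (upd K x (K x ⊕ y)
            , (if hi ≤ᵇ deg Z U (upd K x (K x ⊕ y)) y then F ⊖ y else F)) }

  light : Pr n → Pr n → Pr n → ℕ → (Fin n → Pr n) → Pr n
  light Z S U hi K y = S y ∧ (suc (deg Z U K y) ≤ᵇ hi)

  refresh : Pr n → Pr n → Pr n → ℕ → ℕ → Mem n → Q n (Mem n)
  refresh Z S U hi h (mem K F ref) =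
    foldQ (learn Z S U hi h n) (elems U) (K , light Z S U hi K) >>= λ r →
    ret (mem (proj₁ r) (proj₂ r) (# (Z ∩ U)))

-- Learning exchange edges.

module RefreshL {n : ℕ} (MA MB : Mat n) (Z S U : Pr n) (hi h : ℕ) (iS : Mat.ind MA S ≡ true)
                (U∉ : ∀ x → x ∈ U → x ∉ S) (dep : ∀ x → x ∈ U → Mat.ind MA (S ⊕ x) ≡ false) where
  open Two MA MB

  Edge : Fin n → Fin n → Set
  Edge y x = A.Ind (S ⊖ y ⊕ x)

  Done : (Fin n → Pr n) → Pr n → Fin n → Set
  Done K F x = h ≤ # (K x) ⊎ (∀ y → y ∈ F → Edge y x → y ∈ K x)

  module _ (K₀ : Fin n → Pr n) (kh₀ : ∀ x → # (K₀ x) ≤ h) where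

    F₀ : Pr n
    F₀ = light Z S U hi K₀

    record RI (st : (Fin n → Pr n) × Pr n) : Set where
      K : Fin n → Pr n
      K = proj₁ st
      F : Pr n
      F = proj₂ st
      field
        grow : ∀ x → K₀ x ⊆ K x
        new  : ∀ x y → y ∈ K x → y ∉ K₀ x → x ∈ U × y ∈ F₀ × Edge y x
        F⊆   : F ⊆ F₀
        out  : ∀ y → y ∈ F₀ → y ∉ F → hi ≤ deg Z U K y
        inn  : ∀ y → y ∈ F → suc (deg Z U K y) ≤ hi
        le   : ∀ y → deg Z U K₀ y ≤ hi → deg Z U K y ≤ hi
        kh   : ∀ x → # (K x) ≤ h

    LPost : Fin n → (Fin n → Pr n) × Pr n → (Fin n → Pr n) × Pr n → ℕ → Set
    LPost x st st′ k = RI st′ × Done (proj₁ st′) (proj₂ st′) x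
      × (∀ z → proj₁ st z ⊆ proj₁ st′ z) × proj₂ st′ ⊆ proj₂ st
      × k + (1 + L) * edges (proj₁ st) ≤ 1 + (1 + L) * edges (proj₁ st′)

    module Step {K F x y f} (R : RI (K , F)) (x∈ : x ∈ U) (y∈F : y ∈ F) (y∉K : y ∉ K x) (hlt : # (K x) < h)
                (ed : Edge y x) (fuel : # (F ∖ K x) ≤ suc f) where
      K′ : Fin n → Pr n
      K′ = upd K x (K x ⊕ y)
      F′ : Pr n
      F′ = if hi ≤ᵇ deg Z U K′ y then F ⊖ y else F
      K′x : K′ x ≡ K x ⊕ y
      K′x = upd-here K x (K x ⊕ y)
      K⊆ : ∀ z → K z ⊆ K′ z
      K⊆ z v e with bool (z == x)
      ... | inj₁ q with refl ← ==-true q = subst (v ∈_) (sym K′x) (⊕-there (K z) e)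
      ... | inj₂ q = subst (v ∈_) (sym (upd-there K (K x ⊕ y) (==-false⁻ q))) e
      K′-cases : ∀ z v → v ∈ K′ z → (v ∈ K z) ⊎ (z ≡ x × v ≡ y)
      K′-cases z v e with bool (z == x)
      ... | inj₂ q = inj₁ (subst (v ∈_) (upd-there K (K x ⊕ y) (==-false⁻ q)) e)
      ... | inj₁ q with refl ← ==-true q with ⊕-cases (K z) (subst (v ∈_) K′x e)
      ... | inj₁ r = inj₁ r
      ... | inj₂ r = inj₂ (refl , r)
      deg-mono : ∀ w → deg Z U K w ≤ deg Z U K′ w
      deg-mono w = #-mono {P = known Z U K w} (λ z e → known-in Z U K′ (known-Z Z U K e) (known-U Z U K e) (K⊆ z w (known-K Z U K e)))
      deg-other : ∀ w → w ≢ y → deg Z U K′ w ≤ deg Z U K w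
      deg-other w ne = #-mono {P = known Z U K′ w} {known Z U K w} (λ z e → known-in Z U K (known-Z Z U K′ e) (known-U Z U K′ e)
        (case K′-cases z w (known-K Z U K′ e) of λ { (inj₁ q) → q ; (inj₂ (_ , q)) → ⊥-elim (ne q) }))
      deg-y : deg Z U K′ y ≤ suc (deg Z U K y)
      deg-y = ≤-trans (#-∪ {P = known Z U K y} {λ v → v == x} {known Z U K′ y} lem)
                (≤-reflexive (trans (cong (deg Z U K y +_) (#-sing x)) (+-comm _ 1)))
        where
        lem : ∀ z → z ∈ known Z U K′ y → (z ∈ known Z U K y) ⊎ ((z == x) ≡ true)
        lem z e with K′-cases z y (known-K Z U K′ e)
        ... | inj₁ q = inj₁ (known-in Z U K (known-Z Z U K′ e) (known-U Z U K′ e) q)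
        ... | inj₂ (refl , _) = inj₂ (==-refl z)
      F′⊆ : F′ ⊆ F
      F′⊆ v e with hi ≤ᵇ deg Z U K′ y
      ... | true = ⊖-∈ F {y} e
      ... | false = e
      F′-out : ∀ v → v ∈ F → v ∉ F′ → v ≡ y × hi ≤ deg Z U K′ y
      F′-out v p q with hi ≤ᵇ deg Z U K′ y in e
      ... | false = absurd p q
      ... | true with bool (v == y)
      ... | inj₁ r = ==-true r , ≤ᵇ-t⁻ e
      ... | inj₂ r = absurd (⊖-in F p (==-false⁻ r)) q
      F′-y : y ∈ F′ → suc (deg Z U K′ y) ≤ hi
      F′-y e with hi ≤ᵇ deg Z U K′ y in q
      ... | true = absurd e (⊖-here F y)
      ... | false = ≤ᵇ-f⁻ q
      step : RI (K′ , F′)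
      step = record
        { grow = λ z v e → K⊆ z v (RI.grow R z v e)
        ; new = λ z v e q → case K′-cases z v e of λ
            { (inj₁ r) → RI.new R z v r q ; (inj₂ (refl , refl)) → x∈ , RI.F⊆ R v y∈F , ed }
        ; F⊆ = λ v e → RI.F⊆ R v (F′⊆ v e)
        ; out = out′
        ; inn = inn′
        ; le = λ w q → le′ w q
        ; kh = kh′ }
        where
        out′ : ∀ w → w ∈ F₀ → w ∉ F′ → hi ≤ deg Z U K′ w
        out′ w p q with bool (F w)
        ... | inj₂ r = ≤-trans (RI.out R w p r) (deg-mono w)
        ... | inj₁ r with F′-out w r q
        ... | refl , b = b
        inn′ : ∀ w → w ∈ F′ → suc (deg Z U K′ w) ≤ hi
        inn′ w e with bool (w == y)
        ... | inj₁ q with refl ← ==-true q = F′-y e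
        ... | inj₂ q = ≤-trans (s≤s (deg-other w (==-false⁻ q))) (RI.inn R w (F′⊆ w e))
        le′ : ∀ w → deg Z U K₀ w ≤ hi → deg Z U K′ w ≤ hi
        le′ w q with bool (w == y)
        ... | inj₁ r with refl ← ==-true r = ≤-trans deg-y (RI.inn R w y∈F)
        ... | inj₂ r = ≤-trans (deg-other w (==-false⁻ r)) (RI.le R w q)
        kh′ : ∀ z → # (K′ z) ≤ h
        kh′ z with bool (z == x)
        ... | inj₂ r = subst (λ P → # P ≤ h) (sym (upd-there K (K x ⊕ y) (==-false⁻ r))) (RI.kh R z)
        ... | inj₁ r with refl ← ==-true r = subst (λ P → # P ≤ h) (sym K′x) (≤-trans (≤-reflexive (#-⊕ (K z) y∉K)) hlt)
      fuel′ : # (F′ ∖ K′ x) ≤ f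
      fuel′ = ≤-pred (≤-trans (#-⊂ {P = F′ ∖ K′ x} {F ∖ K x} {y} sub y∉ (∖-in F (K x) y∈F y∉K)) fuel)
        where
        sub : F′ ∖ K′ x ⊆ F ∖ K x
        sub v e = ∖-in F (K x) (F′⊆ v (∖-∈ F′ (K′ x) e)) (¬true⇒false (λ q → absurd (K⊆ x v q) (∖-∉ F′ (K′ x) e)))
        y∉ : y ∉ F′ ∖ K′ x
        y∉ = ¬true⇒false (λ e → absurd (subst (y ∈_) (sym K′x) (⊕-here (K x) y)) (∖-∉ F′ (K′ x) e))
      edges′ : edges K + 1 ≤ edges K′
      edges′ = sum-mono-at x 1 (λ z → #-mono {P = K z} (K⊆ z))
        (≤-reflexive (trans (+-comm _ 1) (sym (trans (cong # K′x) (#-⊕ (K x) y∉K)))))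

    learn-spec : ∀ f x st → x ∈ U → RI st → # (proj₂ st ∖ proj₁ st x) ≤ f →
                 wp (learn Z S U hi h f x st) (LPost x st)
    learn-spec zero x st@(K , F) x∈ R le = R , inj₂ dn , (λ _ _ e → e) , (λ _ e → e) , n≤1+n _
      where
      dn : ∀ y → y ∈ F → Edge y x → y ∈ K x
      dn y y∈ _ with bool (K x y)
      ... | inj₁ q = q
      ... | inj₂ q = ⊥-elim (1+n≰n (≤-trans (≤-reflexive (sym (cong b2n (∖-in F (K x) y∈ q))))
              (≤-trans (sum-point (λ i → b2n ((F ∖ K x) i)) y) le)))
    learn-spec (suc f) x st@(K , F) x∈ R le with h ≤ᵇ # (K x) in eh
    ... | true = R , inj₁ (≤ᵇ-t⁻ eh) , (λ _ _ e → e) , (λ _ e → e) , n≤1+n _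
    ... | false with A.ind ((S ∖ (F ∖ K x)) ⊕ x) in eq
    ...   | false = R , inj₂ dn , (λ _ _ e → e) , (λ _ e → e) , ≤-refl
      where
      dn : ∀ y → y ∈ F → Edge y x → y ∈ K x
      dn y y∈ ed with bool (K x y)
      ... | inj₁ q = q
      ... | inj₂ q = absurd (A.down (⊕-mono {P = S ∖ (F ∖ K x)} {S ⊖ y} (λ v e →
              ⊖-in S (∖-∈ S (F ∖ K x) e) (λ { refl → absurd (∖-in F (K x) y∈ q) (∖-∉ S (F ∖ K x) e) }))) ed) eq
    ...   | true = wp->>= (bisect M₁ L BB (elems W) x) _ (λ st′ k → LPost x st st′ (suc k)) (main bs)
      where
      W = F ∖ K x
      BB = (S ∖ W) ⊕ x
      allW : S ⊕ x ⊆ addL BB (elems W)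
      allW = ⊕-⊆ {P = S} lem (addL-⊇ (elems W) x (⊕-here (S ∖ W) x))
        where
        lem : S ⊆ addL BB (elems W)
        lem v e with bool (W v)
        ... | inj₁ q = addL-∈ (elems W) (∈-elems W q)
        ... | inj₂ q = addL-⊇ (elems W) v (⊕-there (S ∖ W) (∖-in S W e q))
      bs = SA.bisect-spec L BB (elems W) x (len-elems W) eq (A.up allW (dep x x∈))
      F₀S : ∀ y → y ∈ F → y ∈ S
      F₀S y e = ∧-l (RI.F⊆ R y e)
      main : ∀ {y k} → SA.Splits BB (elems W) y × k ≤ L →
             wp (learn Z S U hi h f x (upd K x (K x ⊕ y) , (if hi ≤ᵇ deg Z U (upd K x (K x ⊕ y)) y then F ⊖ y else F)))
                (λ st′ k′ → LPost x st st′ (suc (k + k′)))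
      main {y} {k} ((y∈ , A′ , BA , AZ , a , ad) , k≤) = fin (learn-spec f x (K′ , F′) x∈ step fuel′)
        where
        yW : y ∈ W
        yW = elems-∈ W y∈
        A⊆ : ∀ v → v ∈ A′ → v ∈ S ⊕ x
        A⊆ v q with AZ v q
        ... | inj₂ r = ⊕-there S (F₀S v (∖-∈ F (K x) (elems-∈ W r)))
        ... | inj₁ r = ⊕-mono {P = S ∖ W} {S} (λ w → ∖-∈ S W) v r
        open Step R x∈ (∖-∈ F (K x) yW) (∖-∉ F (K x) yW) (≤ᵇ-f⁻ eh)
          (A.pivot iS a A⊆ (F₀S y (∖-∈ F (K x) yW)) (BA x (⊕-here (S ∖ W) x)) (U∉ x x∈) ad) le
        fin : ∀ {st′ k′} → LPost x (K′ , F′) st′ k′ → LPost x st st′ (suc (k + k′))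
        fin {st′} {k′} (R′ , dn , g , fs , ct) = R′ , dn , (λ z v e → g z v (K⊆ z v e)) , (λ v e → F′⊆ v (fs v e)) , (begin
          suc (k + k′) + (1 + L) * edges K       ≤⟨ +-monoˡ-≤ _ (s≤s (+-monoˡ-≤ k′ k≤)) ⟩
          suc (L + k′) + (1 + L) * edges K       ≡⟨ eqn L k′ (edges K) ⟩
          k′ + (1 + L) * (edges K + 1)           ≤⟨ +-monoʳ-≤ k′ (*-monoʳ-≤ (1 + L) edges′) ⟩
          k′ + (1 + L) * edges K′                ≤⟨ ct ⟩
          1 + (1 + L) * edges (proj₁ st′)        ∎)
          where
          open ≤-Reasoning
          eqn : ∀ l k e → suc (l + k) + (1 + l) * e ≡ k + (1 + l) * (e + 1)
          eqn = solve-∀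

    refresh-spec : ∀ F ref → wp (refresh Z S U hi h (mem K₀ F ref)) (λ m k → let open Mem m renaming (K to K′; F to F′; ref to ref′) in
      RI (K′ , F′) × (∀ x → x ∈ U → Done K′ F′ x) × ref′ ≡ # (Z ∩ U) × k + (1 + L) * edges K₀ ≤ # U + (1 + L) * edges K′)
    refresh-spec F ref = wp->>= (foldQ (learn Z S U hi h n) (elems U) (K₀ , F₀)) (λ r → ret (mem (proj₁ r) (proj₂ r) (# (Z ∩ U))))
      (λ m k → RI (Mem.K m , Mem.F m) × (∀ x → x ∈ U → Done (Mem.K m) (Mem.F m) x) × Mem.ref m ≡ # (Z ∩ U)
          × k + (1 + L) * edges K₀ ≤ # U + (1 + L) * edges (Mem.K m))
      (fin {k = cost (foldQ (learn Z S U hi h n) (elems U) (K₀ , F₀))} (wp-fold (learn Z S U hi h n) P step (elems U) (K₀ , F₀) 0 (init , (λ x x∈ → inj₁ (∈-elems U x∈)) , (λ x → elems-∈ U)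
        , ≤-reflexive (cong (_+ (1 + L) * edges K₀) (length-elems≡# U)))))
      where
      P : List (Fin n) → (Fin n → Pr n) × Pr n → ℕ → Set
      P xs st k = RI st × (∀ x → x ∈ U → (x ∈L xs) ⊎ Done (proj₁ st) (proj₂ st) x) × (∀ x → x ∈L xs → x ∈ U)
        × k + length xs + (1 + L) * edges K₀ ≤ # U + (1 + L) * edges (proj₁ st)
      init : RI (K₀ , F₀)
      init = record { grow = λ _ _ e → e ; new = λ x y p q → absurd p q ; F⊆ = λ _ e → e ; out = λ y p q → absurd p q
                    ; inn = λ y e → ≤ᵇ-t⁻ (∧-r {S y} e) ; le = λ _ q → q ; kh = kh₀ }
      fin : ∀ {r k} → P [] r k → RI r × (∀ x → x ∈ U → Done (proj₁ r) (proj₂ r) x) × # (Z ∩ U) ≡ # (Z ∩ U)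
          × (k + 0) + (1 + L) * edges K₀ ≤ # U + (1 + L) * edges (proj₁ r)
      fin {k = k} (R , dn , _ , ct) = R , (λ x x∈ → case dn x x∈ of λ { (inj₂ q) → q }) , refl , ct
      step : ∀ x xs st k → P (x ∷ xs) st k → wp (learn Z S U hi h n x st) (λ st′ k′ → P xs st′ (k + k′))
      step x xs st k (R , dn , xs⊆ , ct) with learn-spec n x st (xs⊆ x (here refl)) R (#≤n (proj₂ st ∖ proj₁ st x))
      ... | R′ , d , g , fs , ct′ = R′ , dn′ , (λ y q → xs⊆ y (there q)) ,
            +-cancelʳ-≤ (1 + e) _ _ (subst₂ _≤_ (eqn k k′ (length xs) e₀ e) (eqn₂ (# U) e e′) (+-mono-≤ ct ct′))
        where
        st′ = val (learn Z S U hi h n x st)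
        k′ = cost (learn Z S U hi h n x st)
        e₀ = (1 + L) * edges K₀
        e = (1 + L) * edges (proj₁ st)
        e′ = (1 + L) * edges (proj₁ st′)
        eqn : ∀ k k′ l a e → k + suc l + a + (k′ + e) ≡ k + k′ + l + a + (1 + e)
        eqn = solve-∀
        eqn₂ : ∀ u e e′ → u + e + (1 + e′) ≡ u + e′ + (1 + e)
        eqn₂ = solve-∀
        dn′ : ∀ z → z ∈ U → (z ∈L xs) ⊎ Done (proj₁ st′) (proj₂ st′) z
        dn′ z z∈ with dn z z∈
        ... | inj₁ (here refl) = inj₂ d
        ... | inj₁ (there q) = inj₁ q
        ... | inj₂ (inj₁ q) = inj₂ (inj₁ (≤-trans q (#-mono {P = proj₁ st z} (g z))))
        ... | inj₂ (inj₂ q) = inj₂ (inj₂ (λ y y∈ ed → g z y (q y (fs y y∈) ed)))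

module _ {n : ℕ} where

  table : Pr n → Pr n → Q n (Vec (Vec Bool n) n)
  table Z S = travQ λ x → if Z x ∧ not (S x)
    then travQ (λ y → if S y then test M₁ (S ⊖ y ⊕ x) else ret false)
    else ret (tabulate ∅)

  candidate : Pr n → Lab n → ℕ → Pr n
  candidate S c t v = not (S v) ∧ (c v ≡ᵇ t)

  -- Degrees are measured inside `Z`, which is the whole ground set or the sample. Light elements
  -- have fewer than `hi` measured edges; a heavy one is still hot while it has `lo`. `h` caps the
  -- edges per outside element, and `pre` demands a table of all edges into the sample.
  module Smart (Z : Pr n) (pre : Bool) (lo hi h : ℕ) where

    hot : Pr n → Pr n → Mem n → Pr n
    hot Y U (mem K F ref) y = (Y ∖ F) y ∧ (lo ≤ᵇ deg Z U K y)

    update : Pr n → Pr n → Pr n → Mem n → Q n (Mem n)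
    update S Y U m = if nonempty (Y ∖ Mem.F m) ∧ not (nonempty (hot Y U m)) then refresh Z S U hi h m else ret m

    decide : Pr n → Lab n → ℕ → Pr n → Mem n → Fin n → Q n Bool
    decide S c t Y m v = if candidate S c t v
      then (if not (nonempty (Y ∖ Mem.F m)) ∧ not (h ≤ᵇ # (Mem.K m v))
              then ret (nonempty (Mem.K m v ∩ Y)) else test M₁ (geq S c t ⊕ v))
      else ret false

    -- The extra hi in the initial ref pays for the first refresh.
    smart : Cfg n → Mem n → Q n (Subset n × Mem n)
    smart (cfg zero S c par) m =
      travQ (λ v → if candidate S c 1 v then test M₁ (geq S c 1 ⊕ v) else ret false) >>= λ kp →
      (if pre then table Z S else ret (tabulate (λ _ → tabulate ∅))) >>= λ tb →
      ret (kp , mem (λ x y → lookup (lookup tb x) y) ∅ (# Z + hi))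
    smart (cfg (suc u) S c par) m =
      update S (at S c (suc u)) (free S c (suc (suc u))) m >>= λ m′ →
      travQ (decide S c (suc (suc u)) (at S c (suc u)) m′) >>= λ kp →
      ret (kp , m′)

-- Invariants and cost of the cheap expansion.

module SmartInv {n : ℕ} (MA MB : Mat n) (Z : Pr n) (pre : Bool) (hi h : ℕ) where
  open Two MA MB

  -- `k3` remembers heaviness: at the last refresh the element had `hi` measured edges, and it
  -- cannot have lost more of them than measured free elements have disappeared since. `tab` belongs
  -- to the mode with a table, `dle` to the one without.
  record SI (S U : Pr n) (m : Mem n) : Set where
    open Mem m
    field
      k1  : ∀ x y → y ∈ K x → y ∈ S × A.Ind (S ⊖ y ⊕ x)
      k2  : ∀ x → x ∈ U → h ≤ # (K x) ⊎ (∀ y → y ∈ F → A.Ind (S ⊖ y ⊕ x) → y ∈ K x)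
      f⊆  : F ⊆ S
      k3  : ∀ y → y ∈ S → y ∉ F → hi + # (Z ∩ U) ≤ deg Z U K y + ref
      inn : ∀ y → y ∈ F → suc (deg Z U K y) ≤ hi
      tab : pre ≡ true → ∀ x y → x ∈ Z → x ∉ S → y ∈ S → A.Ind (S ⊖ y ⊕ x) → y ∈ K x
      dle : pre ≡ false → ∀ y → deg Z U K y ≤ hi
      kh  : ∀ x → # (K x) ≤ h

  shrink : ∀ {S U U′ m} → U′ ⊆ U → SI S U m → SI S U′ m
  shrink {S} {U} {U′} {mem K F ref} sub si = record
    { k1 = k1 ; k2 = λ x x∈ → k2 x (sub x x∈) ; f⊆ = f⊆
    ; k3 = λ y p q → +-cancelʳ-≤ (deg Z U K y) _ _ (begin
        hi + # (Z ∩ U′) + deg Z U K y       ≡⟨ +-assoc hi _ _ ⟩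
        hi + (# (Z ∩ U′) + deg Z U K y)     ≤⟨ +-monoʳ-≤ hi (loss y) ⟩
        hi + (deg Z U′ K y + # (Z ∩ U))     ≡⟨ eq hi (deg Z U′ K y) (# (Z ∩ U)) ⟩
        deg Z U′ K y + (hi + # (Z ∩ U))     ≤⟨ +-monoʳ-≤ (deg Z U′ K y) (k3 y p q) ⟩
        deg Z U′ K y + (deg Z U K y + ref)  ≡⟨ eq₂ (deg Z U′ K y) (deg Z U K y) ref ⟩
        deg Z U′ K y + ref + deg Z U K y    ∎)
    ; inn = λ y e → ≤-trans (s≤s (less y)) (inn y e)
    ; tab = tab ; dle = λ e y → ≤-trans (less y) (dle e y) ; kh = kh }
    where
    open SI si
    open ≤-Reasoning
    eq : ∀ a b c → a + (b + c) ≡ b + (a + c)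
    eq = solve-∀
    eq₂ : ∀ a b c → a + (b + c) ≡ a + c + b
    eq₂ = solve-∀
    less : ∀ y → deg Z U′ K y ≤ deg Z U K y
    less y = #-mono {P = known Z U′ K y} (λ x e → known-in Z U K (known-Z Z U′ K e) (sub x (known-U Z U′ K e)) (known-K Z U′ K e))
    loss : ∀ y → # (Z ∩ U′) + deg Z U K y ≤ deg Z U′ K y + # (Z ∩ U)
    loss y = subst₂ _≤_ (sum-+ (b2n ∘ (Z ∩ U′)) (b2n ∘ known Z U K y)) (sum-+ (b2n ∘ known Z U′ K y) (b2n ∘ (Z ∩ U))) (sum-mono pw)
      where
      pw : ∀ x → b2n ((Z ∩ U′) x) + b2n (known Z U K y x) ≤ b2n (known Z U′ K y x) + b2n ((Z ∩ U) x)
      pw x with (Z ∩ U′) x in e₁ | known Z U K y x in e₂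
      ... | false | false = z≤n
      ... | false | true rewrite known-Z Z U K e₂ | known-U Z U K e₂ = m≤n+m 1 _
      ... | true | false rewrite ∧-l {Z x} e₁ | sub x (∧-r {Z x} e₁) = m≤n+m 1 _
      ... | true | true rewrite known-in Z U′ K {y} {x} (∧-l e₁) (∧-r {Z x} e₁) (known-K Z U K e₂) | ∧-l {Z x} e₁ | sub x (∧-r {Z x} e₁) = ≤-refl

module SmartT {n : ℕ} (MA MB : Mat n) (d : ℕ) (Z : Pr n) (pre : Bool) (lo hi h : ℕ)
              (w Cb E₀ T₀ : ℕ) (EP : Pr n → Mem n → ℕ) (Ok : Cfg n → Set)
              (hw : n ≤ w * lo) (hlo : lo ≤ hi) (hhi : lo + lo ≤ suc hi) (hh : pre ≡ true → n ≤ h) where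
  open Two MA MB
  open MachineL MA MB
  open StageL MA MB hiding (t; kp; c₁)
  open SmartInv MA MB Z pre hi h
  open Smart Z pre lo hi h

  P₀ : ℕ
  P₀ = n + T₀ + w * (# Z + (# Z + hi)) + E₀ + d * Cb

  InvE : Cfg n → Mem n → Set
  InvE (cfg zero S c par)    m = ⊤
  InvE (cfg (suc u) S c par) m = SI S (free S c (suc (suc u))) m

  -- Measured elements that cease to be free pay at rate `w` for full expansions, and the excess of
  -- `ref` over their number pays for the next refresh. `EP` pays for learning, and `Cb` per level
  -- for the elements at the cap.
  Pot : Cfg n → Mem n → ℕ
  Pot (cfg zero S c par)    m = P₀
  Pot (cfg (suc u) S c par) m = w * (# (Z ∩ free S c (suc (suc u))) + Mem.ref m) + EP S m + (d ∸ suc u) * Cb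

  open MachineT MA MB d (Mem n) (mem (λ _ → ∅) ∅ 0) smart InvE Pot Ok P₀

  -- Left abstract because the same learning is accounted for in two ways: by the capacity left, or
  -- by the elements that become light.
  Pays : Set
  Pays = ∀ u S c par K F ref ref′ K′ F′ → let U = free S c (suc (suc u)) in
    Ok (cfg (suc u) S c par) → (iS : A.Ind S) → B.Ind S → (U∉ : ∀ x → x ∈ U → x ∉ S) (dp : ∀ x → x ∈ U → A.Dep (S ⊕ x)) (si : SI S U (mem K F ref)) →
    RefreshL.RI MA MB Z S U hi h iS U∉ dp K (SI.kh si) (K′ , F′) →
    (1 + L) * edges K′ + EP S (mem K′ F′ ref′) ≤ (1 + L) * edges K + EP S (mem K F ref)

  Caps : Set
  Caps = ∀ S U m → A.Ind S → B.Ind S → SI S U m → # (λ x → U x ∧ (h ≤ᵇ # (Mem.K m x))) ≤ Cb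

  free-shrink : ∀ {u S c par c′} → StepRel (cfg u S c par) c′ → free S c′ (suc (suc u)) ⊆ free S c (suc u)
  free-shrink {u} {S} {c} {par} {c′} rel x e = free-in S c x∉ (lem (StepRel.outer rel x x∉))
    where
    x∉ : x ∉ S
    x∉ = free-∉ S c′ e
    lem : c′ x ≡ bumpX (suc u) S (lookup (spec (cfg u S c par))) c x → suc u ≤ c x
    lem eq with not (S x) ∧ (c x ≡ᵇ suc u) ∧ not (lookup (spec (cfg u S c par)) x) in q
    ... | true = ≤-reflexive (sym (≡ᵇ-t⁻ {c x} (∧-l (∧-r {not (S x)} q))))
    ... | false = ≤-trans (n≤1+n (suc u)) (subst (suc (suc u) ≤_) eq (free-≤ S c′ e))

  module Level (hpay : Pays) (hcap : Caps) {ℓ u S c par} (mi : MI ℓ (cfg (suc u) S c par)) (ok : Ok (cfg (suc u) S c par)) where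
    open MI mi
    t : ℕ
    t = suc (suc u)
    g : Cfg n
    g = cfg (suc u) S c par
    U Y : Pr n
    U = free S c t
    Y = at S c (suc u)

    private
      U∉ : ∀ x → x ∈ U → x ∉ S
      U∉ x = free-∉ S c
      dep : ∀ x → x ∈ U → A.Dep (S ⊕ x)
      dep x e = A.up (⊕-mono {P = geq S c 1} {S} (λ v → geq-S S c)) (n1 x (U∉ x e) 1 ≤-refl (≤-trans (s≤s (s≤s z≤n)) (free-≤ S c e)))

    edge-hit : ∀ {x y} → y ∈ Y → A.Ind (S ⊖ y ⊕ x) → A.Ind (geq S c t ⊕ x)
    edge-hit {x} {y} y∈ = A.down (⊕-mono {P = geq S c t} {S ⊖ y} (λ v e → ⊖-in S (geq-S S c e)
      (λ { refl → 1+n≰n (subst (t ≤_) (at-≡ S c y∈) (geq-≤ S c e)) })))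

    -- An edge of M₁ raises the label by at most one: for a larger label of `x`, `N1` has it spanned
    -- by labels at least `t`, all of which survive the removal of `y`.
    edge-lev : ∀ {x y} → x ∈ U → y ∈ Y → A.Ind (S ⊖ y ⊕ x) → c x ≡ t
    edge-lev {x} x∈ y∈ i with m≤n⇒m<n∨m≡n (free-≤ S c x∈)
    ... | inj₂ e = sym e
    ... | inj₁ lt = absurd (edge-hit y∈ i) (n1 x (U∉ x x∈) t (s≤s z≤n) lt)

    -- No query is made; the value that a bisection would return serves as the witness.
    hit-edge : ∀ {x} → x ∉ S → c x ≡ t → A.Ind (geq S c t ⊕ x) → ∃ λ y → y ∈ Y × A.Ind (S ⊖ y ⊕ x)
    hit-edge {x} x∉ cx i =
      let (y∈ , cy , ed) , _ = kick-spec {S} {c} {x} (suc u) x iA x∉ i (n1 x x∉ (suc u) (s≤s z≤n) (≤-reflexive (sym cx)))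
      in _ , at-in S c y∈ cy , ed

    Mid : Mem n → Mem n → ℕ → Set
    Mid m m′ k = SI S U m′ × (nonempty (Y ∖ Mem.F m′) ≡ true → ∃ λ y → y ∈ Y × lo ≤ deg Z U (Mem.K m′) y)
      × k + (w * (# (Z ∩ U) + Mem.ref m′) + EP S m′) ≤ w * (# (Z ∩ U) + Mem.ref m) + EP S m

    update-spec : ∀ m → SI S U m → wp (update S Y U m) (Mid m)
    update-spec m@(mem K F ref) si with nonempty (Y ∖ F) ∧ not (nonempty (hot Y U m)) in e
    ... | false = si , wit , ≤-refl
      where
      wit : nonempty (Y ∖ F) ≡ true → ∃ λ y → y ∈ Y × lo ≤ deg Z U K y
      wit p with ∧-cases-f {nonempty (Y ∖ F)} e
      ... | inj₁ q = absurd p q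
      ... | inj₂ q = let (y , y∈) = nonempty-t (hot Y U m) (not-ff q) in y , ∖-∈ Y F (∧-l y∈) , ≤ᵇ-t⁻ (∧-r {(Y ∖ F) y} y∈)
    ... | true = lem {val (refresh Z S U hi h m)} {cost (refresh Z S U hi h m)} (RefreshL.refresh-spec MA MB Z S U hi h iA U∉ dep K (SI.kh si) F ref)
      where
      open SI si
      open RefreshL MA MB Z S U hi h iA U∉ dep
      φ : ℕ
      φ = # (Z ∩ U)
      -- The heavy `y` had `hi` measured edges at the last refresh and has fewer than `lo` now. It
      -- has lost at least `hi + 1 ∸ lo`, hence at least `lo`, of them, and as many measured
      -- elements are gone.
      drop-ref : lo + φ ≤ ref
      drop-ref with nonempty-t (Y ∖ F) (∧-l {nonempty (Y ∖ F)} e)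
      ... | y , y∈ = ≤-pred (+-cancelˡ-≤ (deg Z U K y) _ _ (begin
              deg Z U K y + suc (lo + φ)    ≡⟨ eq (deg Z U K y) lo φ ⟩
              suc (deg Z U K y) + (lo + φ)  ≤⟨ +-monoˡ-≤ (lo + φ) cold ⟩
              lo + (lo + φ)                 ≡⟨ sym (+-assoc lo lo φ) ⟩
              lo + lo + φ                   ≤⟨ +-monoˡ-≤ φ hhi ⟩
              suc (hi + φ)                  ≤⟨ s≤s (k3 y (at-S S c (∖-∈ Y F y∈)) (∖-∉ Y F y∈)) ⟩
              suc (deg Z U K y + ref)       ≡⟨ sym (+-suc _ ref) ⟩
              deg Z U K y + suc ref         ∎))
        where
        open ≤-Reasoning
        eq : ∀ a b c → a + suc (b + c) ≡ suc a + (b + c)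
        eq = solve-∀
        cold : suc (deg Z U K y) ≤ lo
        cold = ≤ᵇ-f⁻ (¬true⇒false (λ q → absurd (∧-intro y∈ q) (nonempty-f (hot Y U m) (not-t (∧-r {nonempty (Y ∖ F)} e)) y)))
      lem : ∀ {m′ k} → RI K (SI.kh si) (Mem.K m′ , Mem.F m′) × (∀ x → x ∈ U → Done (Mem.K m′) (Mem.F m′) x)
            × Mem.ref m′ ≡ φ × k + (1 + L) * edges K ≤ # U + (1 + L) * edges (Mem.K m′) → Mid m m′ k
      lem {mem K′ F′ ref′} {k} (R , dn , refl , ct) = si′ , wit , +-cancelʳ-≤ ((1 + L) * edges K + (1 + L) * edges K′) _ _ (begin
          k + (w * (φ + φ) + EP′) + (e₀ + e₁)           ≡⟨ eq₁ k (w * (φ + φ)) EP′ e₀ e₁ ⟩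
          (k + e₀) + w * (φ + φ) + (e₁ + EP′)           ≤⟨ +-mono-≤ (+-monoˡ-≤ (w * (φ + φ)) (≤-trans ct (+-monoˡ-≤ e₁ (≤-trans (#≤n U) hw)))) pay ⟩
          (w * lo + e₁) + w * (φ + φ) + (e₀ + EP S m)   ≡⟨ eq₂ w lo φ e₀ e₁ (EP S m) ⟩
          w * (φ + (lo + φ)) + EP S m + (e₀ + e₁)       ≤⟨ +-monoˡ-≤ (e₀ + e₁) (+-monoˡ-≤ (EP S m) (*-monoʳ-≤ w (+-monoʳ-≤ φ drop-ref))) ⟩
          w * (φ + ref) + EP S m + (e₀ + e₁)            ∎)
        where
        open ≤-Reasoning
        EP′ = EP S (mem K′ F′ φ)
        e₀ = (1 + L) * edges K
        e₁ = (1 + L) * edges K′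
        eq₁ : ∀ k a p e f → k + (a + p) + (e + f) ≡ (k + e) + a + (f + p)
        eq₁ = solve-∀
        eq₂ : ∀ w l x e f p → (w * l + f) + w * (x + x) + (e + p) ≡ w * (x + (l + x)) + p + (e + f)
        eq₂ = solve-∀
        pay : e₁ + EP′ ≤ e₀ + EP S m
        pay = hpay u S c par K F ref φ K′ F′ ok iA iB U∉ dep si R
        degs : ∀ y → deg Z U K y ≤ deg Z U K′ y
        degs y = #-mono {P = known Z U K y} (λ x q → known-in Z U K′ (known-Z Z U K q) (known-U Z U K q) (RI.grow R x y (known-K Z U K q)))
        heavy′ : ∀ y → y ∈ S → y ∉ F′ → hi ≤ deg Z U K′ y
        heavy′ y p q with bool (light Z S U hi K y)
        ... | inj₁ r = RI.out R y r q
        ... | inj₂ r with ∧-cases-f {S y} r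
        ... | inj₁ s = absurd p s
        ... | inj₂ s = ≤-trans (≤-pred (≤ᵇ-f⁻ s)) (degs y)
        si′ : SI S U (mem K′ F′ φ)
        si′ = record
          { k1 = λ x y q → case bool (K x y) of λ
              { (inj₁ r) → k1 x y r
              ; (inj₂ r) → let (_ , y∈ , ed) = RI.new R x y q r in ∧-l y∈ , ed }
          ; k2 = dn
          ; f⊆ = λ y q → ∧-l (RI.F⊆ R y q)
          ; k3 = λ y p q → +-monoˡ-≤ φ (heavy′ y p q)
          ; inn = RI.inn R
          ; tab = λ p x y x∈ x∉ y∈ ed → RI.grow R x y (tab p x y x∈ x∉ y∈ ed)
          ; dle = λ p y → RI.le R y (dle p y)
          ; kh = RI.kh R }
        wit : nonempty (Y ∖ F′) ≡ true → ∃ λ y → y ∈ Y × lo ≤ deg Z U K′ y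
        wit p with nonempty-t (Y ∖ F′) p
        ... | y , y∈ = y , ∖-∈ Y F′ y∈ , ≤-trans hlo (heavy′ y (at-S S c (∖-∈ Y F′ y∈)) (∖-∉ Y F′ y∈))

    module _ (m : Mem n) (si : SI S U m) where
      open Mem m
      open SI si

      f : Fin n → Q n Bool
      f = decide S c t Y m

      easy : Bool
      easy = not (nonempty (Y ∖ F))

      table-right : easy ≡ true → ∀ v → v ∉ S → c v ≡ t → # (K v) < h → nonempty (K v ∩ Y) ≡ A.ind (geq S c t ⊕ v)
      table-right ez v v∉ cv lt with A.ind (geq S c t ⊕ v) in ei
      ... | true = let (y , y∈ , ed) = hit-edge v∉ cv ei in nonempty-in (K v ∩ Y) y
              (∧-intro (case k2 v (free-in S c v∉ (≤-reflexive (sym cv))) of λ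
                { (inj₁ q) → ⊥-elim (<⇒≱ lt q)
                ; (inj₂ q) → q y (inF y y∈) ed }) y∈)
        where
        inF : ∀ y → y ∈ Y → y ∈ F
        inF y y∈ with bool (F y)
        ... | inj₁ q = q
        ... | inj₂ q = absurd (∖-in Y F y∈ q) (nonempty-f (Y ∖ F) (not-t ez) y)
      ... | false = ¬true⇒false λ q → let (y , y∈) = nonempty-t (K v ∩ Y) q in
              absurd (edge-hit (∧-r {K v y} y∈) (proj₂ (k1 v y (∧-l y∈)))) ei

      val-f : ∀ v → val (f v) ≡ not (S v) ∧ (c v ≡ᵇ t) ∧ A.ind (geq S c t ⊕ v)
      val-f v with S v in eS | c v ≡ᵇ t in ec
      ... | true | _ = refl
      ... | false | false = refl
      ... | false | true with nonempty (Y ∖ F) in eN | h ≤ᵇ # (K v) in eh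
      ... | true | _ = refl
      ... | false | true = refl
      ... | false | false = table-right (cong not eN) v eS (≡ᵇ-t⁻ {c v} ec) (≤ᵇ-f⁻ eh)

      cost-f : ∀ v → cost (f v) ≤ 1
      cost-f v with candidate S c t v
      ... | false = z≤n
      ... | true with not (nonempty (Y ∖ F)) ∧ not (h ≤ᵇ # (K v))
      ... | true = z≤n
      ... | false = ≤-refl

      cost-easy : easy ≡ true → ∀ v → cost (f v) ≤ b2n (U v ∧ (h ≤ᵇ # (K v)))
      cost-easy ez v with candidate S c t v in ec
      ... | false = z≤n
      ... | true with nonempty (Y ∖ F) | h ≤ᵇ # (K v) | ez
      ... | false | false | _ = z≤n
      ... | false | true | _ rewrite free-in S c {t} {v} (not-t (∧-l ec)) (≤-reflexive (sym (≡ᵇ-t⁻ {c v} (∧-r {not (S v)} ec)))) = ≤-refl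

      kp≡ : val (travQ f) ≡ spec g
      kp≡ = trans (val-trav f) (tabulate-cong val-f)

      k₂ : ℕ
      k₂ = cost (travQ f)

      k₂≤n : k₂ ≤ n
      k₂≤n = ≤-trans (≤-reflexive (cost-trav f)) (≤-trans (sum-mono cost-f) (≤-reflexive (trans (sum-const {n} 1) (*-identityʳ n))))

      -- On a level of light elements only candidates at the cap are queried. Otherwise some `y` of
      -- the level has `lo` measured free out-neighbours; the expansion reaches all of them, so they
      -- cease to be free and pay `w * lo ≥ n`.
      decide-cost : (nonempty (Y ∖ F) ≡ true → ∃ λ y → y ∈ Y × lo ≤ deg Z U K y) → ∀ c′ → StepRel g c′ →
                    k₂ + w * (# (Z ∩ free S c′ (suc t)) + ref) ≤ w * (# (Z ∩ U) + ref) + Cb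
      decide-cost wit c′ rel with bool (nonempty (Y ∖ F))
      ... | inj₂ eN = ≤-trans (≤-reflexive (+-comm k₂ _)) (+-mono-≤
              (*-monoʳ-≤ w (+-monoˡ-≤ ref (#-mono {P = Z ∩ free S c′ (suc t)} (λ x e → ∧-intro (∧-l e) (free-shrink rel x (∧-r {Z x} e))))))
              (≤-trans (≤-reflexive (cost-trav f)) (≤-trans (sum-mono (cost-easy (cong not eN))) (hcap S U m iA iB si))))
      ... | inj₁ eN with wit eN
      ... | y , y∈ , le = ≤-trans (+-monoˡ-≤ (w * (φ′ + ref)) (≤-trans k₂≤n (≤-trans hw (*-monoʳ-≤ w le))))
              (≤-trans (≤-reflexive (eq w (deg Z U K y) φ′ ref)) (≤-trans (*-monoʳ-≤ w (+-monoˡ-≤ ref gone)) (m≤m+n _ Cb)))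
        where
        φ′ = # (Z ∩ free S c′ (suc t))
        eq : ∀ w a b c → w * a + w * (b + c) ≡ w * (b + a + c)
        eq = solve-∀
        gone : φ′ + deg Z U K y ≤ # (Z ∩ U)
        gone = #-⊎ {P = Z ∩ free S c′ (suc t)} {known Z U K y} {Z ∩ U}
          (λ x e → ∧-intro (∧-l e) (free-shrink rel x (∧-r {Z x} e)))
          (λ x e → ∧-intro (known-Z Z U K e) (known-U Z U K e))
          (λ x e e′ → visited x (known-U Z U K e′) (proj₂ (k1 x y (known-K Z U K e′))) (free-≤ S c′ (∧-r {Z x} e)))
          where
          visited : ∀ x → x ∈ U → A.Ind (S ⊖ y ⊕ x) → ¬ (suc t ≤ c′ x)
          visited x x∈ ed le with StepRel.outer rel x (U∉ x x∈)
          ... | e rewrite U∉ x x∈ | trans (lookup∘tabulate (λ v → not (S v) ∧ (c v ≡ᵇ t) ∧ A.ind (geq S c t ⊕ v)) x)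
                   (∧-intro (not-f (U∉ x x∈)) (∧-intro (≡ᵇ-t (edge-lev x∈ y∈ ed)) (edge-hit y∈ ed)))
                   | ≡ᵇ-t (edge-lev x∈ y∈ ed) = 1+n≰n (subst (suc t ≤_) (trans e (edge-lev x∈ y∈ ed)) le)

  module _ (hpay : Pays) (hcap : Caps) (hE : ∀ S K ref → A.Ind S → B.Ind S → EP S (mem K ∅ ref) ≤ E₀)
           (hT : ∀ S → A.Ind S → B.Ind S → pre ≡ true → # Z * # S ≤ T₀) where

    smart-spec : ∀ ℓ g st → Cfg.lev g < d → MI ℓ g → Ok g → InvE g st → wp (smart g st) (ExpandPost g st)
    smart-spec ℓ g@(cfg (suc u) S c par) m u<d mi ok si =
      wp->>= (update S Y U m) (λ m′ → travQ (decide S c t Y m′) >>= λ kp → ret (kp , m′)) (ExpandPost g m)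
        (main (val (update S Y U m)) (cost (update S Y U m)) (update-spec m si))
      where
      open Level hpay hcap mi ok hiding (g)
      main : ∀ m′ k → Mid m m′ k → wp (travQ (decide S c t Y m′) >>= λ kp → ret (kp , m′)) (λ r k′ → ExpandPost g m r (k + k′))
      main m′ k (si′ , wit , pays) = wp->>= (travQ (decide S c t Y m′)) (λ kp → ret (kp , m′)) (λ r k′ → ExpandPost g m r (k + k′))
          ( kp≡ m′ si′
          , (λ c′ par′ rel → shrink (free-shrink rel) si′ , bound c′ rel)
          , (λ S′ c′ par′ _ → tt , +-monoˡ-≤ P₀ (≤-trans (m≤m+n (k + (k₃ + 0)) _) (bound c₂ rel₂))))
        where
        open ≤-Reasoning
        k₃ = cost (travQ (decide S c t Y m′))
        -- For the augmenting outcome the cost is bounded through a fictitious move to these labels,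
        -- after which `P₀` restores the potential.
        c₂ : Lab n
        c₂ = bumpX t S (lookup (spec g)) c
        rel₂ : StepRel g c₂
        rel₂ = record { outer = λ _ _ → refl ; inner = λ y y∈ → inj₁ (inn₂ y y∈) }
          where
          inn₂ : ∀ y → y ∈ S → c₂ y ≡ c y
          inn₂ y y∈ rewrite y∈ = refl
        bound : ∀ c′ → StepRel g c′ → k + (k₃ + 0) + (w * (# (Z ∩ free S c′ (suc t)) + Mem.ref m′) + EP S m′ + (d ∸ t) * Cb)
                ≤ w * (# (Z ∩ U) + Mem.ref m) + EP S m + (d ∸ suc u) * Cb
        bound c′ rel = begin
          k + (k₃ + 0) + (a′ + EP S m′ + (d ∸ t) * Cb)                    ≡⟨ eq k k₃ a′ (EP S m′) ((d ∸ t) * Cb) ⟩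
          k + ((k₃ + a′) + EP S m′) + (d ∸ t) * Cb                        ≤⟨ +-monoˡ-≤ _ (+-monoʳ-≤ k (+-monoˡ-≤ (EP S m′) (decide-cost m′ si′ wit c′ rel))) ⟩
          k + ((a₁ + Cb) + EP S m′) + (d ∸ t) * Cb                        ≡⟨ eq₂ k a₁ Cb (EP S m′) ((d ∸ t) * Cb) ⟩
          k + (a₁ + EP S m′) + (Cb + (d ∸ t) * Cb)                        ≤⟨ +-mono-≤ pays (≤-reflexive (cong (_* Cb) (sym (+-∸-assoc 1 u<d)))) ⟩
          w * (# (Z ∩ U) + Mem.ref m) + EP S m + (d ∸ suc u) * Cb         ∎
          where
          a′ = w * (# (Z ∩ free S c′ (suc t)) + Mem.ref m′)
          a₁ = w * (# (Z ∩ U) + Mem.ref m′)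
          eq : ∀ k k₃ a e x → k + (k₃ + 0) + (a + e + x) ≡ k + ((k₃ + a) + e) + x
          eq = solve-∀
          eq₂ : ∀ k a b e x → k + ((a + b) + e) + x ≡ k + (a + e) + (b + x)
          eq₂ = solve-∀
    smart-spec ℓ g@(cfg zero S c par) m u<d mi ok _ = wp->>= (travQ f) _ (ExpandPost g m)
        (wp->>= tabQ (λ tb → ret (val (travQ f) , st′ tb)) (λ r k → ExpandPost g m r (cost (travQ f) + k))
          (kp≡ , (λ c′ par′ rel → si c′ , bound c′ par′) , (λ S′ c′ par′ _ → tt , +-monoˡ-≤ P₀ (≤-trans (m≤m+n (cost (travQ f) + (cost tabQ + 0)) _) (bound c par)))))
      where
      open MI mi
      f : Fin n → Q n Bool
      f v = if candidate S c 1 v then test M₁ (geq S c 1 ⊕ v) else ret false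
      tabQ′ : Bool → Q n (Vec (Vec Bool n) n)
      tabQ′ b = if b then table Z S else ret (tabulate (λ _ → tabulate ∅))
      tabQ : Q n (Vec (Vec Bool n) n)
      tabQ = tabQ′ pre
      K : Vec (Vec Bool n) n → Fin n → Pr n
      K tb x y = lookup (lookup tb x) y
      st′ : Vec (Vec Bool n) n → Mem n
      st′ tb = mem (K tb) ∅ (# Z + hi)
      kp≡ : val (travQ f) ≡ spec g
      kp≡ = trans (val-trav f) (tabulate-cong val-f)
        where
        val-f : ∀ v → val (f v) ≡ not (S v) ∧ (c v ≡ᵇ 1) ∧ A.ind (geq S c 1 ⊕ v)
        val-f v with not (S v) | c v ≡ᵇ 1
        ... | false | _ = refl
        ... | true | false = refl
        ... | true | true = refl
      kf≤n : cost (travQ f) ≤ n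
      kf≤n = ≤-trans (≤-reflexive (cost-trav f)) (≤-trans (sum-mono {g = λ _ → 1} cf) (≤-reflexive (trans (sum-const {n} 1) (*-identityʳ n))))
        where
        cf : ∀ v → cost (f v) ≤ 1
        cf v with candidate S c 1 v
        ... | true = ≤-refl
        ... | false = z≤n
      tb = val tabQ
      row : Fin n → Q n (Vec Bool n)
      row x = if Z x ∧ not (S x) then travQ (λ y → if S y then test M₁ (S ⊖ y ⊕ x) else ret false) else ret (tabulate ∅)
      entry : Fin n → Fin n → Bool
      entry x y = pre ∧ (Z x ∧ not (S x)) ∧ S y ∧ A.ind (S ⊖ y ⊕ x)
      tb-val : ∀ b x y → K (val (tabQ′ b)) x y ≡ b ∧ (Z x ∧ not (S x)) ∧ S y ∧ A.ind (S ⊖ y ⊕ x)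
      tb-val false x y = trans (cong (λ r → lookup r y) (lookup∘tabulate (λ _ → tabulate ∅) x)) (lookup∘tabulate ∅ y)
      tb-val true x y = trans (cong (λ T → lookup (lookup T x) y) (val-trav row)) (trans (cong (λ r → lookup r y) (lookup∘tabulate (λ x → val (row x)) x)) (rw x y))
        where
        rw : ∀ x y → lookup (val (row x)) y ≡ (Z x ∧ not (S x)) ∧ S y ∧ A.ind (S ⊖ y ⊕ x)
        rw x y with Z x ∧ not (S x)
        ... | false = lookup∘tabulate ∅ y
        ... | true = trans (cong (λ r → lookup r y) (val-trav (λ y → if S y then test M₁ (S ⊖ y ⊕ x) else ret false)))
                (trans (lookup∘tabulate _ y) (cell y))
          where
          cell : ∀ y → val (if S y then test M₁ (S ⊖ y ⊕ x) else ret false) ≡ S y ∧ A.ind (S ⊖ y ⊕ x)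
          cell y with S y
          ... | true = refl
          ... | false = refl
      tb-cost : ∀ b → (b ≡ true → # Z * # S ≤ T₀) → cost (tabQ′ b) ≤ T₀
      tb-cost false _ = z≤n
      tb-cost true hb = ≤-trans (≤-reflexive (cost-trav row)) (≤-trans (sum-mono {g = λ x → # S * b2n (Z x)} cr)
              (≤-trans (≤-reflexive (trans (sum-* (# S) (λ x → b2n (Z x))) (*-comm (# S) (# Z)))) (hb refl)))
        where
        cell : ∀ x y → cost (if S y then test M₁ (S ⊖ y ⊕ x) else ret false) ≡ b2n (S y)
        cell x y with S y
        ... | true = refl
        ... | false = refl
        cr : ∀ x → cost (row x) ≤ # S * b2n (Z x)
        cr x with Z x | not (S x)
        ... | false | _ = z≤n
        ... | true | false = z≤n
        ... | true | true = ≤-reflexive (trans (cost-trav (λ y → if S y then test M₁ (S ⊖ y ⊕ x) else ret false))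
                (trans (sum-cong (cell x)) (sym (*-identityʳ _))))
      k1′ : ∀ x y → y ∈ K tb x → pre ≡ true × y ∈ S × A.Ind (S ⊖ y ⊕ x)
      k1′ x y e = ∧-l e′ , ∧-l e″ , ∧-r {S y} e″
        where
        e′ : entry x y ≡ true
        e′ = trans (sym (tb-val pre x y)) e
        e″ : S y ∧ A.ind (S ⊖ y ⊕ x) ≡ true
        e″ = ∧-r {Z x ∧ not (S x)} (∧-r {pre} e′)
      si : ∀ c′ → SI S (free S c′ 2) (st′ tb)
      si c′ = record
        { k1 = λ x y e → proj₂ (k1′ x y e)
        ; k2 = λ x _ → inj₂ (λ y ())
        ; f⊆ = λ _ ()
        ; k3 = λ y _ _ → ≤-trans (≤-trans (+-monoʳ-≤ hi (#-mono {P = Z ∩ free S c′ 2} {Z} (λ x → ∧-l))) (≤-reflexive (+-comm hi (# Z)))) (m≤n+m (# Z + hi) (deg Z (free S c′ 2) (K tb) y))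
        ; inn = λ _ ()
        ; tab = λ p x y x∈ x∉ y∈ ed → trans (tb-val pre x y) (∧-intro p (∧-intro (∧-intro x∈ (not-f x∉)) (∧-intro y∈ ed)))
        ; dle = λ p y → ≤-trans (#-mono {P = known Z (free S c′ 2) (K tb) y} {∅} (λ x e →
                  absurd (proj₁ (k1′ x y (known-K Z (free S c′ 2) (K tb) e))) p)) (≤-trans (≤-reflexive (#-∅ {n})) z≤n)
        ; kh = kh′ }
        where
        kh′ : ∀ x → # (K tb x) ≤ h
        kh′ x with bool pre
        ... | inj₁ p = ≤-trans (#≤n (K tb x)) (hh p)
        ... | inj₂ p = ≤-trans (#-mono {P = K tb x} {∅} (λ y e → absurd (proj₁ (k1′ x y e)) p)) (≤-trans (≤-reflexive (#-∅ {n})) z≤n)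
      bound : ∀ c′ par′ → cost (travQ f) + (cost tabQ + 0) + Pot (cfg 1 S c′ par′) (st′ tb) ≤ P₀
      bound c′ par′ = ≤-trans (+-mono-≤ (+-mono-≤ kf≤n (≤-trans (≤-reflexive (+-identityʳ _)) (tb-cost pre (hT S iA iB))))
          (+-mono-≤ (+-mono-≤ (*-monoʳ-≤ w (+-monoˡ-≤ (# Z + hi) (#-mono {P = Z ∩ free S c′ 2} {Z} (λ x → ∧-l)))) (hE S (K tb) _ iA iB))
            (*-monoˡ-≤ Cb (m∸n≤m d 1))))
        (≤-reflexive (eq n T₀ (w * (# Z + (# Z + hi))) E₀ (d * Cb)))
        where
        eq : ∀ a b c e f → a + b + (c + e + f) ≡ a + b + c + e + f
        eq = solve-∀

    smart-mach : ∀ f {ℓ} S c par → (∀ i → i < f → Ok (iter next i (cfg 0 S c par))) → MI ℓ (cfg 0 S c par) →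
                 (n ∸ # S) * suc d + d ≤ f → wp (Machine.mach (Mem n) (mem (λ _ → ∅) ∅ 0) smart f d (cfg 0 S c par) (mem (λ _ → ∅) ∅ 0))
                 (MachPost (cfg 0 S c par) (mem (λ _ → ∅) ∅ 0))
    smart-mach f S c par ok mi le = mach-spec smart-spec f (cfg 0 S c par) _ ok mi tt le

-- Every element learns at most h edges, so learning is paid for by the capacity left.
module CapT {n : ℕ} (MA MB : Mat n) (d : ℕ) (Z : Pr n) (pre : Bool) (lo hi h w Cb T₀ : ℕ)
            (hw : n ≤ w * lo) (hlo : lo ≤ hi) (hhi : lo + lo ≤ suc hi) (hh : pre ≡ true → n ≤ h) where
  open Two MA MB
  open SmartInv MA MB Z pre hi h

  EP : Pr n → Mem n → ℕ
  EP S m = (1 + L) * (n * h ∸ edges (Mem.K m))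

  open SmartT MA MB d Z pre lo hi h w Cb ((1 + L) * (n * h)) T₀ EP (λ _ → ⊤) hw hlo hhi hh public

  pays : Pays
  pays u S c par K F ref ref′ K′ F′ _ iS _ U∉ dp si R = ≤-reflexive (trans (split (edges≤ K′ (RI.kh R))) (sym (split (edges≤ K (SI.kh si)))))
    where
    open RefreshL MA MB Z S (free S c (suc (suc u))) hi h iS U∉ dp
    edges≤ : ∀ (K : Fin n → Pr n) → (∀ x → # (K x) ≤ h) → edges K ≤ n * h
    edges≤ K kh = ≤-trans (sum-mono kh) (≤-reflexive (sum-const {n} h))
    split : ∀ {e} → e ≤ n * h → (1 + L) * e + (1 + L) * (n * h ∸ e) ≡ (1 + L) * (n * h)
    split {e} le = trans (sym (*-distribˡ-+ (1 + L) e _)) (cong ((1 + L) *_) (m+[n∸m]≡n le))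

  start≤ : ∀ S K ref → A.Ind S → B.Ind S → EP S (mem K ∅ ref) ≤ (1 + L) * (n * h)
  start≤ S K ref _ _ = *-monoʳ-≤ (1 + L) (m∸n≤m (n * h) (edges K))

-- Accounting with edge caps.

module DetMode {n : ℕ} (MA MB : Mat n) (d D H w R₀ Cb : ℕ) (H≥1 : 1 ≤ H)
               (hw : n ≤ w * D) (hC : 2 * D * R₀ ≤ Cb * H)
               (hR : ∀ S → Mat.ind MA S ≡ true → Mat.ind MB S ≡ true → # S ≤ R₀) where
  open Two MA MB
  open SmartInv MA MB full false (2 * D) H
  open CapT MA MB d full false D (2 * D) H w Cb 0
    hw (m≤m+n D _) (≤-trans (+-monoʳ-≤ D (m≤m+n D 0)) (n≤1+n _)) (λ ()) public

  -- Double counting of recorded edges: an element at the cap holds `H` of them, and each element of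
  -- `S` is the source of at most `2 * D` into `U`.
  caps : Caps
  caps S U (mem K F ref) iA iB si = *-cancelʳ-≤ _ _ H {{>-nonZero H≥1}} (≤-trans lem hC)
    where
    open SI si
    open ≤-Reasoning
    lem : # (λ x → U x ∧ (H ≤ᵇ # (K x))) * H ≤ 2 * D * R₀
    lem = begin
      # (λ x → U x ∧ (H ≤ᵇ # (K x))) * H                   ≡⟨ *-comm _ H ⟩
      H * # (λ x → U x ∧ (H ≤ᵇ # (K x)))                   ≡⟨ sym (sum-* H (λ x → b2n (U x ∧ (H ≤ᵇ # (K x))))) ⟩
      sumF (λ x → H * b2n (U x ∧ (H ≤ᵇ # (K x))))          ≤⟨ sum-mono full-row ⟩
      sumF (λ x → sumF (λ y → b2n (known full U K y x)))   ≡⟨ sum-swap (λ x y → b2n (known full U K y x)) ⟩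
      sumF (λ y → deg full U K y)                          ≤⟨ sum-mono col ⟩
      sumF (λ y → 2 * D * b2n (S y))                       ≡⟨ sum-* (2 * D) (λ y → b2n (S y)) ⟩
      2 * D * # S                                          ≤⟨ *-monoʳ-≤ (2 * D) (hR S iA iB) ⟩
      2 * D * R₀                                           ∎
      where
      full-row : ∀ x → H * b2n (U x ∧ (H ≤ᵇ # (K x))) ≤ sumF (λ y → b2n (known full U K y x))
      full-row x with U x in eU | H ≤ᵇ # (K x) in eh
      ... | false | _ = ≤-trans (≤-reflexive (*-zeroʳ H)) z≤n
      ... | true | false = ≤-trans (≤-reflexive (*-zeroʳ H)) z≤n
      ... | true | true = ≤-trans (≤-reflexive (*-identityʳ H)) (≤-trans (≤ᵇ-t⁻ eh)
              (sum-mono (λ y → b2n-mono {K x y} {known full U K y x} (λ e → known-in full U K refl eU e))))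
      col : ∀ y → deg full U K y ≤ 2 * D * b2n (S y)
      col y with S y in eS
      ... | true = ≤-trans (dle refl y) (≤-reflexive (sym (*-identityʳ _)))
      ... | false = ≤-trans (#-mono {P = known full U K y} {∅} (λ x e → absurd (proj₁ (k1 x y (known-K full U K e))) eS))
              (≤-trans (≤-reflexive (#-∅ {n})) z≤n)

  det-mach = smart-mach pays caps start≤ (λ S _ _ ())

-- Accounting with a sample.

module _ {n : ℕ} (MA MB : Mat n) where
  open Two MA MB

  outs : Cfg n → Fin n → Pr n
  outs (cfg u S c par) y x = free S c (suc u) x ∧ A.ind (S ⊖ y ⊕ x)

  -- The good event: y without a sampled out-neighbour has at most D of them.
  Hit : Pr n → ℕ → Cfg n → Set
  Hit Z D g = ∀ y → y ∈ Cfg.S g → (∀ x → x ∈ Z → x ∉ outs g y) → # (outs g y) ≤ D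

-- The cap `n + 1` is out of reach, which is how the randomized mode switches caps off.
cap-none : ∀ {n} (U : Pr n) (K : Fin n → Pr n) → # (λ x → U x ∧ (suc n ≤ᵇ # (K x))) ≤ 0
cap-none {n} U K = ≤-trans (#-mono {P = λ x → U x ∧ (suc n ≤ᵇ # (K x))} {∅} (λ x e →
  ⊥-elim (<⇒≱ (≤ᵇ-t⁻ {suc n} {# (K x)} (∧-r {U x} e)) (#≤n (K x))))) (≤-reflexive (#-∅ {n}))

-- Bookkeeping valid for every sample, which gives correctness of the output on every seed.
module SafeMode {n : ℕ} (MA MB : Mat n) (d : ℕ) (Z : Pr n) (R₀ : ℕ)
                (hR : ∀ S → Mat.ind MA S ≡ true → Mat.ind MB S ≡ true → # S ≤ R₀) where
  open CapT MA MB d Z true 1 1 (suc n) n 0 (# Z * R₀)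
    (≤-reflexive (sym (*-identityʳ n))) ≤-refl ≤-refl (λ _ → n≤1+n n) public

  safe-mach = smart-mach pays (λ S U m _ _ _ → cap-none U (Mem.K m)) start≤ (λ S iA iB _ → *-monoʳ-≤ (# Z) (hR S iA iB))

module RandMode {n : ℕ} (MA MB : Mat n) (d D : ℕ) (Z : Pr n) (R₀ : ℕ)
                (hR : ∀ S → Mat.ind MA S ≡ true → Mat.ind MB S ≡ true → # S ≤ R₀) where
  open Two MA MB
  open SmartInv MA MB Z true 1 (suc n)

  -- Within one search an element of `S` that is light at a refresh stays light. It brings at most
  -- `D` edges when it becomes so, and these are reserved for each element not yet in `F`.
  EP : Pr n → Mem n → ℕ
  EP S m = (1 + L) * (D * # (S ∖ Mem.F m))

  open SmartT MA MB d Z true 1 1 (suc n) n 0 ((1 + L) * (D * R₀)) (# Z * R₀) EP (Hit MA MB Z D)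
    (≤-reflexive (sym (*-identityʳ n))) ≤-refl ≤-refl (λ _ → n≤1+n n) public

  pays : Pays
  pays u S c par K F ref ref′ K′ F′ ok iS iB U∉ dp si R = begin
    (1 + L) * edges K′ + (1 + L) * (D * # (S ∖ F′))     ≡⟨ sym (*-distribˡ-+ (1 + L) (edges K′) _) ⟩
    (1 + L) * (edges K′ + D * # (S ∖ F′))               ≤⟨ *-monoʳ-≤ (1 + L) main ⟩
    (1 + L) * (edges K + D * # (S ∖ F))                 ≡⟨ *-distribˡ-+ (1 + L) (edges K) _ ⟩
    (1 + L) * edges K + (1 + L) * (D * # (S ∖ F))       ∎
    where
    open ≤-Reasoning
    open SI si
    U : Pr n
    U = free S c (suc (suc u))
    open RefreshL MA MB Z S U 1 (suc n) iS U∉ dp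
    g : Cfg n
    g = cfg (suc u) S c par
    G : Pr n
    G = light Z S U 1 K
    -- With threshold 1, light means to have no sampled free out-neighbour, because the table holds
    -- every edge into the sample.
    unsampled : ∀ {x y} → y ∈ G → x ∈ Z → x ∈ U → Edge y x → ⊥
    unsampled {x} {y} y∈ x∈Z x∈U ed = 1+n≰n (≤-trans (≤ᵇ-t⁻ (∧-r {S y} y∈))
      (≤-trans (≤-reflexive (sym (cong b2n (known-in Z U K x∈Z x∈U (tab refl x y x∈Z (U∉ x x∈U) (∧-l y∈) ed)))))
        (sum-point (λ z → b2n (known Z U K y z)) x)))
    outs≤ : ∀ y → y ∈ G → # (outs MA MB g y) ≤ D
    outs≤ y y∈ = ok y (∧-l y∈) (λ x x∈ → ¬true⇒false (λ e → unsampled y∈ x∈ (∧-l e) (∧-r {U x} e)))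
    G⊆F′ : G ⊆ F′
    G⊆F′ y y∈ with bool (F′ y)
    ... | inj₁ e = e
    ... | inj₂ e with pick (known Z U K′ y) (RI.out R y y∈ e)
    ... | x , x∈ = ⊥-elim (unsampled y∈ (known-Z Z U K′ x∈) (known-U Z U K′ x∈) ed)
      where
      ed : Edge y x
      ed with bool (K x y)
      ... | inj₁ q = proj₂ (k1 x y q)
      ... | inj₂ q = proj₂ (proj₂ (RI.new R x y (known-K Z U K′ x∈) q))
    F⊆G : F ⊆ G
    F⊆G y y∈ = ∧-intro (f⊆ y y∈) (≤ᵇ-t (inn y y∈))
    fresh : Fin n → Pr n
    fresh x y = K′ x y ∧ not (K x y)
    fresh-in : ∀ x y → y ∈ fresh x → y ∈ G ∖ F × x ∈ outs MA MB g y
    -- Edges out of `F` were recorded at an earlier refresh, so a new edge must come from an element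
    -- that has just become light.
    fresh-in x y e with RI.new R x y (∧-l e) (not-t (∧-r {K′ x y} e))
    ... | x∈ , y∈ , ed = ∖-in G F y∈ (¬true⇒false old) , ∧-intro x∈ ed
      where
      old : ¬ (y ∈ F)
      old q with k2 x x∈
      ... | inj₁ le = <⇒≱ le (#≤n (K x))
      ... | inj₂ h = absurd (h y q ed) (not-t (∧-r {K′ x y} e))
    edges-new : edges K′ ≤ edges K + D * # (G ∖ F)
    edges-new = begin
      edges K′                                                ≤⟨ sum-mono (λ x → #-∪ {P = K x} {fresh x} {K′ x} (cases x)) ⟩
      sumF (λ x → # (K x) + # (fresh x))                      ≡⟨ sum-+ (λ x → # (K x)) (λ x → # (fresh x)) ⟩
      edges K + sumF (λ x → # (fresh x))                      ≡⟨ cong (edges K +_) (sum-swap (λ x y → b2n (fresh x y))) ⟩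
      edges K + sumF (λ y → sumF (λ x → b2n (fresh x y)))     ≤⟨ +-monoʳ-≤ (edges K) (sum-mono col) ⟩
      edges K + sumF (λ y → D * b2n ((G ∖ F) y))              ≡⟨ cong (edges K +_) (sum-* D (λ y → b2n ((G ∖ F) y))) ⟩
      edges K + D * # (G ∖ F)                                 ∎
      where
      cases : ∀ x y → y ∈ K′ x → (y ∈ K x) ⊎ (y ∈ fresh x)
      cases x y e with bool (K x y)
      ... | inj₁ q = inj₁ q
      ... | inj₂ q = inj₂ (∧-intro e (not-f q))
      col : ∀ y → sumF (λ x → b2n (fresh x y)) ≤ D * b2n ((G ∖ F) y)
      col y with bool ((G ∖ F) y)
      ... | inj₁ e = ≤-trans (sum-mono (λ x → b2n-mono {fresh x y} {outs MA MB g y x} (λ q → proj₂ (fresh-in x y q))))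
              (≤-trans (outs≤ y (∖-∈ G F e)) (≤-reflexive (sym (trans (cong (λ b → D * b2n b) e) (*-identityʳ D)))))
      ... | inj₂ e = ≤-trans (sum-mono (λ x → b2n-mono {fresh x y} {false} (λ q → absurd (proj₁ (fresh-in x y q)) e)))
              (≤-trans (≤-reflexive (#-∅ {n})) z≤n)
    main : edges K′ + D * # (S ∖ F′) ≤ edges K + D * # (S ∖ F)
    main = begin
      edges K′ + D * # (S ∖ F′)                         ≤⟨ +-monoˡ-≤ _ edges-new ⟩
      edges K + D * # (G ∖ F) + D * # (S ∖ F′)          ≡⟨ +-assoc (edges K) _ _ ⟩
      edges K + (D * # (G ∖ F) + D * # (S ∖ F′))        ≡⟨ cong (edges K +_) (sym (*-distribˡ-+ D (# (G ∖ F)) _)) ⟩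
      edges K + D * (# (G ∖ F) + # (S ∖ F′))            ≤⟨ +-monoʳ-≤ (edges K) (*-monoʳ-≤ D (#-⊎ {P = G ∖ F} {S ∖ F′} {S ∖ F}
          (λ y e → ∖-in S F (∧-l (∖-∈ G F e)) (∖-∉ G F e))
          (λ y e → ∖-in S F (∖-∈ S F′ e) (¬true⇒false (λ q → absurd (G⊆F′ y (F⊆G y q)) (∖-∉ S F′ e))))
          (λ y p q → absurd (G⊆F′ y (∖-∈ G F p)) (∖-∉ S F′ q)))) ⟩
      edges K + D * # (S ∖ F)                           ∎

  rand-mach = smart-mach pays (λ S U m _ _ _ → cap-none U (Mem.K m))
    (λ S K ref iA iB → *-monoʳ-≤ (1 + L) (*-monoʳ-≤ D (≤-trans (#-mono {P = S ∖ ∅} {S} (λ y → ∖-∈ S ∅)) (hR S iA iB))))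
    (λ S iA iB _ → *-monoʳ-≤ (# Z) (hR S iA iB))

-- Running times

-- n / T for T ≥ 1, without a NonZero instance.
quot : ℕ → ℕ → ℕ
quot n T = n / suc (T ∸ 1)

quot-≤ : ∀ n T → 1 ≤ T → quot n T * T ≤ n
quot-≤ n (suc T) _ = m/n*n≤m n (suc T)

quot-> : ∀ n T → 1 ≤ T → n ≤ suc (quot n T) * T
quot-> n (suc T) _ = ≤-trans (≤-reflexive (m≡m%n+[m/n]*n n (suc T))) (+-monoˡ-≤ _ (<⇒≤ (m%n<n n (suc T))))

rootFrom : ℕ → ℕ → ℕ → ℕ → ℕ
rootFrom e x zero    a = a
rootFrom e x (suc f) a = if x ≤ᵇ a ^ e then a else rootFrom e x f (suc a)

root : ℕ → ℕ → ℕ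
root e x = rootFrom e x x 1

^-distribʳ-* : ∀ e a b → (a * b) ^ e ≡ a ^ e * b ^ e
^-distribʳ-* zero    a b = refl
^-distribʳ-* (suc e) a b = trans (cong (a * b *_) (^-distribʳ-* e a b)) (eq a b (a ^ e) (b ^ e))
  where
  eq : ∀ a b x y → a * b * (x * y) ≡ a * x * (b * y)
  eq = solve-∀

-- The root is found by counting up from 1. The last rejected candidate has a power below `x`, and
-- the step to the next one at most doubles it.
root-spec : ∀ e x → let a = root (suc e) x in 1 ≤ a × x ≤ a ^ suc e × a ^ suc e ≤ 2 ^ suc e * (x ⊔ 1)
root-spec e x = go x 1 ≤-refl (≤-trans (≤-reflexive (^-zeroˡ (suc e))) (*-mono-≤ (m^n>0 2 (suc e)) (m≤n⊔m x 1)))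
                  (subst (λ y → x ≤ y ^ suc e) (+-comm 1 x) (≤-trans (n≤1+n x)
                    (≤-trans (≤-reflexive (sym (*-identityʳ (suc x)))) (*-monoʳ-≤ (suc x) (m^n>0 (suc x) e)))))
  where
  go : ∀ f a → 1 ≤ a → a ^ suc e ≤ 2 ^ suc e * (x ⊔ 1) → x ≤ (f + a) ^ suc e →
       let b = rootFrom (suc e) x f a in 1 ≤ b × x ≤ b ^ suc e × b ^ suc e ≤ 2 ^ suc e * (x ⊔ 1)
  go zero a p q r = p , r , q
  go (suc f) a p q r with x ≤ᵇ a ^ suc e in eq
  ... | true = p , ≤ᵇ-t⁻ eq , q
  ... | false = go f (suc a) (s≤s z≤n) small (subst (λ z → x ≤ z ^ suc e) (sym (+-suc f a)) r)
    where
    small : suc a ^ suc e ≤ 2 ^ suc e * (x ⊔ 1)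
    small = begin
      suc a ^ suc e          ≤⟨ ^-monoˡ-≤ (suc e) (≤-trans (+-monoˡ-≤ a p) (≤-reflexive (cong (a +_) (sym (+-identityʳ a))))) ⟩
      (2 * a) ^ suc e        ≡⟨ ^-distribʳ-* (suc e) 2 a ⟩
      2 ^ suc e * a ^ suc e  ≤⟨ *-monoʳ-≤ (2 ^ suc e) (≤-trans (<⇒≤ (≤ᵇ-f⁻ eq)) (m≤m⊔n x 1)) ⟩
      2 ^ suc e * (x ⊔ 1)    ∎
      where open ≤-Reasoning

fuel : ℕ → ℕ → ℕ
fuel n d = n * suc d + d

record Pars (n : ℕ) : Set where
  field
    a T      : ℕ
    Z        : Pr n
    pre      : Bool
    lo hi h  : ℕ

module _ {n : ℕ} where

  -- One round at label 1 only, where nothing can be thrown out: the usual greedy algorithm, with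
  -- the factor 2 supplied by `end-gap` for `d = 1`.
  greedy : Q n (Auc n)
  greedy = levels 1 0 (auc ∅ ∅ (λ _ → 1))

  mem₀ : Mem n
  mem₀ = mem (λ _ → ∅) ∅ 0

  restart : Cfg n → Cfg n
  restart g = cfg 0 (Cfg.S g) (Cfg.c g) (Cfg.par g)

  -- The labels of the auction are dropped: the search that follows profits only from the small
  -- deficit of its set.
  approx : ℕ → ℕ → Q n (Cfg n)
  approx a T = auction a (a * T ∸ 1) >>= λ S →
    Machine.mach ⊤ tt naive (fuel n (a * T)) (a * T) (cfg 0 S (λ _ → 1) (λ x → x)) tt

  exact : ℕ → Pars n → Cfg n → Q n (Cfg n)
  exact d p g = Machine.mach (Mem n) mem₀ (Smart.smart Z pre lo hi h) (fuel n d) d (restart g) mem₀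
    where open Pars p

  matroidIntersection : (ℕ → Pars n) → Q n (Subset n)
  matroidIntersection ps = greedy >>= λ st → let ρ = # (Auc.S st) ; p = ps ρ in
    approx (Pars.a p) (Pars.T p) >>= λ g → exact (suc (2 * ρ)) p g >>= λ g′ → ret (tabulate (Cfg.S g′))

-- The phases together.

module Assembly {n : ℕ} (MA MB : Mat n) (1≤n : 1 ≤ n) where
  open Two MA MB
  open MachineL MA MB
  open StageL MA MB hiding (t; kp; c₁)

  1≤L : 1 ≤ L
  1≤L = m≤n⊔m ⌈log₂ n ⌉ 1

  ρ : ℕ
  ρ = # (Auc.S (val greedy))

  Common : Pr n → Set
  Common S = A.Ind S × B.Ind S

  greedy-spec : Common (Auc.S (val greedy)) × (∀ T → Common T → # T ≤ 2 * ρ) × cost greedy ≤ 3 * (L * n)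
  greedy-spec with B.basis
  ... | W , iW , mx = main
    where
    open AuctionL MA MB 1
    open AuctionT MA MB 1
    c₀ : Lab n
    c₀ _ = 1
    ref : Ref W c₀
    ref = record { iW = iW ; dom = λ s _ T iT T≤ → B.span-bound (B.down (λ v → leq-S W c₀) iW) iT
            (λ x e q → B.up (⊕-mono {P = W} {leq W c₀ s} (λ v a → leq-in W c₀ a (T≤ x e)))
              (mx x (¬true⇒false (λ a → absurd (leq-in W c₀ a (T≤ x e)) q)))) }
    inv : Inv W c₀ 0 [] (auc ∅ ∅ c₀)
    inv = record
      { iA = A.empt ; iB = B.empt ; disj = λ () ; c≥1 = λ _ → ≤-refl ; c≤d = λ _ ()
      ; n1 = λ x _ s 1≤s s<1 → ⊥-elim (<⇒≱ s<1 1≤s) ; n1K = λ _ () ; K< = λ _ ()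
      ; r1 = λ _ → ≤-refl ; r2 = λ _ () ; skip = λ x _ _ () }
    main : Common (Auc.S (val greedy)) × (∀ T → Common T → # T ≤ 2 * ρ) × cost greedy ≤ 3 * (L * n)
    main with levels-spec ref 1 0 (auc ∅ ∅ c₀) refl inv
    ... | i , p , q = (Inv.iA i , B.down (λ v → ∨-l) (Inv.iB i)) , two , ct
      where
      st = val greedy
      K0 : # (Auc.K st) ≡ 0
      K0 = n≤0⇒n≡0 (≤-trans (#-mono {P = Auc.K st} {∅} (λ y e → ⊥-elim (<⇒≱ (Inv.K< i y e) (Inv.c≥1 i y)))) (≤-reflexive (#-∅ {n})))
      two : ∀ T → Common T → # T ≤ 2 * ρ
      two T (iT , jT) = subst₂ _≤_ (*-identityˡ (# T)) (trans (cong (λ k → 1 * (ρ + k) + ρ) K0) (eq ρ)) (end-gap ref i T iT jT)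
        where
        eq : ∀ x → 1 * (x + 0) + x ≡ 2 * x
        eq = solve-∀
      ct : cost greedy ≤ 3 * (L * n)
      ct = begin
        cost greedy                                   ≤⟨ m≤m+n _ _ ⟩
        cost greedy + L * load ∅ c₀                   ≤⟨ p ⟩
        1 * (2 * n) + L * load (Auc.S st) (Auc.c st)  ≤⟨ +-monoʳ-≤ _ (*-monoʳ-≤ L (≤-trans (load-≤ (Auc.S st) (Auc.c st) 1 (Inv.c≤d i)) (≤-trans (≤-reflexive (*-identityˡ ρ)) (#≤n (Auc.S st))))) ⟩
        1 * (2 * n) + L * n                           ≡⟨ eq n (L * n) ⟩
        2 * (1 * n) + L * n                           ≤⟨ +-monoˡ-≤ (L * n) (*-monoʳ-≤ 2 (*-monoˡ-≤ n 1≤L)) ⟩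
        2 * (L * n) + L * n                           ≡⟨ eq₂ (L * n) ⟩
        3 * (L * n)                                   ∎
        where
        open ≤-Reasoning
        eq : ∀ n x → 1 * (2 * n) + x ≡ 2 * (1 * n) + x
        eq = solve-∀
        eq₂ : ∀ x → 2 * x + x ≡ 3 * x
        eq₂ = solve-∀

  ρ≤n : ρ ≤ n
  ρ≤n = #≤n (Auc.S (val greedy))

  cap : ∀ S → A.Ind S → B.Ind S → # S ≤ 2 * ρ
  cap S i j = proj₁ (proj₂ greedy-spec) S (i , j)

  fuel-ok : ∀ d (S : Pr n) → (n ∸ # S) * suc d + d ≤ fuel n d
  fuel-ok d S = +-monoˡ-≤ d (*-monoˡ-≤ (suc d) (m∸n≤m n (# S)))

  -- Treats both exponents at once: `a * (a * T)` is aᵉ, `G` is aᵉ⁻¹ and `X` is the target bound.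
  -- `M` comes from rounding the root up.
  module Bounds (a T M : ℕ) (1≤a : 1 ≤ a) (a²≤T : a * a ≤ T) (ρ≤ : ρ ≤ a * (a * T)) (≤Mn : a * (a * T) ≤ M * n) where
    G : ℕ
    G = a * T

    1≤T : 1 ≤ T
    1≤T = ≤-trans (*-mono-≤ 1≤a 1≤a) a²≤T

    1≤G : 1 ≤ G
    1≤G = *-mono-≤ 1≤a 1≤T

    a≤G : a ≤ G
    a≤G = ≤-trans (≤-reflexive (sym (*-identityʳ a))) (*-monoʳ-≤ a 1≤T)

    G≤Mn : G ≤ M * n
    G≤Mn = ≤-trans (≤-trans (≤-reflexive (sym (*-identityˡ G))) (*-monoˡ-≤ G 1≤a)) ≤Mn

    X : ℕ
    X = L * n * G

    n≤Ln : n ≤ L * n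
    n≤Ln = ≤-trans (≤-reflexive (sym (*-identityˡ n))) (*-monoˡ-≤ n 1≤L)

    Ln≤X : L * n ≤ X
    Ln≤X = ≤-trans (≤-reflexive (sym (*-identityʳ (L * n)))) (*-monoʳ-≤ (L * n) 1≤G)

    n*G≤X : n * G ≤ X
    n*G≤X = *-monoˡ-≤ G n≤Ln

    cancel-gap : ∀ {b x y e z} → 1 ≤ b → b * x ≤ b * y + z → z ≤ b * e → x ≤ y + e
    cancel-gap {b} {x} {y} {e} {z} 1≤b h hz = *-cancelˡ-≤ b {{>-nonZero 1≤b}} (≤-trans h
      (≤-trans (+-monoʳ-≤ (b * y) hz) (≤-reflexive (sym (*-distribˡ-+ b y e)))))
      where open import Data.Nat using (>-nonZero)

    size : ∀ {S} → Common S → # S ≤ 2 * (a * G)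
    size (i , j) = ≤-trans (cap _ i j) (*-monoʳ-≤ 2 ρ≤)

    auction-cost : ∀ {S κ} → Common S → let w = 2 * suc (quot n T) in κ ≤ a * (2 * n) + (w + L) * (a * # S) → κ ≤ (6 + 6 * M) * X
    auction-cost {S} {κ} cm h = begin
      κ                                                       ≤⟨ h ⟩
      a * (2 * n) + (2 * suc q + L) * (a * # S)               ≤⟨ +-monoʳ-≤ (a * (2 * n)) (*-monoʳ-≤ (2 * suc q + L) (*-monoʳ-≤ a (size cm))) ⟩
      a * (2 * n) + (2 * suc q + L) * (a * (2 * (a * G)))     ≡⟨ eq a n q L T ⟩
      2 * (n * a) + (4 * (q * T * (a * (a * a))) + (2 + L) * (2 * (a * (a * G))))
        ≤⟨ +-mono-≤ (*-monoʳ-≤ 2 (≤-trans (*-monoʳ-≤ n a≤G) n*G≤X)) (+-mono-≤ (*-monoʳ-≤ 4 part₁) part₂) ⟩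
      2 * X + (4 * X + 6 * M * X)                             ≡⟨ eq₂ M X ⟩
      (6 + 6 * M) * X                                         ∎
      where
      open ≤-Reasoning
      q = quot n T
      part₁ : q * T * (a * (a * a)) ≤ X
      part₁ = ≤-trans (*-mono-≤ (quot-≤ n T 1≤T) (*-monoʳ-≤ a a²≤T)) n*G≤X
      part₂ : (2 + L) * (2 * (a * (a * G))) ≤ 6 * M * X
      part₂ = begin
        (2 + L) * (2 * (a * (a * G)))        ≤⟨ *-mono-≤ (+-monoˡ-≤ L (*-monoʳ-≤ 2 1≤L)) (*-monoʳ-≤ 2 (*-mono-≤ a≤G ≤Mn)) ⟩
        (2 * L + L) * (2 * (G * (M * n)))    ≡⟨ eq₃ L G M n ⟩
        6 * M * (L * n * G)                  ∎
        where
        eq₃ : ∀ l g m n → (2 * l + l) * (2 * (g * (m * n))) ≡ 6 * m * (l * n * g)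
        eq₃ = solve-∀
      eq : ∀ a n q l t → a * (2 * n) + (2 * suc q + l) * (a * (2 * (a * (a * t))))
           ≡ 2 * (n * a) + (4 * (q * t * (a * (a * a))) + (2 + l) * (2 * (a * (a * (a * t)))))
      eq = solve-∀
      eq₂ : ∀ m x → 2 * x + (4 * x + 6 * m * x) ≡ (6 + 6 * m) * x
      eq₂ = solve-∀

    start : ∀ {S} → Common S → MI 0 (cfg 0 S (λ _ → 1) (λ x → x))
    start (i , j) = record
      { iA = i ; iB = j ; c≥1 = λ _ → ≤-refl ; n1 = λ x _ s 1≤s s<1 → ⊥-elim (<⇒≱ s<1 1≤s) ; cap = λ _ _ → ≤-refl
      ; dom = λ { s 1≤s s≤0 → ⊥-elim (<⇒≱ 1≤s s≤0) } ; u≤ℓ = z≤n ; t1 = λ z _ () ; t2 = λ z _ () }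

    ApproxPost : Cfg n → ℕ → Set
    ApproxPost g k = (∃ λ ℓ → MI ℓ (restart g)) × (∀ T → Common T → # T ≤ # (Cfg.S g) + 2 * a) × Common (Cfg.S g)
      × k ≤ (30 + 9 * M) * X

    approx-spec : wp (approx a T) ApproxPost
    approx-spec = wp->>= (auction a (G ∸ 1)) _ ApproxPost
        (main (val (auction a (G ∸ 1))) (cost (auction a (G ∸ 1))) (AuctionT.auction-spec MA MB a (G ∸ 1) (2 * suc (quot n T)) weight))
      where
      G≡ : suc (G ∸ 1) ≡ G
      G≡ = m+[n∸m]≡n 1≤G
      weight : a * (2 * n) ≤ 2 * suc (quot n T) * suc (G ∸ 1)
      weight = ≤-trans (*-monoʳ-≤ a (*-monoʳ-≤ 2 (quot-> n T 1≤T)))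
        (≤-reflexive (trans (eq a (suc (quot n T)) T) (cong (2 * suc (quot n T) *_) (sym G≡))))
        where
        eq : ∀ a q t → a * (2 * (q * t)) ≡ 2 * q * (a * t)
        eq = solve-∀
      main : ∀ S κ → A.Ind S × B.Ind S × (∀ T → A.Ind T → B.Ind T → a * # T ≤ a * (# S + (G ∸ 1)) + # S)
             × κ ≤ a * (2 * n) + (2 * suc (quot n T) + L) * (a * # S) →
             wp (Machine.mach ⊤ tt naive (fuel n G) G (cfg 0 S (λ _ → 1) (λ x → x)) tt) (λ g k → ApproxPost g (κ + k))
      main S κ (iA , iB , gp , ct) =
          fin (val (Machine.mach ⊤ tt naive (fuel n G) G g₀ tt)) (cost (Machine.mach ⊤ tt naive (fuel n G) G g₀ tt))
            (NaiveL.naive-mach MA MB G (fuel n G) g₀ (start (iA , iB)) (fuel-ok G S))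
        where
        g₀ : Cfg n
        g₀ = cfg 0 S (λ _ → 1) (λ x → x)
        price : ℕ
        price = 2 * n + n + G * L + (2 + L) * n
        gap₁ : ∀ T → Common T → # T ≤ # S + 3 * G
        gap₁ T (i , j) = ≤-trans (cancel-gap 1≤a (gp T i j) (≤-trans (size (iA , iB)) (≤-reflexive (eq a G))))
          (≤-trans (+-monoˡ-≤ (2 * G) (+-monoʳ-≤ (# S) (m∸n≤m G 1))) (≤-reflexive (eq₂ (# S) G)))
          where
          eq : ∀ a g → 2 * (a * g) ≡ a * (2 * g)
          eq = solve-∀
          eq₂ : ∀ s g → s + g + 2 * g ≡ s + 3 * g
          eq₂ = solve-∀
        fin : ∀ g k → MachineT.MachPost MA MB G ⊤ tt naive (λ _ _ → ⊤) (naivePot G) (λ _ → ⊤) (2 * n) g₀ tt g k → ApproxPost g (κ + k)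
        fin g k (i , j , fin-gap , mi , bd) = mi , gap₂ , (i , j) , (begin
            κ + k                                ≤⟨ +-mono-≤ (auction-cost (iA , iB) ct) k≤ ⟩
            (6 + 6 * M) * X + (24 + 3 * M) * X   ≡⟨ eq M X ⟩
            (30 + 9 * M) * X                     ∎)
          where
          open ≤-Reasoning
          eq : ∀ m x → (6 + 6 * m) * x + (24 + 3 * m) * x ≡ (30 + 9 * m) * x
          eq = solve-∀
          gap₂ : ∀ T → Common T → # T ≤ # (Cfg.S g) + 2 * a
          gap₂ T (i′ , j′) = cancel-gap 1≤G (fin-gap T i′ j′) (≤-trans (size (i , j)) (≤-reflexive (eq₃ a G)))
            where
            eq₃ : ∀ a g → 2 * (a * g) ≡ g * (2 * a)
            eq₃ = solve-∀
          k≤ : k ≤ (24 + 3 * M) * X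
          k≤ = +-cancelʳ-≤ (# S * price) _ _ (begin
            k + # S * price                                                    ≤⟨ bd ⟩
            # (Cfg.S g) * price + ((2 + L) * above (Cfg.c g₀) 1 + naivePot G g₀ tt)
              ≤⟨ +-mono-≤ (*-monoˡ-≤ price (gap₁ (Cfg.S g) (i , j))) (+-mono-≤ (*-monoʳ-≤ (2 + L) {above (Cfg.c g₀) 1} {n} (#≤n (geq full (Cfg.c g₀) 1))) (NaiveL.naivePot-≤ MA MB G g₀)) ⟩
            (# S + 3 * G) * price + ((2 + L) * n + (G + 2) * n)                ≡⟨ eq₄ (# S) G price L n ⟩
            3 * (G * price) + (n * G + (4 + L) * n) + # S * price              ≤⟨ +-monoˡ-≤ (# S * price) (+-mono-≤ (*-monoʳ-≤ 3 gp≤) (+-mono-≤ n*G≤X five)) ⟩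
            3 * ((6 + M) * X) + (X + 5 * X) + # S * price                      ≡⟨ cong (_+ # S * price) (eq₅ M X) ⟩
            (24 + 3 * M) * X + # S * price                                     ∎)
            where
            eq₄ : ∀ s g p l n → (s + 3 * g) * p + ((2 + l) * n + (g + 2) * n) ≡ 3 * (g * p) + (n * g + (4 + l) * n) + s * p
            eq₄ = solve-∀
            eq₅ : ∀ m x → 3 * ((6 + m) * x) + (x + 5 * x) ≡ (24 + 3 * m) * x
            eq₅ = solve-∀
            five : (4 + L) * n ≤ 5 * X
            five = ≤-trans (*-monoˡ-≤ n (+-monoˡ-≤ L (*-monoʳ-≤ 4 1≤L))) (≤-trans (≤-reflexive (e L n)) (*-monoʳ-≤ 5 Ln≤X))
              where
              e : ∀ l n → (4 * l + l) * n ≡ 5 * (l * n)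
              e = solve-∀
            -- A path may be `G` levels long; its bisections cost `G * L`, which `G ≤ M * n`
            -- absorbs.
            gp≤ : G * price ≤ (6 + M) * X
            gp≤ = begin
              G * (2 * n + n + G * L + (2 + L) * n)               ≡⟨ e G n L ⟩
              5 * (n * G) + G * L * G + L * n * G                 ≤⟨ +-monoˡ-≤ X (+-mono-≤ (*-monoʳ-≤ 5 n*G≤X) (*-monoˡ-≤ G (*-monoˡ-≤ L G≤Mn))) ⟩
              5 * X + M * n * L * G + X                           ≡⟨ e₂ M n L G ⟩
              (6 + M) * X                                         ∎
              where
              e : ∀ g n l → g * (2 * n + n + g * l + (2 + l) * n) ≡ 5 * (n * g) + g * l * g + l * n * g
              e = solve-∀
              e₂ : ∀ m n l g → 5 * (l * n * g) + m * n * l * g + l * n * g ≡ (6 + m) * (l * n * g)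
              e₂ = solve-∀

    ExactPost : ℕ → Pr n → Cfg n → ℕ → Set
    ExactPost price S g k = let d = suc (2 * ρ) in Common (Cfg.S g)
      × (∀ T → A.Ind T → B.Ind T → d * # T ≤ d * # (Cfg.S g) + # (Cfg.S g))
      × k + # S * price ≤ # (Cfg.S g) * price + ((2 + L) * n + price)

    exact-post : ∀ {d St ini expand InvE Pot Ok B₀ st} {g g′ : Cfg n} {k price} → d ≡ suc (2 * ρ) →
                 MachineT.price MA MB d St ini expand InvE Pot Ok B₀ ≡ price → Pot g st ≤ price →
                 MachineT.MachPost MA MB d St ini expand InvE Pot Ok B₀ g st g′ k → ExactPost price (Cfg.S g) g′ k
    exact-post {g = g} {g′} {k} {price} refl refl pot (i , j , gp , _ , bd) = (i , j) , gp ,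
      ≤-trans bd (+-monoʳ-≤ (# (Cfg.S g′) * price) (+-mono-≤ (*-monoʳ-≤ (2 + L) (#≤n (geq full (Cfg.c g) (suc (Cfg.lev g))))) pot))

    -- The last phase enters only through its price per path, of order `L * n * T`: at most `2 * a`
    -- paths are left, so it adds O(`X`).
    total : ∀ {ps : ℕ → Pars n} {K₃ price} → Pars.a (ps ρ) ≡ a → Pars.T (ps ρ) ≡ T → price ≤ K₃ * (L * n * T) →
            (let g = val (approx {n} a T) in (∃ λ ℓ → MI ℓ (restart g)) → wp (exact (suc (2 * ρ)) (ps ρ) g) (ExactPost price (Cfg.S g))) →
            wp (matroidIntersection ps) (λ V k → ∃ λ S → V ≡ tabulate S × Common S × (∀ T → Common T → # T ≤ # S)
              × k ≤ (36 + 9 * M + 3 * K₃) * X)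
    total {ps} {K₃} {price} refl refl pr hx =
      wp->>= greedy _ Post (wp->>= (approx a T) _ (λ V k → Post V (cost greedy + k))
        (wp->>= (exact (suc (2 * ρ)) (ps ρ) g) _ (λ V k → Post V (cost greedy + (cost (approx {n} a T) + k)))
          (main (approx-spec) (hx (proj₁ approx-spec)))))
      where
      g : Cfg n
      g = val (approx a T)
      Post : Subset n → ℕ → Set
      Post V k = ∃ λ S → V ≡ tabulate S × Common S × (∀ T → Common T → # T ≤ # S) × k ≤ (36 + 9 * M + 3 * K₃) * X
      main : ApproxPost g (cost (approx {n} a T)) → wp (exact (suc (2 * ρ)) (ps ρ) g) (ExactPost price (Cfg.S g)) →
             wp (exact (suc (2 * ρ)) (ps ρ) g) (λ g′ k → Post (tabulate (Cfg.S g′)) (cost greedy + (cost (approx {n} a T) + (k + 0))))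
      main (_ , gp , cm , c₁) (cm′ , gp′ , bd) = S₃ , refl , cm′ , best , (begin
          cost greedy + (cost (approx {n} a T) + (k₃ + 0))                   ≡⟨ cong (λ z → cost greedy + (cost (approx {n} a T) + z)) (+-identityʳ k₃) ⟩
          cost greedy + (cost (approx {n} a T) + k₃)                         ≤⟨ +-mono-≤ (≤-trans (proj₂ (proj₂ greedy-spec)) (*-monoʳ-≤ 3 Ln≤X)) (+-mono-≤ c₁ k₃≤) ⟩
          3 * X + ((30 + 9 * M) * X + (3 * K₃ * X + 3 * X))                  ≡⟨ eq M K₃ X ⟩
          (36 + 9 * M + 3 * K₃) * X                                          ∎)
        where
        open ≤-Reasoning
        S₃ = Cfg.S (val (exact (suc (2 * ρ)) (ps ρ) g))
        k₃ = cost (exact (suc (2 * ρ)) (ps ρ) g)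
        eq : ∀ m k x → 3 * x + ((30 + 9 * m) * x + (3 * k * x + 3 * x)) ≡ (36 + 9 * m + 3 * k) * x
        eq = solve-∀
        best : ∀ T → Common T → # T ≤ # S₃
        -- A larger common independent set would force `2 * ρ + 1 ≤ # S₃`, against the greedy bound.
        best T (i , j) with # T ≤? # S₃
        ... | yes p = p
        ... | no p = ⊥-elim (1+n≰n (≤-trans (+-cancelˡ-≤ (suc (2 * ρ) * # S₃) _ _ (begin
                suc (2 * ρ) * # S₃ + suc (2 * ρ)     ≡⟨ trans (+-comm _ (suc (2 * ρ))) (sym (*-suc (suc (2 * ρ)) (# S₃))) ⟩
                suc (2 * ρ) * suc (# S₃)             ≤⟨ *-monoʳ-≤ (suc (2 * ρ)) (≰⇒> p) ⟩
                suc (2 * ρ) * # T                    ≤⟨ gp′ T i j ⟩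
                suc (2 * ρ) * # S₃ + # S₃            ∎)) (cap S₃ (proj₁ cm′) (proj₂ cm′))))
        k₃≤ : k₃ ≤ 3 * K₃ * X + 3 * X
        k₃≤ = +-cancelʳ-≤ (# (Cfg.S g) * price) _ _ (begin
          k₃ + # (Cfg.S g) * price                                        ≤⟨ bd ⟩
          # S₃ * price + ((2 + L) * n + price)                            ≤⟨ +-monoˡ-≤ _ (*-monoˡ-≤ price (gp S₃ cm′)) ⟩
          (# (Cfg.S g) + 2 * a) * price + ((2 + L) * n + price)           ≡⟨ e₁ (# (Cfg.S g)) a price ((2 + L) * n) ⟩
          2 * (a * price) + price + (2 + L) * n + # (Cfg.S g) * price     ≤⟨ +-monoˡ-≤ (# (Cfg.S g) * price) (+-mono-≤ (+-mono-≤ (*-monoʳ-≤ 2 ap) (≤-trans p≤ap ap)) three) ⟩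
          2 * (K₃ * X) + K₃ * X + 3 * X + # (Cfg.S g) * price             ≡⟨ cong (_+ # (Cfg.S g) * price) (e₂ K₃ X) ⟩
          3 * K₃ * X + 3 * X + # (Cfg.S g) * price                        ∎)
          where
          e₁ : ∀ s a p l → (s + 2 * a) * p + (l + p) ≡ 2 * (a * p) + p + l + s * p
          e₁ = solve-∀
          e₂ : ∀ k x → 2 * (k * x) + k * x + 3 * x ≡ 3 * k * x + 3 * x
          e₂ = solve-∀
          ap : a * price ≤ K₃ * X
          ap = ≤-trans (*-monoʳ-≤ a pr) (≤-reflexive (e a K₃ (L * n) T))
            where
            e : ∀ a k x t → a * (k * (x * t)) ≡ k * (x * (a * t))
            e = solve-∀
          p≤ap : price ≤ a * price
          p≤ap = ≤-trans (≤-reflexive (sym (*-identityˡ price))) (*-monoˡ-≤ price 1≤a)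
          three : (2 + L) * n ≤ 3 * X
          three = ≤-trans (*-monoˡ-≤ n (+-monoˡ-≤ L (*-monoʳ-≤ 2 1≤L))) (≤-trans (≤-reflexive (e L n)) (*-monoʳ-≤ 3 Ln≤X))
            where
            e : ∀ l n → (2 * l + l) * n ≡ 3 * (l * n)
            e = solve-∀

-- Sampling

csum : (m : ℕ) → (Vec Bool m → ℕ) → ℕ
csum zero    f = f []
csum (suc m) f = csum m (λ ρ → f (true ∷ ρ)) + csum m (λ ρ → f (false ∷ ρ))

count≡csum : ∀ m f → count m f ≡ csum m (λ ρ → b2n (f ρ))
count≡csum zero f with f []
... | true  = refl
... | false = refl
count≡csum (suc m) f = cong₂ _+_ (count≡csum m (λ ρ → f (true ∷ ρ))) (count≡csum m (λ ρ → f (false ∷ ρ)))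

csum-mono : ∀ m {f g} → (∀ ρ → f ρ ≤ g ρ) → csum m f ≤ csum m g
csum-mono zero h = h []
csum-mono (suc m) h = +-mono-≤ (csum-mono m (λ ρ → h (true ∷ ρ))) (csum-mono m (λ ρ → h (false ∷ ρ)))

csum-sumF : ∀ m {N} (f : Vec Bool m → Fin N → ℕ) → csum m (λ ρ → sumF (f ρ)) ≡ sumF (λ i → csum m (λ ρ → f ρ i))
csum-sumF zero f = refl
csum-sumF (suc m) f = trans (cong₂ _+_ (csum-sumF m (λ ρ → f (true ∷ ρ))) (csum-sumF m (λ ρ → f (false ∷ ρ))))
  (sym (sum-+ (λ i → csum m (λ ρ → f (true ∷ ρ) i)) (λ i → csum m (λ ρ → f (false ∷ ρ) i))))

count-true : ∀ m → count m (λ _ → true) ≡ 2 ^ m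
count-true zero = refl
count-true (suc m) = cong₂ _+_ (count-true m) (trans (count-true m) (sym (+-identityʳ _)))

count-false : ∀ m → count m (λ _ → false) ≡ 0
count-false zero = refl
count-false (suc m) = cong₂ _+_ (count-false m) (count-false m)

count-not : ∀ m f → count m f + count m (λ ρ → not (f ρ)) ≡ 2 ^ m
count-not zero f with f []
... | true  = refl
... | false = refl
count-not (suc m) f = trans (eq (count m (λ ρ → f (true ∷ ρ))) (count m (λ ρ → f (false ∷ ρ))) _ _)
  (cong₂ _+_ (count-not m (λ ρ → f (true ∷ ρ))) (trans (count-not m (λ ρ → f (false ∷ ρ))) (sym (+-identityʳ _))))
  where
  eq : ∀ a b c d → a + b + (c + d) ≡ a + c + (b + d)
  eq = solve-∀

takeV : ∀ b {k} → Vec Bool (b + k) → Vec Bool b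
takeV zero    ρ       = []
takeV (suc b) (x ∷ ρ) = x ∷ takeV b ρ

dropV : ∀ b {k} → Vec Bool (b + k) → Vec Bool k
dropV zero    ρ       = ρ
dropV (suc b) (x ∷ ρ) = dropV b ρ

count-split : ∀ b {k} (g : Vec Bool b → Bool) (h : Vec Bool k → Bool) →
              count (b + k) (λ ρ → g (takeV b ρ) ∧ h (dropV b ρ)) ≡ count b g * count k h
count-split zero {k} g h with g []
... | true  = sym (+-identityʳ _)
... | false = count-false k
count-split (suc b) {k} g h = trans (cong₂ _+_ (count-split b (λ u → g (true ∷ u)) h) (count-split b (λ u → g (false ∷ u)) h))
  (sym (*-distribʳ-+ (count k h) (count b (λ u → g (true ∷ u))) _))

bin : ∀ {b} → Vec Bool b → ℕ
bin []                  = 0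
bin {suc b} (true ∷ u)  = 2 ^ b + bin u
bin {suc b} (false ∷ u) = bin u

below : ℕ → (ℕ → Bool) → ℕ
below zero    P = 0
below (suc N) P = b2n (P 0) + below N (P ∘ suc)

below-+ : ∀ a b P → below (a + b) P ≡ below a P + below b (λ j → P (a + j))
below-+ zero b P = refl
below-+ (suc a) b P = trans (cong (b2n (P 0) +_) (below-+ a b (P ∘ suc))) (sym (+-assoc (b2n (P 0)) _ _))

count-bin : ∀ b P → count b (λ u → P (bin u)) ≡ below (2 ^ b) P
count-bin zero P with P 0
... | true  = refl
... | false = refl
count-bin (suc b) P = trans (cong₂ _+_ (count-bin b (λ j → P (2 ^ b + j))) (count-bin b P))
  (trans (+-comm (below (2 ^ b) (λ j → P (2 ^ b + j))) _)
    (sym (trans (cong (λ z → below (2 ^ b + z) P) (+-identityʳ (2 ^ b))) (below-+ (2 ^ b) (2 ^ b) P))))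

extend : ∀ {n} → Pr n → ℕ → Bool
extend {zero}  A j       = false
extend {suc n} A zero    = A zero
extend {suc n} A (suc j) = extend (A ∘ suc) j

extend-∈ : ∀ {n} (A : Pr n) j → extend A j ≡ true → ∃ λ v → v ∈ A × j ≡ toℕ v
extend-∈ {suc n} A zero e = zero , e , refl
extend-∈ {suc n} A (suc j) e = let (v , v∈ , q) = extend-∈ (A ∘ suc) j e in suc v , v∈ , cong suc q

below-extend : ∀ {n} (A : Pr n) N → n ≤ N → # A ≤ below N (extend A)
below-extend {zero} A N _ = z≤n
below-extend {suc n} A (suc N) (s≤s le) = +-monoʳ-≤ (b2n (A zero)) (below-extend (A ∘ suc) N le)

-- A seed consists of M blocks of b bits; each of the first m blocks draws the element with that
-- number, or nothing if the number is at least n.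
sampled : ∀ {n} (b m M : ℕ) → Vec Bool (M * b) → Pr n
sampled b zero    M       ρ v = false
sampled b (suc m) zero    ρ v = false
sampled b (suc m) (suc M) ρ v = (bin (takeV b ρ) ≡ᵇ toℕ v) ∨ sampled b m M (dropV b ρ) v

misses : ∀ {n} (b m M : ℕ) → Pr n → Vec Bool (M * b) → Bool
misses b zero    M       A ρ = true
misses b (suc m) zero    A ρ = true
misses b (suc m) (suc M) A ρ = not (extend A (bin (takeV b ρ))) ∧ misses b m M A (dropV b ρ)

misses-f : ∀ {n} (b m M : ℕ) (A : Pr n) ρ → misses b m M A ρ ≡ false → ∃ λ v → v ∈ A × v ∈ sampled b m M ρ
misses-f b (suc m) (suc M) A ρ e with ∧-cases-f {not (extend A (bin (takeV b ρ)))} e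
... | inj₁ p = let (v , v∈ , q) = extend-∈ A _ (not-ff p) in v , v∈ , ∨-l (≡ᵇ-t q)
... | inj₂ p = let (v , v∈ , q) = misses-f b m M A (dropV b ρ) p in v , v∈ , ∨-r {bin (takeV b ρ) ≡ᵇ toℕ v} q

#-point : ∀ {n} j → # {n} (λ v → j ≡ᵇ toℕ v) ≤ 1
#-point {zero} j = z≤n
#-point {suc n} zero = s≤s (≤-reflexive (#-∅ {n}))
#-point {suc n} (suc j) = #-point {n} j

#-sampled : ∀ {n} (b m M : ℕ) ρ → # {n} (sampled b m M ρ) ≤ m
#-sampled {n} b zero M ρ = ≤-reflexive (#-∅ {n})
#-sampled {n} b (suc m) zero ρ = ≤-trans (≤-reflexive (#-∅ {n})) z≤n
#-sampled {n} b (suc m) (suc M) ρ = ≤-trans (#-∪ {n} {P = λ v → bin (takeV b ρ) ≡ᵇ toℕ v} {sampled b m M (dropV b ρ)}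
    (λ v e → ∨-cases {bin (takeV b ρ) ≡ᵇ toℕ v} e))
  (+-mono-≤ (#-point {n} (bin (takeV b ρ))) (#-sampled {n} b m M (dropV b ρ)))

-- At least one in `q + 1` values of a block hits `A`; the fraction q / (q + 1) of misses is stated
-- after cross-multiplication.
miss-once : ∀ {n} b q (A : Pr n) → n ≤ 2 ^ b → 2 ^ b ≤ suc q * # A →
            count b (λ u → not (extend A (bin u))) * suc q ≤ q * 2 ^ b
miss-once {n} b q A n≤ big = +-cancelʳ-≤ (suc q * # A) _ _ (begin
  k * suc q + suc q * # A        ≡⟨ eq k q (# A) ⟩
  (# A + k) * suc q              ≤⟨ *-monoˡ-≤ (suc q) (≤-trans (+-monoˡ-≤ k hits) (≤-reflexive (count-not b _))) ⟩
  2 ^ b * suc q                  ≡⟨ eq₂ (2 ^ b) q ⟩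
  q * 2 ^ b + 2 ^ b              ≤⟨ +-monoʳ-≤ (q * 2 ^ b) big ⟩
  q * 2 ^ b + suc q * # A        ∎)
  where
  open ≤-Reasoning
  k = count b (λ u → not (extend A (bin u)))
  hits : # A ≤ count b (λ u → extend A (bin u))
  hits = ≤-trans (below-extend A (2 ^ b) n≤) (≤-reflexive (sym (count-bin b (extend A))))
  eq : ∀ k q a → k * suc q + suc q * a ≡ (a + k) * suc q
  eq = solve-∀
  eq₂ : ∀ x q → x * suc q ≡ q * x + x
  eq₂ = solve-∀

miss-bound : ∀ {n} b q (A : Pr n) → n ≤ 2 ^ b → 2 ^ b ≤ suc q * # A → ∀ m M → m ≤ M →
             count (M * b) (misses b m M A) * suc q ^ m ≤ q ^ m * 2 ^ (M * b)
miss-bound b q A n≤ big zero M _ = ≤-reflexive (trans (*-identityʳ _) (trans (count-true (M * b)) (sym (*-identityˡ _))))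
miss-bound b q A n≤ big (suc m) (suc M) (s≤s le) = begin
  count (b + M * b) (misses b (suc m) (suc M) A) * (suc q * suc q ^ m)
    ≡⟨ cong (_* (suc q * suc q ^ m)) (count-split b (λ u → not (extend A (bin u))) (misses b m M A)) ⟩
  k * r * (suc q * suc q ^ m)                  ≡⟨ eq k r (suc q) (suc q ^ m) ⟩
  (k * suc q) * (r * suc q ^ m)                ≤⟨ *-mono-≤ (miss-once b q A n≤ big) (miss-bound b q A n≤ big m M le) ⟩
  q * 2 ^ b * (q ^ m * 2 ^ (M * b))            ≡⟨ eq₂ q (2 ^ b) (q ^ m) (2 ^ (M * b)) ⟩
  q * q ^ m * (2 ^ b * 2 ^ (M * b))            ≡⟨ cong (q * q ^ m *_) (sym (^-distribˡ-+-* 2 b (M * b))) ⟩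
  q * q ^ m * 2 ^ (b + M * b)                  ∎
  where
  open ≤-Reasoning
  k = count b (λ u → not (extend A (bin u)))
  r = count (M * b) (misses b m M A)
  eq : ∀ k r x y → k * r * (x * y) ≡ (k * x) * (r * y)
  eq = solve-∀
  eq₂ : ∀ q x y z → q * x * (y * z) ≡ q * y * (x * z)
  eq₂ = solve-∀

-- The two leading terms of the binomial expansion of (q + 1)ᵐ.
bernoulli : ∀ q m → q ^ m + m * q ^ (m ∸ 1) ≤ suc q ^ m
bernoulli q zero = ≤-refl
bernoulli q (suc zero) = ≤-reflexive (eq q)
  where
  eq : ∀ q → q * 1 + (1 + 0) ≡ suc q * 1
  eq = solve-∀
bernoulli q (suc (suc m)) = begin
  q * x + (x + suc m * x)              ≤⟨ m≤m+n _ (suc m * q ^ m) ⟩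
  q * x + (x + suc m * x) + suc m * q ^ m ≡⟨ eq q (q ^ m) m ⟩
  suc q * (x + suc m * q ^ m)          ≤⟨ *-monoʳ-≤ (suc q) (bernoulli q (suc m)) ⟩
  suc q * suc q ^ suc m                ∎
  where
  open ≤-Reasoning
  x = q ^ suc m
  eq : ∀ q y m → q * (q * y) + (q * y + suc m * (q * y)) + suc m * y ≡ suc q * (q * y + suc m * y)
  eq = solve-∀

halving : ∀ q → 2 * q ^ suc q ≤ suc q ^ suc q
halving q = ≤-trans (≤-trans (≤-reflexive (eq q (q ^ q))) (+-monoʳ-≤ (q * q ^ q) (*-monoˡ-≤ (q ^ q) (n≤1+n q)))) (bernoulli q (suc q))
  where
  eq : ∀ q y → 2 * (q * y) ≡ q * y + q * y
  eq = solve-∀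

-- By `halving`, each group of `q + 1` draws at least halves the probability of missing `A`, and
-- there are `s` groups.
rare : ∀ {n} b q (A : Pr n) → n ≤ 2 ^ b → 2 ^ b ≤ suc q * # A → ∀ s M → suc q * s ≤ M →
       count (M * b) (misses b (suc q * s) M A) * 2 ^ s ≤ 2 ^ (M * b)
rare b q A n≤ big s M le = *-cancelʳ-≤ (k * 2 ^ s) _ (suc q ^ (suc q * s)) {{m^n≢0 (suc q) (suc q * s)}} (begin
  k * 2 ^ s * suc q ^ (suc q * s)          ≡⟨ eq k (2 ^ s) (suc q ^ (suc q * s)) ⟩
  2 ^ s * (k * suc q ^ (suc q * s))        ≤⟨ *-monoʳ-≤ (2 ^ s) (miss-bound b q A n≤ big (suc q * s) M le) ⟩
  2 ^ s * (q ^ (suc q * s) * 2 ^ (M * b))  ≡⟨ sym (*-assoc (2 ^ s) _ _) ⟩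
  2 ^ s * q ^ (suc q * s) * 2 ^ (M * b)    ≤⟨ *-monoˡ-≤ (2 ^ (M * b)) half ⟩
  suc q ^ (suc q * s) * 2 ^ (M * b)        ≡⟨ *-comm _ (2 ^ (M * b)) ⟩
  2 ^ (M * b) * suc q ^ (suc q * s)        ∎)
  where
  open ≤-Reasoning
  k = count (M * b) (misses b (suc q * s) M A)
  eq : ∀ k x y → k * x * y ≡ x * (k * y)
  eq = solve-∀
  half : 2 ^ s * q ^ (suc q * s) ≤ suc q ^ (suc q * s)
  half = begin
    2 ^ s * q ^ (suc q * s)       ≡⟨ cong (2 ^ s *_) (sym (^-*-assoc q (suc q) s)) ⟩
    2 ^ s * (q ^ suc q) ^ s       ≡⟨ sym (^-distribʳ-* s 2 (q ^ suc q)) ⟩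
    (2 * q ^ suc q) ^ s           ≤⟨ ^-monoˡ-≤ s (halving q) ⟩
    (suc q ^ suc q) ^ s           ≡⟨ ^-*-assoc (suc q) (suc q) s ⟩
    suc q ^ (suc q * s)           ∎

union-bound : ∀ {F n} m k (slow : Vec Bool m → Bool) (bad : Fin F → Fin n → Vec Bool m → Bool) →
              (∀ ρ → (∀ i y → bad i y ρ ≡ false) → slow ρ ≡ false) → (∀ i y → count m (bad i y) * k ≤ 2 ^ m) →
              count m slow * k ≤ F * n * 2 ^ m
union-bound {F} {n} m k slow bad quick each = begin
  count m slow * k
    ≤⟨ *-monoˡ-≤ k (≤-trans (≤-reflexive (count≡csum m slow)) (csum-mono m some)) ⟩
  csum m (λ ρ → sumF (λ i → sumF (λ y → b2n (bad i y ρ)))) * k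
    ≡⟨ cong (_* k) (trans (csum-sumF m (λ ρ i → sumF (λ y → b2n (bad i y ρ))))
         (sum-cong (λ i → trans (csum-sumF m (λ ρ y → b2n (bad i y ρ))) (sum-cong (λ y → sym (count≡csum m (bad i y))))))) ⟩
  sumF (λ i → sumF (λ y → count m (bad i y))) * k
    ≡⟨ trans (*-comm _ k) (trans (sym (sum-* k (λ i → sumF (λ y → count m (bad i y)))))
         (sum-cong (λ i → sym (sum-* k (λ y → count m (bad i y)))))) ⟩
  sumF (λ i → sumF (λ y → k * count m (bad i y)))
    ≤⟨ sum-mono (λ i → sum-mono (λ y → ≤-trans (≤-reflexive (*-comm k _)) (each i y))) ⟩
  sumF {F} (λ i → sumF {n} (λ y → 2 ^ m))
    ≡⟨ trans (sum-cong {F} (λ i → sum-const {n} (2 ^ m))) (trans (sum-const {F} (n * 2 ^ m)) (sym (*-assoc F n _))) ⟩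
  F * n * 2 ^ m ∎
  where
  open ≤-Reasoning
  some : ∀ ρ → b2n (slow ρ) ≤ sumF (λ i → sumF (λ y → b2n (bad i y ρ)))
  some ρ with 1 ≤? sumF (λ i → sumF (λ y → b2n (bad i y ρ)))
  ... | yes p = ≤-trans (b2n≤1 (slow ρ)) p
  ... | no p = ≤-trans (≤-reflexive (cong b2n (quick ρ (λ i y → ¬true⇒false (λ e → p (≤-trans (≤-reflexive (sym (cong b2n e)))
          (≤-trans (sum-point (λ y → b2n (bad i y ρ)) y) (sum-point (λ i → sumF (λ y → b2n (bad i y ρ))) i)))))))) z≤n

-- Raising to the power p + 1 clears the root: aᵖ⁺¹ is O(ρ) and ρ ≤ r, so the power of aᵖ becomes
-- rᵖ, and the rounding of the root contributes the factor 2ᵖ to the constant.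
root-bound : ∀ p {q C₁ L n a ρ r} → q ≤ C₁ * (L * n * a ^ p) → a ^ suc p ≤ 2 ^ suc p * (ρ ⊔ 1) → ρ ≤ r →
             q ^ suc p ≤ (2 ^ p * C₁) ^ suc p * n ^ suc p * r⁺ r ^ p * L ^ suc p
root-bound p {q} {C₁} {L} {n} {a} {ρ} {r} hq ha hr = begin
  q ^ suc p                                                ≤⟨ ^-monoˡ-≤ (suc p) hq ⟩
  (C₁ * (L * n * a ^ p)) ^ suc p                           ≡⟨ trans (dist C₁ (L * n * a ^ p)) (cong (C₁ ^ suc p *_) (trans (dist (L * n) (a ^ p)) (cong (_* (a ^ p) ^ suc p) (dist L n)))) ⟩
  C₁ ^ suc p * (L ^ suc p * n ^ suc p * (a ^ p) ^ suc p)   ≤⟨ *-monoʳ-≤ (C₁ ^ suc p) (*-monoʳ-≤ (L ^ suc p * n ^ suc p) powers) ⟩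
  C₁ ^ suc p * (L ^ suc p * n ^ suc p * ((2 ^ p) ^ suc p * r⁺ r ^ p))
    ≡⟨ eq (C₁ ^ suc p) (L ^ suc p) (n ^ suc p) ((2 ^ p) ^ suc p) (r⁺ r ^ p) ⟩
  ((2 ^ p) ^ suc p * C₁ ^ suc p) * n ^ suc p * r⁺ r ^ p * L ^ suc p
    ≡⟨ cong (λ z → z * n ^ suc p * r⁺ r ^ p * L ^ suc p) (sym (dist (2 ^ p) C₁)) ⟩
  (2 ^ p * C₁) ^ suc p * n ^ suc p * r⁺ r ^ p * L ^ suc p  ∎
  where
  open ≤-Reasoning
  dist : ∀ x y → (x * y) ^ suc p ≡ x ^ suc p * y ^ suc p
  dist = ^-distribʳ-* (suc p)
  eq : ∀ c l n x r → c * (l * n * (x * r)) ≡ (x * c) * n * r * l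
  eq = solve-∀
  flip : ∀ x → (x ^ p) ^ suc p ≡ (x ^ suc p) ^ p
  flip x = trans (^-*-assoc x p (suc p)) (trans (cong (x ^_) (*-comm p (suc p))) (sym (^-*-assoc x (suc p) p)))
  powers : (a ^ p) ^ suc p ≤ (2 ^ p) ^ suc p * r⁺ r ^ p
  powers = begin
    (a ^ p) ^ suc p                    ≡⟨ flip a ⟩
    (a ^ suc p) ^ p                    ≤⟨ ^-monoˡ-≤ p (≤-trans ha (*-monoʳ-≤ (2 ^ suc p) (⊔-monoˡ-≤ 1 hr))) ⟩
    (2 ^ suc p * r⁺ r) ^ p             ≡⟨ ^-distribʳ-* p (2 ^ suc p) (r⁺ r) ⟩
    (2 ^ suc p) ^ p * r⁺ r ^ p         ≡⟨ cong (_* r⁺ r ^ p) (sym (flip 2)) ⟩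
    (2 ^ p) ^ suc p * r⁺ r ^ p         ∎

-- Back to oracles and query trees; the two algorithms.

module Transfer {n : ℕ} {I₁ I₂ : Oracle n} (m₁ : IsMatroid I₁) (m₂ : IsMatroid I₂) where
  MA MB : Mat n
  MA = toMat m₁
  MB = toMat m₂
  open Two MA MB

  run≡ : ∀ m → run (toTree m) I₁ I₂ ≡ (val m , cost m)
  run≡ = run-toTree I₁ I₂ o (λ { M₁ P → refl ; M₂ P → refl })

  ∣∣≡# : ∀ (V : Subset n) → ∣ V ∣ ≡ # (lookup V)
  ∣∣≡# V = trans (cong ∣_∣ (sym (tabulate∘lookup V))) (∣tabulate∣ (lookup V))

  maximum : ∀ {V S} → V ≡ tabulate S → A.Ind S × B.Ind S → (∀ T → A.Ind T × B.Ind T → # T ≤ # S) → MaxCommonIndep I₁ I₂ V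
  maximum {S = S} refl cm best = cm , λ T (i , j) → subst₂ _≤_ (sym (∣∣≡# T)) (sym (∣tabulate∣ S))
    (best (lookup T) (trans (cong I₁ (tabulate∘lookup T)) i , trans (cong I₂ (tabulate∘lookup T)) j))

-- `D` lies just above n / T, so removing `D` elements pays for `n` queries at rate `T`. The
-- distance between `lo` and `hi` ensures that a refresh is preceded by the loss of `D` elements as
-- well.
detPars : ∀ n → ℕ → Pars n
detPars n ρ = record { a = a ; T = T ; Z = full ; pre = false ; lo = D ; hi = 2 * D ; h = T }
  where
  a = root 6 ρ
  T = a ^ 4
  D = suc (quot n T)

module DetBound {n : ℕ} (MA MB : Mat n) (1≤n : 1 ≤ n) where
  open Two MA MB
  open MachineL MA MB
  open Assembly MA MB 1≤n

  a T D d : ℕ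
  a = root 6 ρ
  T = a ^ 4
  D = suc (quot n T)
  d = suc (2 * ρ)

  1≤a : 1 ≤ a
  1≤a = proj₁ (root-spec 5 ρ)

  ρ≤ : ρ ≤ a * (a * T)
  ρ≤ = proj₁ (proj₂ (root-spec 5 ρ))

  a⁶≤ : a * (a * T) ≤ 64 * n
  a⁶≤ = ≤-trans (proj₂ (proj₂ (root-spec 5 ρ))) (*-monoʳ-≤ 64 (⊔-lub ρ≤n 1≤n))

  1≤aa : 1 ≤ a * a
  1≤aa = *-mono-≤ 1≤a 1≤a

  T≡ : T ≡ a * a * (a * a)
  T≡ = eq a
    where
    eq : ∀ a → a * (a * (a * (a * 1))) ≡ a * a * (a * a)
    eq = solve-∀

  a²≤T : a * a ≤ T
  a²≤T = ≤-trans (≤-trans (≤-reflexive (sym (*-identityʳ (a * a)))) (*-monoʳ-≤ (a * a) 1≤aa)) (≤-reflexive (sym T≡))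

  open Bounds a T 64 1≤a a²≤T ρ≤ a⁶≤

  DT≤ : D * T ≤ 65 * n
  DT≤ = begin
    T + quot n T * T   ≤⟨ +-mono-≤ (≤-trans (≤-trans (≤-reflexive (sym (*-identityˡ T))) (*-monoˡ-≤ T 1≤a)) G≤Mn) (quot-≤ n T 1≤T) ⟩
    64 * n + n         ≡⟨ eq n ⟩
    65 * n             ∎
    where
    open ≤-Reasoning
    eq : ∀ n → 64 * n + n ≡ 65 * n
    eq = solve-∀

  Cb : ℕ
  Cb = 4 * D * (a * a)

  capacity : ∀ d a t → 2 * d * (2 * (a * (a * t))) ≡ 4 * d * (a * a) * t
  capacity = solve-∀

  module DM = DetMode MA MB d D T T (2 * ρ) Cb 1≤T (≤-trans (quot-> n T 1≤T) (≤-reflexive (*-comm D T)))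
    (≤-trans (*-monoʳ-≤ (2 * D) (*-monoʳ-≤ 2 ρ≤)) (≤-reflexive (capacity D a T))) cap

  price : ℕ
  price = DM.P₀ + n + d * L + (2 + L) * n

  price≤ : price ≤ 922 * (L * n * T)
  price≤ = begin
    n + 0 + T * (# Z + (# Z + 2 * D)) + (1 + L) * (n * T) + d * Cb + n + d * L + (2 + L) * n
      ≤⟨ +-monoˡ-≤ ((2 + L) * n) (+-mono-≤ (+-monoˡ-≤ n (+-mono-≤ (+-monoˡ-≤ ((1 + L) * (n * T)) (+-monoʳ-≤ (n + 0) (*-monoʳ-≤ T (+-mono-≤ (#≤n Z) (+-monoˡ-≤ (2 * D) (#≤n Z)))))) dC)) (*-monoˡ-≤ L d≤)) ⟩
    n + 0 + T * (n + (n + 2 * D)) + (1 + L) * (n * T) + 780 * (n * T) + n + 3 * n * L + (2 + L) * n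
      ≡⟨ eq n T D L ⟩
    4 * n + 4 * (L * n) + 2 * (D * T) + 783 * (n * T) + L * n * T
      ≤⟨ +-monoˡ-≤ (L * n * T) (+-mono-≤ (+-mono-≤ (+-mono-≤ (*-monoʳ-≤ 4 n≤) (*-monoʳ-≤ 4 Ln≤)) (*-monoʳ-≤ 2 (≤-trans DT≤ (*-monoʳ-≤ 65 n≤)))) (*-monoʳ-≤ 783 nT≤)) ⟩
    4 * x + 4 * x + 2 * (65 * x) + 783 * x + x
      ≡⟨ eq₂ x ⟩
    922 * x ∎
    where
    open ≤-Reasoning
    Z : Pr n
    Z = full
    x = L * n * T
    Ln≤ : L * n ≤ x
    Ln≤ = ≤-trans (≤-reflexive (sym (*-identityʳ (L * n)))) (*-monoʳ-≤ (L * n) 1≤T)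
    n≤ : n ≤ x
    n≤ = ≤-trans n≤Ln Ln≤
    nT≤ : n * T ≤ x
    nT≤ = *-monoˡ-≤ T n≤Ln
    d≤ : d ≤ 3 * n
    d≤ = +-mono-≤ 1≤n (*-monoʳ-≤ 2 ρ≤n)
    -- The balance that fixes `T = a ^ 4`: O(a⁶) levels with O(D a²) elements at the cap give a⁴ D
    -- T, where `D * T` is O(n).
    dC : d * Cb ≤ 780 * (n * T)
    dC = begin
      (1 + 2 * ρ) * Cb                                   ≤⟨ *-monoˡ-≤ Cb (+-mono-≤ 1≤a²T (*-monoʳ-≤ 2 ρ≤)) ⟩
      (a * (a * T) + 2 * (a * (a * T))) * (4 * D * (a * a)) ≡⟨ e₁ a T D ⟩
      12 * (D * T * (a * a * (a * a)))                   ≡⟨ cong (λ z → 12 * (D * T * z)) (sym T≡) ⟩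
      12 * (D * T * T)                                   ≤⟨ *-monoʳ-≤ 12 (*-monoˡ-≤ T DT≤) ⟩
      12 * (65 * n * T)                                  ≡⟨ e₂ n T ⟩
      780 * (n * T)                                      ∎
      where
      1≤a²T : 1 ≤ a * (a * T)
      1≤a²T = *-mono-≤ 1≤a 1≤G
      e₁ : ∀ a t d → (a * (a * t) + 2 * (a * (a * t))) * (4 * d * (a * a)) ≡ 12 * (d * t * (a * a * (a * a)))
      e₁ = solve-∀
      e₂ : ∀ n t → 12 * (65 * n * t) ≡ 780 * (n * t)
      e₂ = solve-∀
    eq : ∀ n t d l → n + 0 + t * (n + (n + 2 * d)) + (1 + l) * (n * t) + 780 * (n * t) + n + 3 * n * l + (2 + l) * n
         ≡ 4 * n + 4 * (l * n) + 2 * (d * t) + 783 * (n * t) + l * n * t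
    eq = solve-∀
    eq₂ : ∀ x → 4 * x + 4 * x + 2 * (65 * x) + 783 * x + x ≡ 922 * x
    eq₂ = solve-∀

  -- 3378 = 36 + 9 · 64 + 3 · 922, with 64 = 2⁶ from rounding the sixth root.
  det-total : wp (matroidIntersection (detPars n)) (λ V k → ∃ λ S → V ≡ tabulate S × Common S × (∀ T → Common T → # T ≤ # S)
              × k ≤ 3378 * X)
  det-total = total {ps = detPars n} {922} {price} refl refl price≤ (λ (ℓ , mi) →
    exact-post {d} {Mem n} {mem₀} {Smart.smart full false D (2 * D) T} {DM.InvE} {DM.Pot} {λ _ → ⊤} {DM.P₀} {mem₀}
      {restart (val (approx {n} a T))} {val (exact d (detPars n ρ) (val (approx {n} a T)))}
      {cost (exact d (detPars n ρ) (val (approx {n} a T)))} {price} refl refl (≤-trans (m≤m+n DM.P₀ n) (≤-trans (m≤m+n _ (d * L)) (m≤m+n _ ((2 + L) * n))))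
      (DM.det-mach (fuel n d) _ _ _ (λ _ _ → tt) mi (fuel-ok d _)))

module DetCorrect {n : ℕ} (1≤n : 1 ≤ n) {I₁ I₂ : Oracle n} (m₁ : IsMatroid I₁) (m₂ : IsMatroid I₂) where
  open Transfer m₁ m₂
  open DetBound MA MB 1≤n
  open Two MA MB using (val; cost)
  open Assembly MA MB 1≤n using (ρ; Common; greedy-spec)

  tree : QTree n
  tree = toTree (matroidIntersection (detPars n))

  Goal : Subset n × ℕ → Set
  Goal r = MaxCommonIndep I₁ I₂ (proj₁ r) × Bound56 (2 ^ 5 * 3378) n ∣ proj₁ r ∣ (proj₂ r)

  det-correct : Goal (run tree I₁ I₂)
  det-correct = subst Goal (sym (run≡ (matroidIntersection (detPars n)))) (conv det-total)
    where
    conv : ∀ {V q} → (∃ λ S → V ≡ tabulate S × Common S × (∀ T → Common T → # T ≤ # S) × q ≤ 3378 * (logn n * n * a ^ 5)) → Goal (V , q)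
    conv {q = q} (S , refl , cm , best , le) = maximum refl cm best ,
      root-bound 5 {q} {3378} {logn n} {n} {a} {ρ} {∣ tabulate S ∣} le (proj₂ (proj₂ (root-spec 5 ρ)))
      (subst (ρ ≤_) (sym (∣tabulate∣ S)) (best (Auc.S (val greedy)) (proj₁ greedy-spec)))

deterministic : DeterministicClaim
deterministic = alg , 2 ^ 5 * 3378 , correct
  where
  alg : DetAlg
  alg zero    = leaf ∅S
  alg (suc k) = toTree (matroidIntersection (detPars (suc k)))
  correct : ∀ n (I₁ I₂ : Oracle n) → IsMatroid I₁ → IsMatroid I₂ →
            MaxCommonIndep I₁ I₂ (output (alg n) I₁ I₂) × Bound56 (2 ^ 5 * 3378) n ∣ output (alg n) I₁ I₂ ∣ (queries (alg n) I₁ I₂)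
  correct zero I₁ I₂ m₁ m₂ = ((IsMatroid.empty m₁ , IsMatroid.empty m₂) , λ { [] _ → z≤n }) , z≤n
  correct (suc k) I₁ I₂ m₁ m₂ = DetCorrect.det-correct (s≤s z≤n) m₁ m₂

-- The sample size depends on the greedy pass, so `Z` is a family of samples indexed by the number
-- of draws.
randPars : ∀ n → ℕ → (ℕ → Pr n) → ℕ → Pars n
randPars n s Z ρ = record { a = a ; T = a ^ 2 ; Z = Z (2 * a ^ 2 * s) ; pre = true ; lo = 1 ; hi = 1 ; h = suc n }
  where a = root 4 ρ

module RandBound {n : ℕ} (MA MB : Mat n) (1≤n : 1 ≤ n) where
  open Two MA MB
  open MachineL MA MB
  open StageL MA MB using (next)
  open Assembly MA MB 1≤n

  a T D d : ℕ
  a = root 4 ρ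
  T = a ^ 2
  D = quot n T
  d = suc (2 * ρ)

  1≤a : 1 ≤ a
  1≤a = proj₁ (root-spec 3 ρ)

  ρ≤ : ρ ≤ a * (a * T)
  ρ≤ = proj₁ (proj₂ (root-spec 3 ρ))

  a⁴≤ : a * (a * T) ≤ 16 * n
  a⁴≤ = ≤-trans (proj₂ (proj₂ (root-spec 3 ρ))) (*-monoʳ-≤ 16 (⊔-lub ρ≤n 1≤n))

  T≡ : T ≡ a * a
  T≡ = cong (a *_) (*-identityʳ a)

  open Bounds a T 16 1≤a (≤-reflexive (sym T≡)) ρ≤ a⁴≤

  T-pos : 1 ≤ T
  T-pos = 1≤T

  T≤16n : T ≤ 16 * n
  T≤16n = ≤-trans (≤-trans (≤-reflexive (sym (*-identityˡ T))) (*-monoˡ-≤ T 1≤a)) G≤Mn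

  -- No random bit is used before this configuration, so it is common to all seeds.
  entry : Cfg n
  entry = restart (val (approx {n} a T))

  Result : Subset n → Set
  Result V = ∃ λ S → V ≡ tabulate S × Common S × (∀ T → Common T → # T ≤ # S)

  module Sampled (s : ℕ) (Z : ℕ → Pr n) where
    m : ℕ
    m = 2 * T * s

    module SM = SafeMode MA MB d (Z m) (2 * ρ) cap
    module RM = RandMode MA MB d D (Z m) (2 * ρ) cap

    safe-total : wp (matroidIntersection (randPars n s Z)) (λ V k → Result V)
    safe-total = let (S , e , cm , best , _) = total {ps = randPars n s Z} {price} {price} refl refl price≤
                       (λ (ℓ , mi) → exact-post {d} {Mem n} {mem₀} {Smart.smart (Z m) true 1 1 (suc n)} {SM.InvE} {SM.Pot} {λ _ → ⊤} {SM.P₀} {mem₀}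
                         {entry} {val (exact d (randPars n s Z ρ) (val (approx {n} a T)))} {cost (exact d (randPars n s Z ρ) (val (approx {n} a T)))} {price} refl refl
                         (≤-trans (m≤m+n SM.P₀ n) (≤-trans (m≤m+n _ (d * L)) (m≤m+n _ ((2 + L) * n))))
                         (SM.safe-mach (fuel n d) _ _ _ (λ _ _ → tt) mi (fuel-ok d _)))
                 in S , e , cm , best
      where
      price : ℕ
      price = SM.P₀ + n + d * L + (2 + L) * n
      -- The price itself may serve as the constant, because only correctness is extracted here.
      price≤ : price ≤ price * (L * n * T)
      price≤ = ≤-trans (≤-reflexive (sym (*-identityʳ price))) (*-monoʳ-≤ price (*-mono-≤ (*-mono-≤ 1≤L 1≤n) 1≤T))

    module _ (J : ℕ) (#Z≤ : # (Z m) ≤ J * (T * L)) where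

      price : ℕ
      price = RM.P₀ + n + d * L + (2 + L) * n

      price≤ : price ≤ (13 + 4 * J) * (L * n * T)
      price≤ = begin
        n + z * (2 * ρ) + n * (z + (z + 1)) + (1 + L) * (D * (2 * ρ)) + d * 0 + n + d * L + (2 + L) * n
          ≤⟨ +-monoˡ-≤ ((2 + L) * n) (+-mono-≤ (+-monoˡ-≤ n (+-monoˡ-≤ (d * 0) (+-mono-≤
               (+-mono-≤ (+-monoʳ-≤ n (*-mono-≤ #Z≤ (*-monoʳ-≤ 2 ρ≤n))) (*-monoʳ-≤ n (+-mono-≤ #Z≤ (+-monoˡ-≤ 1 #Z≤))))
               (*-mono-≤ (+-monoˡ-≤ L 1≤L) DR)))) (*-monoˡ-≤ L d≤)) ⟩
        n + J * (T * L) * (2 * n) + n * (J * (T * L) + (J * (T * L) + 1)) + (L + L) * (2 * (n * T)) + d * 0 + n + 3 * n * L + (2 + L) * n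
          ≡⟨ eq n J T L d ⟩
        5 * n + 4 * (L * n) + 4 * (L * n * T) + 4 * J * (L * n * T)
          ≤⟨ +-monoˡ-≤ (4 * J * x) (+-monoˡ-≤ (4 * x) (+-mono-≤ (*-monoʳ-≤ 5 (≤-trans n≤Ln Ln≤)) (*-monoʳ-≤ 4 Ln≤))) ⟩
        5 * x + 4 * x + 4 * x + 4 * J * x
          ≡⟨ eq₂ J x ⟩
        (13 + 4 * J) * x ∎
        where
        open ≤-Reasoning
        z = # (Z m)
        x = L * n * T
        Ln≤ : L * n ≤ x
        Ln≤ = ≤-trans (≤-reflexive (sym (*-identityʳ (L * n)))) (*-monoʳ-≤ (L * n) 1≤T)
        d≤ : d ≤ 3 * n
        d≤ = +-mono-≤ 1≤n (*-monoʳ-≤ 2 ρ≤n)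
        -- The balance that fixes `T = a ^ 2`: `D * T` is at most `n` and ρ is at most a² T.
        DR : D * (2 * ρ) ≤ 2 * (n * T)
        DR = begin
          D * (2 * ρ)              ≤⟨ *-monoʳ-≤ D (*-monoʳ-≤ 2 ρ≤) ⟩
          D * (2 * (a * (a * T)))  ≡⟨ e D a T ⟩
          2 * (D * T * (a * a))    ≤⟨ *-monoʳ-≤ 2 (*-mono-≤ (quot-≤ n T 1≤T) (≤-reflexive (sym T≡))) ⟩
          2 * (n * T)              ∎
          where
          e : ∀ d a t → d * (2 * (a * (a * t))) ≡ 2 * (d * t * (a * a))
          e = solve-∀
        eq : ∀ n j t l d → n + j * (t * l) * (2 * n) + n * (j * (t * l) + (j * (t * l) + 1)) + (l + l) * (2 * (n * t)) + d * 0 + n + 3 * n * l + (2 + l) * n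
             ≡ 5 * n + 4 * (l * n) + 4 * (l * n * t) + 4 * j * (l * n * t)
        eq = solve-∀
        eq₂ : ∀ j x → 5 * x + 4 * x + 4 * x + 4 * j * x ≡ (13 + 4 * j) * x
        eq₂ = solve-∀

      fast : (∀ (i : ℕ) → i < fuel n d → Hit MA MB (Z m) D (iter next i entry)) →
             cost (matroidIntersection (randPars n s Z)) ≤ (180 + 3 * (13 + 4 * J)) * X
      fast hit = let (_ , _ , _ , _ , le) = total {ps = randPars n s Z} {13 + 4 * J} {price} refl refl price≤
                       (λ (ℓ , mi) → exact-post {d} {Mem n} {mem₀} {Smart.smart (Z m) true 1 1 (suc n)} {RM.InvE} {RM.Pot} {Hit MA MB (Z m) D} {RM.P₀} {mem₀}
                         {entry} {val (exact d (randPars n s Z ρ) (val (approx {n} a T)))} {cost (exact d (randPars n s Z ρ) (val (approx {n} a T)))} {price} refl refl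
                         (≤-trans (m≤m+n RM.P₀ n) (≤-trans (m≤m+n _ (d * L)) (m≤m+n _ ((2 + L) * n))))
                         (RM.rand-mach (fuel n d) _ _ _ hit mi (fuel-ok d _)))
                 in le

seedBits : ℕ → ℕ
seedBits n = ⌈log₂ n ⌉

-- 2 ^ rate has to beat n ^ c times the at most 8 n³ pairs of a configuration and an element.
rate draws : ℕ → ℕ → ℕ
rate  c n = (c + 6) * logn n
draws c n = 32 * n * rate c n

spread : ∀ k f x N t → 1 ≤ f → k * N ≤ f * t → f * x ≤ N → k * x ≤ t
spread k f x N t 1≤f h h′ = *-cancelˡ-≤ f {{>-nonZero 1≤f}} (begin
  f * (k * x)   ≡⟨ eq f k x ⟩
  k * (f * x)   ≤⟨ *-monoʳ-≤ k h′ ⟩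
  k * N         ≤⟨ h ⟩
  f * t         ∎)
  where
  open ≤-Reasoning
  eq : ∀ f k x → f * (k * x) ≡ k * (f * x)
  eq = solve-∀

fuel-pos : ∀ n ρ → 1 ≤ fuel n (suc (2 * ρ))
fuel-pos n ρ = ≤-trans (s≤s z≤n) (m≤n+m (suc (2 * ρ)) (n * suc (suc (2 * ρ))))

fuel-rate : ∀ c n ρ → 1 ≤ n → ρ ≤ n → fuel n (suc (2 * ρ)) * n * n ^ c ≤ 2 ^ rate c n
fuel-rate c n ρ 1≤n ρ≤n = begin
  fuel n d * n * n ^ c                 ≤⟨ *-monoˡ-≤ (n ^ c) (*-monoˡ-≤ n F≤) ⟩
  8 * (n * n) * n * n ^ c              ≡⟨ eq n (n ^ c) ⟩
  2 ^ 3 * n ^ (3 + c)                  ≤⟨ *-mono-≤ (^-monoʳ-≤ 2 {3} {3 * L} (*-monoʳ-≤ 3 {1} {L} (m≤n⊔m ⌈log₂ n ⌉ 1))) (^-monoˡ-≤ (3 + c) {n} {2 ^ L} (n≤2^logn n)) ⟩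
  2 ^ (3 * L) * (2 ^ L) ^ (3 + c)      ≡⟨ cong (2 ^ (3 * L) *_) (^-*-assoc 2 L (3 + c)) ⟩
  2 ^ (3 * L) * 2 ^ (L * (3 + c))      ≡⟨ sym (^-distribˡ-+-* 2 (3 * L) (L * (3 + c))) ⟩
  2 ^ (3 * L + L * (3 + c))            ≡⟨ cong (2 ^_) (eq₂ L c) ⟩
  2 ^ ((c + 6) * L)                    ∎
  where
  open ≤-Reasoning
  L d : ℕ
  L = logn n
  d = suc (2 * ρ)
  eq : ∀ n x → 8 * (n * n) * n * x ≡ 8 * (n * (n * (n * x)))
  eq = solve-∀
  eq₂ : ∀ l c → 3 * l + l * (3 + c) ≡ (c + 6) * l
  eq₂ = solve-∀
  d≤ : d ≤ 3 * n
  d≤ = +-mono-≤ 1≤n (*-monoʳ-≤ 2 ρ≤n)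
  n≤nn : n ≤ n * n
  n≤nn = ≤-trans (≤-reflexive (sym (*-identityʳ n))) (*-monoʳ-≤ n 1≤n)
  F≤ : fuel n d ≤ 8 * (n * n)
  F≤ = begin
    n * suc d + d                        ≤⟨ +-mono-≤ (*-monoʳ-≤ n (+-mono-≤ 1≤n d≤)) d≤ ⟩
    n * (n + 3 * n) + 3 * n              ≡⟨ e₁ n ⟩
    4 * (n * n) + 3 * n                  ≤⟨ +-monoʳ-≤ (4 * (n * n)) (*-monoʳ-≤ 3 n≤nn) ⟩
    4 * (n * n) + 3 * (n * n)            ≤⟨ m≤n+m _ (n * n) ⟩
    n * n + (4 * (n * n) + 3 * (n * n))  ≡⟨ e₂ (n * n) ⟩
    8 * (n * n)                          ∎
    where
    e₁ : ∀ n → n * (n + 3 * n) + 3 * n ≡ 4 * (n * n) + 3 * n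
    e₁ = solve-∀
    e₂ : ∀ x → x + (4 * x + 3 * x) ≡ 8 * x
    e₂ = solve-∀

-- The length of the seed may depend only on `n`, so it suffices for the largest sample; a run reads
-- just the first `m` blocks.
sampleOf : ∀ c n → Vec Bool (draws c n * seedBits n) → ℕ → Pr n
sampleOf c n seed m = sampled (seedBits n) m (draws c n) seed

module RandCorrect (c : ℕ) {n : ℕ} (1≤n : 1 ≤ n) {I₁ I₂ : Oracle n} (m₁ : IsMatroid I₁) (m₂ : IsMatroid I₂) where
  open Transfer m₁ m₂
  open RandBound MA MB 1≤n
  open Two MA MB using (val; cost; L)
  open Assembly MA MB 1≤n using (ρ; Common; greedy-spec; ρ≤n; 1≤L)
  open StageL MA MB using (next)

  s J C₁ bitsN F : ℕ
  s = rate c n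
  J = 2 * (c + 6)
  C₁ = 180 + 3 * (13 + 4 * J)
  bitsN = draws c n * seedBits n
  F = fuel n d

  prog : Vec Bool bitsN → Q n (Subset n)
  prog seed = matroidIntersection (randPars n s (sampleOf c n seed))

  tree : Vec Bool bitsN → QTree n
  tree seed = toTree (prog seed)

  correct : ∀ seed → MaxCommonIndep I₁ I₂ (output (tree seed) I₁ I₂)
  correct seed = subst (λ r → MaxCommonIndep I₁ I₂ (proj₁ r)) (sym (run≡ (prog seed))) (conv (Sampled.safe-total s (sampleOf c n seed)))
    where
    conv : ∀ {V} → Result V → MaxCommonIndep I₁ I₂ V
    conv (S , e , cm , best) = maximum e cm best

  slow : Vec Bool bitsN → Bool
  slow seed = exceeds34 (2 ^ 3 * C₁) n ∣ output (tree seed) I₁ I₂ ∣ (queries (tree seed) I₁ I₂)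

  m : ℕ
  m = 2 * T * s

  target : Fin F → Fin n → Pr n
  target i y = outs MA MB (iter next (toℕ i) entry) y

  -- Out-neighbourhoods of size at most `D` satisfy `Hit` for every sample, so only larger ones
  -- enter the union bound.
  missed : Fin F → Fin n → Vec Bool bitsN → Bool
  missed i y seed = (suc D ≤ᵇ # (target i y)) ∧ misses (seedBits n) m (draws c n) (target i y) seed

  quick : ∀ seed → (∀ i y → missed i y seed ≡ false) → slow seed ≡ false
  quick seed none = ¬true⇒false λ e → <⇒≱ (<ᵇ-t⁻ e) (subst (λ r → Bounded r) (sym (run≡ (prog seed))) bound)
    where
    Bounded : Subset n × ℕ → Set
    Bounded r = proj₂ r ^ 4 ≤ (2 ^ 3 * C₁) ^ 4 * n ^ 4 * r⁺ ∣ proj₁ r ∣ ^ 3 * logn n ^ 4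
    <ᵇ-t⁻ : ∀ {x y} → (x <ᵇ y) ≡ true → x < y
    <ᵇ-t⁻ {x} = ≤ᵇ-t⁻ {suc x}
    open Sampled s (sampleOf c n seed) using (fast; safe-total)
    #Z≤ : # (sampleOf c n seed m) ≤ J * (T * L)
    #Z≤ = ≤-trans (#-sampled {n} (seedBits n) m (draws c n) seed) (≤-reflexive (eq T c L))
      where
      eq : ∀ t c l → 2 * t * ((c + 6) * l) ≡ 2 * (c + 6) * (t * l)
      eq = solve-∀
    hit : ∀ i → i < F → Hit MA MB (sampleOf c n seed m) D (iter next i entry)
    hit i lt y y∈ out = subst (λ j → # (outs MA MB (iter next j entry) y) ≤ D) (toℕ-fromℕ< lt) (case ∧-cases-f (none i′ y) of λ
        { (inj₁ q) → ≤-pred (≤ᵇ-f⁻ q)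
        ; (inj₂ q) → let (v , v∈ , v∈Z) = misses-f (seedBits n) m (draws c n) (target i′ y) seed q
                     in absurd v∈ (subst (λ j → v ∉ outs MA MB (iter next j entry) y) (sym (toℕ-fromℕ< lt)) (out v v∈Z)) })
      where
      i′ : Fin F
      i′ = fromℕ< lt
    bound : Bounded (val (prog seed) , cost (prog seed))
    bound = conv safe-total (fast J #Z≤ hit)
      where
      conv : ∀ {V q} → Result V → q ≤ C₁ * (logn n * n * a ^ 3) → Bounded (V , q)
      conv {q = q} (S , refl , cm , best) le = root-bound 3 {q} {C₁} {logn n} {n} {a} {ρ} {∣ tabulate S ∣} le (proj₂ (proj₂ (root-spec 3 ρ)))
        (subst (ρ ≤_) (sym (∣tabulate∣ S)) (best (Auc.S (val greedy)) (proj₁ greedy-spec)))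

  each : ∀ i y → count bitsN (missed i y) * 2 ^ s ≤ 2 ^ bitsN
  each i y with suc D ≤ᵇ # (target i y) in e
  ... | false = ≤-trans (≤-reflexive (cong (_* 2 ^ s) (count-false bitsN))) z≤n
  ... | true = subst (λ z → count bitsN (misses (seedBits n) (z * s) (draws c n) (target i y)) * 2 ^ s ≤ 2 ^ bitsN) 2T≡
      (rare (seedBits n) (2 * T ∸ 1) (target i y) (n≤2^⌈log₂n⌉ n) big s (draws c n) fits)
    where
    2T≡ : suc (2 * T ∸ 1) ≡ 2 * T
    2T≡ = m+[n∸m]≡n (≤-trans T-pos (m≤m+n T _))
    -- The factor 2 in the number of draws makes up for blocks that range over a power of two, which
    -- may be up to twice `n`.
    big : 2 ^ seedBits n ≤ suc (2 * T ∸ 1) * # (target i y)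
    big = begin
      2 ^ ⌈log₂ n ⌉                          ≤⟨ 2^⌈log₂n⌉≤2n n 1≤n ⟩
      2 * n                                  ≤⟨ *-monoʳ-≤ 2 (≤-trans (quot-> n T T-pos) (*-monoˡ-≤ T {suc D} {# (target i y)} (≤ᵇ-t⁻ e))) ⟩
      2 * (# (target i y) * T)               ≡⟨ eq (# (target i y)) T ⟩
      2 * T * # (target i y)                 ≡⟨ cong (_* # (target i y)) (sym 2T≡) ⟩
      suc (2 * T ∸ 1) * # (target i y)       ∎
      where
      open ≤-Reasoning
      eq : ∀ x t → 2 * (x * t) ≡ 2 * t * x
      eq = solve-∀
    fits : suc (2 * T ∸ 1) * s ≤ draws c n
    fits = *-monoˡ-≤ s {suc (2 * T ∸ 1)} {32 * n} (≤-trans (≤-reflexive 2T≡) (≤-trans (*-monoʳ-≤ 2 T≤16n) (≤-reflexive (sym (*-assoc 2 16 n)))))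

  union : count bitsN slow * 2 ^ s ≤ F * n * 2 ^ bitsN
  union = union-bound bitsN (2 ^ s) slow missed quick each

  seldom : count bitsN slow * n ^ c ≤ 2 ^ bitsN
  seldom = spread (count bitsN slow) (F * n) (n ^ c) (2 ^ s) (2 ^ bitsN) (*-mono-≤ (fuel-pos n ρ) 1≤n) union (fuel-rate c n ρ 1≤n ρ≤n)

scale : ℕ → ℕ
scale c = 2 ^ 3 * (180 + 3 * (13 + 4 * (2 * (c + 6))))

searchAlg : ℕ → RandAlg
searchAlg c = record { bits = λ n → draws c n * seedBits n ; tree = tree }
  where
  tree : ∀ n → Vec Bool (draws c n * seedBits n) → QTree n
  tree zero    _    = leaf ∅S
  tree (suc k) seed = toTree (matroidIntersection (randPars (suc k) (rate c (suc k)) (sampleOf c (suc k) seed)))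

no-slow : ∀ m k → count m (λ _ → false) * k ≤ 2 ^ m
no-slow m k = ≤-trans (≤-reflexive (cong (_* k) (count-false m))) z≤n

randomized : RandomizedClaim
randomized c = searchAlg c , scale c , λ
  { zero    I₁ I₂ m₁ m₂ → (λ _ → (IsMatroid.empty m₁ , IsMatroid.empty m₂) , λ { [] _ → z≤n }) , no-slow (draws c 0 * seedBits 0) (0 ^ c)
  ; (suc k) I₁ I₂ m₁ m₂ → RandCorrect.correct c (s≤s z≤n) m₁ m₂ , RandCorrect.seldom c (s≤s z≤n) m₁ m₂ }

theorem2 : RandomizedClaim × DeterministicClaim
theorem2 = randomized , deterministic
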